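{- There exists an integer $n_0$ such that for every $n>n_0$, if $G$ minimizes $t(G)+i(G)$ among all $n$-vertex oriented graphs, then $G\in\mathcal E_n$.
   Context: An oriented graph is a directed graph with no loops and no multiple (parallel or anti-parallel) edges. For an oriented graph $G$, $t(G)$ (resp. $i(G)$) is the probability that a uniformly random $3$-set of vertices induces a transitive triangle (resp. an independent set). $\mathcal B_n=(V,E)$ is the oriented graph whose vertex set $V$ is the disjoint union of $V_0,V_1,V_2$ with $|V_i|=\lfloor (n+i)/3\rfloor$, and whose edge set consists of all directed edges from $V_i$ to $V_{i+1\bmod 3}$, $0\le i\le 2$. $\mathcal M_n$ is the family of all triangle-free $n$-vertex oriented graphs on the vertex set $V$ which are the union of three matchings: one between $V_0$ and $V_1$, one between $V_1$ and $V_2$, and one between $V_2$ and $V_0$. $\mathcal E_n=\{\mathcal B_n\setminus H : H\in\mathcal M_n\}$, where $\mathcal B_n\setminus H$ is obtained from $\mathcal B_n$ by deleting the edges of $H$. -}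

module Defs where

open import Data.Nat using (ℕ; zero; suc; _+_; _≤_; _<_; _<ᵇ_; _≡ᵇ_; _/_; _%_)
open import Data.Bool using (Bool; true; false; _∧_; _∨_; not; if_then_else_)
open import Data.Fin using (Fin; toℕ)
open import Data.List using (List; map; allFin)
open import Data.Nat.ListAction using (sum)
open import Data.Product using (Σ; ∃; _×_; _,_)
open import Data.Empty using (⊥)
open import Data.Fin.Permutation using (Permutation′; _⟨$⟩ʳ_)
open import Relation.Binary.PropositionalEquality using (_≡_)

record OrientedGraph (n : ℕ) : Set where
  field
    adj     : Fin n → Fin n → Bool
    noLoop  : ∀ v → adj v v ≡ false
    noAnti  : ∀ u v → adj u v ≡ true → adj v u ≡ false
open OrientedGraph public

adjacent : {n : ℕ} → (Fin n → Fin n → Bool) → Fin n → Fin n → Bool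
adjacent E u v = E u v ∨ E v u

transitiveTriple : {n : ℕ} → (Fin n → Fin n → Bool) → Fin n → Fin n → Fin n → Bool
transitiveTriple E u v w =
  adjacent E u v ∧ adjacent E v w ∧ adjacent E u w
  ∧ not ((E u v ∧ E v w ∧ E w u) ∨ (E u w ∧ E w v ∧ E v u))

independentTriple : {n : ℕ} → (Fin n → Fin n → Bool) → Fin n → Fin n → Fin n → Bool
independentTriple E u v w =
  not (adjacent E u v ∨ adjacent E v w ∨ adjacent E u w)

count3 : (n : ℕ) → (Fin n → Fin n → Fin n → Bool) → ℕ
count3 n P =
  sum (map (λ u → sum (map (λ v → sum (map (λ w →
    if (toℕ u <ᵇ toℕ v) ∧ (toℕ v <ᵇ toℕ w) ∧ P u v w then 1 else 0)
    (allFin n))) (allFin n))) (allFin n))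

-- T(G) = t(G)·C(n,3), I(G) = i(G)·C(n,3)  (numbers of such 3-sets)
numTransitive : {n : ℕ} → OrientedGraph n → ℕ
numTransitive {n} G = count3 n (transitiveTriple (adj G))

numIndependent : {n : ℕ} → OrientedGraph n → ℕ
numIndependent {n} G = count3 n (independentTriple (adj G))

-- G minimizes t(G)+i(G) = (T(G)+I(G)) / C(n,3) among all n-vertex oriented graphs
IsMinimizer : {n : ℕ} → OrientedGraph n → Set
IsMinimizer {n} G =
  ∀ (G' : OrientedGraph n) →
    numTransitive G + numIndependent G ≤ numTransitive G' + numIndependent G'

-- The blow-up B_n : V = V₀ ⊎ V₁ ⊎ V₂ laid out consecutively in Fin n,
-- |V_i| = ⌊(n+i)/3⌋, edges V_i → V_{i+1 mod 3}

partSize : ℕ → ℕ → ℕ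
partSize n i = (n + i) / 3

part : {n : ℕ} → Fin n → ℕ
part {n} v =
  if toℕ v <ᵇ partSize n 0 then 0
  else if toℕ v <ᵇ partSize n 0 + partSize n 1 then 1
  else 2

B : (n : ℕ) → Fin n → Fin n → Bool
B n u v = part v ≡ᵇ (suc (part u) % 3)

-- H ∈ M_n : H a set of edges (taken inside B_n), triangle-free,
-- and a union of three matchings between V₀–V₁, V₁–V₂, V₂–V₀.
record InM (n : ℕ) (H : Fin n → Fin n → Bool) : Set where
  field
    subB          : ∀ u v → H u v ≡ true → B n u v ≡ true
    matching      : ∀ u v w → adjacent H u v ≡ true → adjacent H u w ≡ true →
                    part v ≡ part w → v ≡ w
    triangleFree  : ∀ u v w → adjacent H u v ≡ true → adjacent H v w ≡ true →
                    adjacent H u w ≡ true → ⊥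

InE : {n : ℕ} → OrientedGraph n → Set
InE {n} G =
  Σ (Permutation′ n) λ σ →
  Σ (Fin n → Fin n → Bool) λ H →
    InM n H ×
    (∀ u v → adj G (σ ⟨$⟩ʳ u) (σ ⟨$⟩ʳ v) ≡ (B n u v ∧ not (H u v)))

{-# OPTIONS --safe #-}

-- A flag-algebra certificate on four vertices shows that 9 Σ_{uvw} cost ≥ n³ over ordered triples with repetition, with
-- a surplus proportional to the number of 4-tuples that do not embed in the blow-up of the cyclic triangle minus an arc.
-- For a minimizer the surplus is O(n³), so some arc xy lies in O(n) bad 4-tuples, and splitting the vertices by their
-- relations to x and y gives a partition with o(n²) wrong pairs. Replacing a vertex by a clone of another one cannot
-- lower the objective, so all vertices have nearly the average cost n²/18; this forces every vertex to be joined to the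
-- parts almost as in the blow-up, and after moving o(n) vertices every vertex is in few wrong pairs. Now each edge inside
-- a part and each reversed arc creates more transitive triangles than it destroys independent triples, while a missing
-- arc costs nothing by itself, so the minimum is reached only by balanced parts with missing arcs that create no
-- independent triple.
module Submission where

open import Defs
open import Data.Bool using (Bool; true; false; _∧_; _∨_; not; if_then_else_)
import Data.Bool.Properties as Bool
open import Data.Empty using (⊥)
open import Data.Fin using (Fin; zero; suc; toℕ; fromℕ<; punchIn)
open import Data.Fin.Patterns using (0F; 1F; 2F; 3F)
open import Data.Fin.Permutation as Permutation using (Permutation′; _⟨$⟩ʳ_; _⟨$⟩ˡ_; inverseˡ; insert)
open import Data.Fin.Properties using (all?; any?; _≟_; toℕ-injective)
import Data.Integer as ℤ
import Data.Integer.Properties as ℤ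
open import Data.Integer.Tactic.RingSolver using (solve-∀)
open import Data.List using (List; []; _∷_; tabulate; allFin; map)
open import Data.List.Properties using (map-tabulate)
open import Data.Nat as ℕ using (ℕ; _<ᵇ_; _≡ᵇ_; _/_; _%_)
open import Data.Nat.Divisibility using (divides-refl)
open import Data.Nat.DivMod using (m≡m%n+[m/n]*n; m%n<n; m*n/n≡m; +-distrib-/-∣ʳ; /-monoˡ-≤)
import Data.Nat.ListAction as List
import Data.Nat.Properties as ℕ
open import Data.Nat.Tactic.RingSolver using () renaming (solve-∀ to solveℕ-∀)
open import Data.Product using (Σ; ∃; _×_; _,_; proj₁; proj₂)
open import Data.Sum using (_⊎_; inj₁; inj₂)
open import Function using (_∋_; Equivalence)
open import Relation.Binary.Definitions using (tri<; tri≈; tri>)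
open import Relation.Binary.PropositionalEquality using (_≡_; _≢_; refl; sym; trans; cong; cong₂; subst; subst₂)
open import Relation.Nullary using (¬_; contradiction)
open import Relation.Nullary.Decidable using (Dec; does; yes; no; from-yes; _→-dec_; _⊎-dec_; _×-dec_)

-- Deleting one arc of the blow-up changes neither count: its ends have no common non-neighbour, and
-- every triangle through it is cyclic. Hence a tight certificate must vanish on the blow-up minus
-- an arc, and missing arcs are invisible to first order. They are caught to second order: two
-- defects at one arc do produce slack, so the slack bounds sums of squares. Square roots are
-- avoided by writing `L * x ≤ N` with a fixed large `L` in place of x = o(N). The constants are
-- chosen backwards from the local argument: `m` = 20 makes the wrong neighbours of a vertex at most
-- n/25, `M` = 7 + 3m² is the precision needed for the part sizes, `L` = 366M² the precision needed
-- for the partition, and n has to exceed L²K. Two objectives occur. Tuples with repetition turn the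
-- flag sums into exact squares, while the graph objective counts distinct triples; the first sum
-- exceeds the second by at most 3n².

private variable n : ℕ

-- Integer inequalities and iterated finite sums.

module FiniteSums where

  open import Data.Integer hiding (suc; _≟_; _/_; _%_)
  open import Data.Integer.Properties hiding (_≟_)
  open import Algebra.Properties.Semiring.Sum +-*-semiring public
    using (sum; sum-cong-≗; ∑-distrib-+; ∑-comm; *-distribˡ-sum; *-distribʳ-sum; sum-remove)

  +-nonneg : ∀ {a b} → 0ℤ ≤ a → 0ℤ ≤ b → 0ℤ ≤ a + b
  +-nonneg p q = +-mono-≤ p q

  *-nonneg : ∀ {a b} → 0ℤ ≤ a → 0ℤ ≤ b → 0ℤ ≤ a * b
  *-nonneg {a} {b} p q = subst (_≤ a * b) (*-zeroʳ a) (*-monoˡ-≤-nonNeg a {{nonNegative p}} q)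

  0≤pos : ∀ n → 0ℤ ≤ + n
  0≤pos n = +≤+ ℕ.z≤n

  square-nonneg : ∀ a → 0ℤ ≤ a * a
  square-nonneg (+ n) = *-nonneg (0≤pos n) (0≤pos n)
  square-nonneg -[1+ n ] = +≤+ ℕ.z≤n

  -- The form of most inequalities below: `c` combines known nonnegative differences with
  -- nonnegative multipliers, and the equation is left to the ring solver.
  ≤-by : ∀ {a b} c → 0ℤ ≤ c → b - a ≡ c → a ≤ b
  ≤-by c p e = 0≤i-j⇒j≤i (subst (0ℤ ≤_) (sym e) p)

  Δ : ∀ {a b} → a ≤ b → 0ℤ ≤ b - a
  Δ = i≤j⇒0≤j-i

  cancel-< : ∀ {a b} c → 0ℤ ≤ c → c * a < c * b → a < b
  cancel-< {a} {b} c p q = *-cancelˡ-<-nonNeg c {{nonNegative p}} q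

  sum-mono : {f g : Fin n → ℤ} → (∀ i → f i ≤ g i) → sum f ≤ sum g
  sum-mono {ℕ.zero}  h = ≤-refl
  sum-mono {ℕ.suc n} h = +-mono-≤ (h zero) (sum-mono (λ i → h (suc i)))

  sum-const : ∀ n c → sum {n} (λ _ → c) ≡ + n * c
  sum-const ℕ.zero    c = refl
  sum-const (ℕ.suc n) c = trans (cong (λ x → c + x) (sum-const n c)) (sym ([1+m]*n≡n+m*n n c))
    where
    [1+m]*n≡n+m*n : ∀ n c → + ℕ.suc n * c ≡ c + + n * c
    [1+m]*n≡n+m*n n c = trans (*-distribʳ-+ c 1ℤ (+ n)) (cong (λ x → x + + n * c) (*-identityˡ c))

  sum-0 : ∀ n → sum {n} (λ _ → 0ℤ) ≡ 0ℤ
  sum-0 n = trans (sum-const n 0ℤ) (*-zeroʳ (+ n))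

  sum-nonneg : {f : Fin n → ℤ} → (∀ i → 0ℤ ≤ f i) → 0ℤ ≤ sum f
  sum-nonneg {n} {f} h = subst (_≤ sum f) (sum-0 n) (sum-mono h)

  sum-*ˡ : ∀ c (f : Fin n → ℤ) → sum (λ i → c * f i) ≡ c * sum f
  sum-*ˡ c f = sym (*-distribˡ-sum c f)

  sum-*ʳ : ∀ c (f : Fin n → ℤ) → sum (λ i → f i * c) ≡ sum f * c
  sum-*ʳ c f = sym (*-distribʳ-sum c f)

  sum-neg : (f : Fin n → ℤ) → sum (λ i → - f i) ≡ - sum f
  sum-neg f = trans (sum-cong-≗ (λ i → sym (-1*i≡-i (f i)))) (trans (sum-*ˡ -1ℤ f) (-1*i≡-i (sum f)))

  sum-sub : (f g : Fin n → ℤ) → sum (λ i → f i - g i) ≡ sum f - sum g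
  sum-sub f g = trans (∑-distrib-+ f (λ i → - g i)) (cong (λ x → sum f + x) (sum-neg g))

  term≤sum : {f : Fin n → ℤ} → (∀ i → 0ℤ ≤ f i) → ∀ i → f i ≤ sum f
  term≤sum {f = f} h zero    = subst (_≤ sum f) (+-identityʳ (f zero)) (+-monoʳ-≤ (f zero) (sum-nonneg (λ i → h (suc i))))
  term≤sum {f = f} h (suc i) = subst (_≤ sum f) (+-identityˡ (f (suc i))) (+-mono-≤ (h zero) (term≤sum (λ i → h (suc i)) i))

  sum-product : ∀ {m} (f : Fin n → ℤ) (g : Fin m → ℤ) → sum (λ i → sum (λ j → f i * g j)) ≡ sum f * sum g
  sum-product f g = trans (sum-cong-≗ (λ i → sum-*ˡ (f i) g)) (sum-*ʳ (sum g) f)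

  sum-<⇒∃ : (f g : Fin n → ℤ) → sum f < sum g → ∃ λ i → f i < g i
  sum-<⇒∃ {ℕ.zero}  f g (+<+ ())
  sum-<⇒∃ {ℕ.suc n} f g lt with f zero <? g zero
  ... | yes p = zero , p
  ... | no  f≮g with sum-<⇒∃ (λ i → f (suc i)) (λ i → g (suc i))
                     (≰⇒> λ g≤f → <⇒≱ lt (+-mono-≤ (≮⇒≥ f≮g) g≤f))
  ...   | i , q = suc i , q

  sum² : (Fin n → Fin n → ℤ) → ℤ
  sum² h = sum λ a → sum λ b → h a b

  sum³ : (Fin n → Fin n → Fin n → ℤ) → ℤ
  sum³ h = sum λ a → sum² (h a)

  sum⁴ : (Fin n → Fin n → Fin n → Fin n → ℤ) → ℤ
  sum⁴ h = sum λ a → sum³ (h a)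

  sum²-cong : {g h : Fin n → Fin n → ℤ} → (∀ a b → g a b ≡ h a b) → sum² g ≡ sum² h
  sum²-cong e = sum-cong-≗ λ a → sum-cong-≗ (e a)

  sum³-cong : {g h : Fin n → Fin n → Fin n → ℤ} → (∀ a b c → g a b c ≡ h a b c) → sum³ g ≡ sum³ h
  sum³-cong e = sum-cong-≗ λ a → sum²-cong (e a)

  sum⁴-cong : {g h : Fin n → Fin n → Fin n → Fin n → ℤ} → (∀ a b c d → g a b c d ≡ h a b c d) → sum⁴ g ≡ sum⁴ h
  sum⁴-cong e = sum-cong-≗ λ a → sum³-cong (e a)

  sum²-mono : {g h : Fin n → Fin n → ℤ} → (∀ a b → g a b ≤ h a b) → sum² g ≤ sum² h
  sum²-mono e = sum-mono λ a → sum-mono (e a)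

  sum³-mono : {g h : Fin n → Fin n → Fin n → ℤ} → (∀ a b c → g a b c ≤ h a b c) → sum³ g ≤ sum³ h
  sum³-mono e = sum-mono λ a → sum²-mono (e a)

  sum²-+ : (g h : Fin n → Fin n → ℤ) → sum² (λ a b → g a b + h a b) ≡ sum² g + sum² h
  sum²-+ g h = trans (sum-cong-≗ λ a → ∑-distrib-+ (g a) (h a)) (∑-distrib-+ (λ a → sum (g a)) (λ a → sum (h a)))

  sum³-+ : (g h : Fin n → Fin n → Fin n → ℤ) → sum³ (λ a b c → g a b c + h a b c) ≡ sum³ g + sum³ h
  sum³-+ g h = trans (sum-cong-≗ λ a → sum²-+ (g a) (h a)) (∑-distrib-+ (λ a → sum² (g a)) (λ a → sum² (h a)))

  sum⁴-+ : (g h : Fin n → Fin n → Fin n → Fin n → ℤ) →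
    sum⁴ (λ a b c d → g a b c d + h a b c d) ≡ sum⁴ g + sum⁴ h
  sum⁴-+ g h = trans (sum-cong-≗ λ a → sum³-+ (g a) (h a)) (∑-distrib-+ (λ a → sum³ (g a)) (λ a → sum³ (h a)))

  sum²-*ˡ : ∀ c (h : Fin n → Fin n → ℤ) → sum² (λ a b → c * h a b) ≡ c * sum² h
  sum²-*ˡ c h = trans (sum-cong-≗ λ a → sum-*ˡ c (h a)) (sum-*ˡ c (λ a → sum (h a)))

  sum³-*ˡ : ∀ c (h : Fin n → Fin n → Fin n → ℤ) → sum³ (λ a b d → c * h a b d) ≡ c * sum³ h
  sum³-*ˡ c h = trans (sum-cong-≗ λ a → sum²-*ˡ c (h a)) (sum-*ˡ c (λ a → sum² (h a)))

  sum³-sub : (g h : Fin n → Fin n → Fin n → ℤ) → sum³ (λ a b c → g a b c - h a b c) ≡ sum³ g - sum³ h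
  sum³-sub g h = trans (sum-cong-≗ λ a → trans (sum-cong-≗ λ b → sum-sub (g a b) (h a b)) (sum-sub (λ b → sum (g a b)) (λ b → sum (h a b))))
    (sum-sub (λ a → sum² (g a)) (λ a → sum² (h a)))

  sum³-swap₁₂ : (h : Fin n → Fin n → Fin n → ℤ) → sum³ (λ a b c → h b a c) ≡ sum³ h
  sum³-swap₁₂ h = ∑-comm (λ a b → sum (λ c → h b a c))

  sum³-swap₂₃ : (h : Fin n → Fin n → Fin n → ℤ) → sum³ (λ a b c → h a c b) ≡ sum³ h
  sum³-swap₂₃ h = sum-cong-≗ λ a → ∑-comm (λ b c → h a c b)

  sum⁴-swap₁₂ : (h : Fin n → Fin n → Fin n → Fin n → ℤ) → sum⁴ (λ a b c d → h b a c d) ≡ sum⁴ h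
  sum⁴-swap₁₂ h = ∑-comm (λ a b → sum² (h b a))

  sum⁴-swap₂₃ : (h : Fin n → Fin n → Fin n → Fin n → ℤ) → sum⁴ (λ a b c d → h a c b d) ≡ sum⁴ h
  sum⁴-swap₂₃ h = sum-cong-≗ λ a → sum³-swap₁₂ (h a)

  sum⁴-swap₃₄ : (h : Fin n → Fin n → Fin n → Fin n → ℤ) → sum⁴ (λ a b c d → h a b d c) ≡ sum⁴ h
  sum⁴-swap₃₄ h = sum-cong-≗ λ a → sum³-swap₂₃ (h a)

  cancel-≤ : ∀ {a b} c → 0ℤ < c → c * a ≤ c * b → a ≤ b
  cancel-≤ {a} {b} c 0<c p = *-cancelˡ-≤-pos a b c {{positive 0<c}} p

  <-by : ∀ {a b} c → 0ℤ < c → b - a ≡ c → a < b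
  <-by {a} {b} c p e = subst₂ _<_ (+-identityʳ a) (lemma a b) (+-monoʳ-< a (subst (0ℤ <_) (sym e) p))
    where
    lemma : ∀ a b → a + (b - a) ≡ b
    lemma = solve-∀

  *-pos : ∀ {a b} → 0ℤ < a → 0ℤ < b → 0ℤ < a * b
  *-pos {a} {b} p q = subst (_< a * b) (*-zeroʳ a) (*-monoˡ-<-pos a {{positive p}} q)

  sum²-nonneg : {h : Fin n → Fin n → ℤ} → (∀ a b → 0ℤ ≤ h a b) → 0ℤ ≤ sum² h
  sum²-nonneg {h = h} p = sum-nonneg {f = λ a → sum (h a)} (λ a → sum-nonneg (p a))

  sum²-<⇒∃ : (g h : Fin n → Fin n → ℤ) → sum² g < sum² h → ∃ λ a → ∃ λ b → g a b < h a b
  sum²-<⇒∃ g h lt with sum-<⇒∃ (λ a → sum (g a)) (λ a → sum (h a)) lt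
  ... | a , lt₁ with sum-<⇒∃ (g a) (h a) lt₁
  ...   | b , lt₂ = a , b , lt₂

  sum²-transpose : (h : Fin n → Fin n → ℤ) → sum² (λ a b → h b a) ≡ sum² h
  sum²-transpose h = ∑-comm (λ a b → h b a)

  sum²-ignore₂ : (g : Fin n → ℤ) → sum² {n} (λ a _ → g a) ≡ + n * sum g
  sum²-ignore₂ {n} g = trans (sum-cong-≗ (λ a → sum-const n (g a))) (sum-*ˡ (+ n) g)

  sum²-ignore₁ : (g : Fin n → ℤ) → sum² {n} (λ _ b → g b) ≡ + n * sum g
  sum²-ignore₁ {n} g = sum-const n (sum g)

  sum³-ignore₃ : (h : Fin n → Fin n → ℤ) → sum³ {n} (λ a b _ → h a b) ≡ + n * sum² h
  sum³-ignore₃ {n} h = trans (sum²-cong (λ a b → sum-const n (h a b))) (sum²-*ˡ (+ n) h)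

  sum³-ignore₂ : (h : Fin n → Fin n → ℤ) → sum³ {n} (λ a _ c → h a c) ≡ + n * sum² h
  sum³-ignore₂ {n} h = trans (sum-cong-≗ (λ a → sum-const n (sum (h a)))) (sum-*ˡ (+ n) (λ a → sum (h a)))

  sum³-ignore₁ : (h : Fin n → Fin n → ℤ) → sum³ {n} (λ _ b c → h b c) ≡ + n * sum² h
  sum³-ignore₁ {n} h = sum-const n (sum² h)

  sum³-pairs : (h : Fin n → Fin n → ℤ) → sum³ (λ u v w → h u v + h v w + h u w) ≡ + 3 * (+ n * sum² h)
  sum³-pairs {n} h = trans (sum³-+ (λ u v w → h u v + h v w) (λ u _ w → h u w))
    (trans (cong₂ _+_ (trans (sum³-+ (λ u v _ → h u v) (λ _ v w → h v w)) (cong₂ _+_ (sum³-ignore₃ h) (sum³-ignore₁ h))) (sum³-ignore₂ h))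
      (thrice (+ n * sum² h)))
    where
    thrice : ∀ x → x + x + x ≡ + 3 * x
    thrice = solve-∀

  sum³-1 : ∀ n → sum³ {n} (λ _ _ _ → 1ℤ) ≡ + n * (+ n * + n)
  sum³-1 n = trans (sum³-ignore₃ {n} (λ _ _ → 1ℤ)) (cong (λ x → + n * x)
    (trans (sum²-ignore₂ {n} (λ _ → 1ℤ)) (cong (λ x → + n * x) (trans (sum-const n 1ℤ) (*-identityʳ (+ n))))))

open FiniteSums

-- The flag-algebra certificate on four vertices.

module Certificate where

  open import Data.Integer hiding (suc; _≟_; _/_; _%_)
  open import Data.Integer.Properties hiding (_≟_)

  -- A relation ρ u v is 0F for "not adjacent" (in particular u = v), 1F for u → v and 2F for v → u;
  -- tripleCost expects ρ u v, ρ v w, ρ u w in this order.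
  flip : Fin 3 → Fin 3
  flip 0F = 0F
  flip 1F = 2F
  flip 2F = 1F

  tripleCost : Fin 3 → Fin 3 → Fin 3 → ℤ
  tripleCost 0F 0F 0F = 1ℤ
  tripleCost 0F _  _  = 0ℤ
  tripleCost _  0F _  = 0ℤ
  tripleCost _  _  0F = 0ℤ
  tripleCost 1F 1F 2F = 0ℤ
  tripleCost 2F 2F 1F = 0ℤ
  tripleCost _  _  _  = 1ℤ

  Form : Set
  Form = (ℤ × ℤ × ℤ) × (ℤ × ℤ × ℤ) × (ℤ × ℤ × ℤ)

  select : ∀ {A : Set} → A × A × A → Fin 3 → A
  select (a , b , c) 0F = a
  select (a , b , c) 1F = b
  select (a , b , c) 2F = c

  ⟦_⟧ : Form → Fin 3 → Fin 3 → ℤ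
  ⟦ φ ⟧ a b = select (select φ a) b

  -- A rational solution, scaled to integers, of the flag-algebra semidefinite program on four vertices. The entry of a
  -- form in row a, column b is its value on the flag (ρ x z , ρ y z) = (a , b) over a pair x, y of the given relation;
  -- the forms vanish on the flag densities of the blow-up, also after deletion of one of its arcs.
  forms : Fin 3 → List (ℕ × Form)
  forms 0F = ( 4 , ((-[1+ 1 ] , 0ℤ , 0ℤ) , (0ℤ , 1ℤ , 0ℤ) , (0ℤ , 0ℤ , 1ℤ)))
           ∷ (12 , ((0ℤ , -1ℤ , 1ℤ) , (-1ℤ , -1ℤ , 0ℤ) , (1ℤ , 0ℤ , 1ℤ)))
           ∷ ( 2 , ((0ℤ , -1ℤ , 1ℤ) , (-1ℤ , 0ℤ , 0ℤ) , (1ℤ , 0ℤ , 0ℤ)))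
           ∷ ( 4 , ((0ℤ , 0ℤ , 0ℤ) , (0ℤ , -1ℤ , 0ℤ) , (0ℤ , 0ℤ , 1ℤ)))
           ∷ ( 9 , ((0ℤ , -1ℤ , -1ℤ) , (1ℤ , 0ℤ , 0ℤ) , (1ℤ , 0ℤ , 0ℤ)))
           ∷ []
  forms 1F = (14 , ((1ℤ , -1ℤ , 0ℤ) , (0ℤ , -1ℤ , -1ℤ) , (-1ℤ , 0ℤ , -1ℤ)))
           ∷ (22 , ((0ℤ , 1ℤ , 0ℤ) , (0ℤ , 1ℤ , 0ℤ) , (-1ℤ , 0ℤ , -1ℤ)))
           ∷ (22 , ((0ℤ , 0ℤ , -1ℤ) , (1ℤ , 1ℤ , 0ℤ) , (0ℤ , 0ℤ , -1ℤ)))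
           ∷ ( 4 , ((0ℤ , 0ℤ , -1ℤ) , (1ℤ , 0ℤ , 0ℤ) , (0ℤ , 0ℤ , 0ℤ)))
           ∷ ( 8 , ((1ℤ , 0ℤ , 0ℤ) , (0ℤ , -1ℤ , 0ℤ) , (0ℤ , 0ℤ , -1ℤ)))
           ∷ []
  forms 2F = []

  quad : List (ℕ × Form) → (a b a′ b′ : Fin 3) → ℤ
  quad []             a b a′ b′ = 0ℤ
  quad ((w , φ) ∷ ws) a b a′ b′ = + w * (⟦ φ ⟧ a b * ⟦ φ ⟧ a′ b′) + quad ws a b a′ b′

  local : {A : Set} → (A → A → Fin 3) → A → A → A → A → ℤ
  local r a b c d = + 18 * tripleCost (r a b) (r b c) (r a c) - + 2 - quad (forms (r a b)) (r a c) (r b c) (r a d) (r b d)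

  -- Together the three steps run over all 24 orders of a 4-tuple. Every pair then occurs in both
  -- directions, so `forms` need list nothing for a reversed arc.
  sym₂ sym₃ sym₄ symmetrize : {A : Set} → (A → A → A → A → ℤ) → A → A → A → A → ℤ
  sym₂ h a b c d = h a b c d + h a b d c
  sym₃ h a b c d = h a b c d + h a c b d + h a d b c
  sym₄ h a b c d = h a b c d + h b a c d + h c a b d + h d a b c
  symmetrize h = sym₄ (sym₃ (sym₂ h))

  -- The last clause concerns the diagonal: a vertex counts as not adjacent to itself, as in an
  -- antisymmetric relation on the vertices.
  config : (ab ac ad bc bd cd : Fin 3) → Fin 4 → Fin 4 → Fin 3
  config ab ac ad bc bd cd 0F 1F = ab
  config ab ac ad bc bd cd 0F 2F = ac
  config ab ac ad bc bd cd 0F 3F = ad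
  config ab ac ad bc bd cd 1F 2F = bc
  config ab ac ad bc bd cd 1F 3F = bd
  config ab ac ad bc bd cd 2F 3F = cd
  config ab ac ad bc bd cd 1F 0F = flip ab
  config ab ac ad bc bd cd 2F 0F = flip ac
  config ab ac ad bc bd cd 3F 0F = flip ad
  config ab ac ad bc bd cd 2F 1F = flip bc
  config ab ac ad bc bd cd 3F 1F = flip bd
  config ab ac ad bc bd cd 3F 2F = flip cd
  config ab ac ad bc bd cd _ _ = 0F

  -- Zero on the four-vertex subgraphs of the blow-up with at most one arc deleted, and positive on all others.
  slack : (ab ac ad bc bd cd : Fin 3) → ℤ
  slack ab ac ad bc bd cd = symmetrize (local (config ab ac ad bc bd cd)) 0F 1F 2F 3F

  abstract
    -- A check of all 729 assignments of relations to the six pairs. It covers 4-tuples with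
    -- repeated vertices, where equal vertices look like non-adjacent twins.
    0≤slack : ∀ ab ac ad bc bd cd → 0ℤ ≤ slack ab ac ad bc bd cd
    0≤slack = from-yes (all? λ ab → all? λ ac → all? λ ad → all? λ bc → all? λ bd → all? λ cd →
      0ℤ ≤? slack ab ac ad bc bd cd)

open Certificate

-- Summing the certificate over all 4-tuples of vertices.

module FlagInequality where

  open import Data.Integer hiding (suc; _≟_; _/_; _%_)
  open import Data.Integer.Properties hiding (_≟_)

  sym₂-cong : {A B : Set} {g : A → A → A → A → ℤ} {h : B → B → B → B → ℤ} (e : A → B) →
    (∀ i j k l → g i j k l ≡ h (e i) (e j) (e k) (e l)) →
    ∀ i j k l → sym₂ g i j k l ≡ sym₂ h (e i) (e j) (e k) (e l)
  sym₂-cong e eq i j k l = cong₂ _+_ (eq i j k l) (eq i j l k)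

  sym₃-cong : {A B : Set} {g : A → A → A → A → ℤ} {h : B → B → B → B → ℤ} (e : A → B) →
    (∀ i j k l → g i j k l ≡ h (e i) (e j) (e k) (e l)) →
    ∀ i j k l → sym₃ g i j k l ≡ sym₃ h (e i) (e j) (e k) (e l)
  sym₃-cong e eq i j k l = cong₂ _+_ (cong₂ _+_ (eq i j k l) (eq i k j l)) (eq i l j k)

  sym₄-cong : {A B : Set} {g : A → A → A → A → ℤ} {h : B → B → B → B → ℤ} (e : A → B) →
    (∀ i j k l → g i j k l ≡ h (e i) (e j) (e k) (e l)) →
    ∀ i j k l → sym₄ g i j k l ≡ sym₄ h (e i) (e j) (e k) (e l)
  sym₄-cong e eq i j k l =
    cong₂ _+_ (cong₂ _+_ (cong₂ _+_ (eq i j k l) (eq j i k l)) (eq k i j l)) (eq l i j k)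

  sum⁴-symmetrize : (h : Fin n → Fin n → Fin n → Fin n → ℤ) → sum⁴ (symmetrize h) ≡ + 24 * sum⁴ h
  sum⁴-symmetrize h = trans (sum⁴-sym₄ (sym₃ (sym₂ h)))
    (trans (cong (λ x → + 4 * x) (trans (sum⁴-sym₃ (sym₂ h)) (cong (λ x → + 3 * x) (sum⁴-sym₂ h))))
           (lemma (sum⁴ h)))
    where
    lemma : ∀ x → + 4 * (+ 3 * (+ 2 * x)) ≡ + 24 * x
    lemma = solve-∀
    twice : ∀ x → x + x ≡ + 2 * x
    twice = solve-∀
    thrice : ∀ x → x + x + x ≡ + 3 * x
    thrice = solve-∀
    four : ∀ x → x + x + x + x ≡ + 4 * x
    four = solve-∀
    sum⁴-sym₂ : ∀ h → sum⁴ (sym₂ h) ≡ + 2 * sum⁴ h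
    sum⁴-sym₂ h = trans (sum⁴-+ h (λ a b c d → h a b d c))
      (trans (cong (λ x → sum⁴ h + x) (sum⁴-swap₃₄ h)) (twice (sum⁴ h)))
    sum⁴-sym₃ : ∀ h → sum⁴ (sym₃ h) ≡ + 3 * sum⁴ h
    sum⁴-sym₃ h = trans (sum⁴-+ (λ a b c d → h a b c d + h a c b d) (λ a b c d → h a d b c))
      (trans (cong₂ _+_ (trans (sum⁴-+ h (λ a b c d → h a c b d)) (cong (λ x → sum⁴ h + x) (sum⁴-swap₂₃ h)))
                        (trans (sum⁴-swap₃₄ (λ a b c d → h a c b d)) (sum⁴-swap₂₃ h)))
             (thrice (sum⁴ h)))
    sum⁴-sym₄ : ∀ h → sum⁴ (sym₄ h) ≡ + 4 * sum⁴ h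
    sum⁴-sym₄ h = trans (sum⁴-+ (λ a b c d → h a b c d + h b a c d + h c a b d) (λ a b c d → h d a b c))
      (trans (cong₂ _+_
        (trans (sum⁴-+ (λ a b c d → h a b c d + h b a c d) (λ a b c d → h c a b d))
          (cong₂ _+_ (trans (sum⁴-+ h (λ a b c d → h b a c d)) (cong (λ x → sum⁴ h + x) (sum⁴-swap₁₂ h)))
                     swap₃))
        (trans (sum⁴-swap₃₄ (λ a b c d → h c a b d)) swap₃))
        (four (sum⁴ h)))
      where
      swap₃ : sum⁴ (λ a b c d → h c a b d) ≡ sum⁴ h
      swap₃ = trans (sum⁴-swap₂₃ (λ a b c d → h b a c d)) (sum⁴-swap₁₂ h)

  -- With `a` and `b` fixed, each form contributes a product of a factor in `c` and the same factor
  -- in `d`. Summed over all pairs, c = d included, this is a weighted square.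
  sum²-quad-nonneg : ∀ ws (a b : Fin n → Fin 3) → 0ℤ ≤ sum² (λ c d → quad ws (a c) (b c) (a d) (b d))
  sum²-quad-nonneg {n} [] a b = sum-nonneg {n} {λ _ → sum {n} (λ _ → 0ℤ)} (λ _ → sum-nonneg {n} {λ _ → 0ℤ} (λ _ → ≤-refl))
  sum²-quad-nonneg ((w , φ) ∷ ws) a b =
    subst (0ℤ ≤_) (sym (trans (sum²-+ (λ c d → + w * (g c * g d)) rest)
                    (cong (λ x → x + sum² rest) (trans (sum²-*ˡ (+ w) (λ c d → g c * g d)) (cong (λ x → + w * x) (sum-product g g))))))
      (+-nonneg (*-nonneg (0≤pos w) (square-nonneg (sum g))) (sum²-quad-nonneg ws a b))
    where
    g = λ c → ⟦ φ ⟧ (a c) (b c)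
    rest = λ c d → quad ws (a c) (b c) (a d) (b d)

  Antisymmetric : (Fin n → Fin n → Fin 3) → Set
  Antisymmetric ρ = ∀ u v → ρ v u ≡ flip (ρ u v)

  module _ (ρ : Fin n → Fin n → Fin 3) where

    cost : Fin n → Fin n → Fin n → ℤ
    cost u v w = tripleCost (ρ u v) (ρ v w) (ρ u w)

    total : ℤ
    total = sum³ cost

    slackAt : Fin n → Fin n → Fin n → Fin n → ℤ
    slackAt a b c d = slack (ρ a b) (ρ a c) (ρ a d) (ρ b c) (ρ b d) (ρ c d)

    slackAt-nonneg : ∀ a b c d → 0ℤ ≤ slackAt a b c d
    slackAt-nonneg a b c d = 0≤slack (ρ a b) (ρ a c) (ρ a d) (ρ b c) (ρ b d) (ρ c d)

  module _ {ρ : Fin n → Fin n → Fin 3} (anti : Antisymmetric ρ) where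

    diagonal : ∀ u → ρ u u ≡ 0F
    diagonal u = fixed (ρ u u) (anti u u)
      where
      fixed : ∀ a → a ≡ flip a → a ≡ 0F
      fixed 0F _ = refl
      fixed 1F ()
      fixed 2F ()

    -- Transport along `e`, which may fail to be injective: antisymmetry gives the reversed
    -- relations and the zero diagonal, and this is all that the comparison needs.
    slackAt≡sym : ∀ a b c d → slackAt ρ a b c d ≡ symmetrize (local ρ) a b c d
    slackAt≡sym a b c d =
      sym₄-cong {g = sym₃ (sym₂ (local m))} {h = sym₃ (sym₂ (local ρ))} e
        (sym₃-cong {g = sym₂ (local m)} {h = sym₂ (local ρ)} e
          (sym₂-cong {g = local m} {h = local ρ} e local-cong)) 0F 1F 2F 3F
      where
      e : Fin 4 → Fin n
      e 0F = a
      e 1F = b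
      e 2F = c
      e 3F = d
      m = config (ρ a b) (ρ a c) (ρ a d) (ρ b c) (ρ b d) (ρ c d)
      m≡ρ : ∀ i j → m i j ≡ ρ (e i) (e j)
      m≡ρ 0F 0F = sym (diagonal a)
      m≡ρ 0F 1F = refl
      m≡ρ 0F 2F = refl
      m≡ρ 0F 3F = refl
      m≡ρ 1F 0F = sym (anti a b)
      m≡ρ 1F 1F = sym (diagonal b)
      m≡ρ 1F 2F = refl
      m≡ρ 1F 3F = refl
      m≡ρ 2F 0F = sym (anti a c)
      m≡ρ 2F 1F = sym (anti b c)
      m≡ρ 2F 2F = sym (diagonal c)
      m≡ρ 2F 3F = refl
      m≡ρ 3F 0F = sym (anti a d)
      m≡ρ 3F 1F = sym (anti b d)
      m≡ρ 3F 2F = sym (anti c d)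
      m≡ρ 3F 3F = sym (diagonal d)
      local-cong : ∀ i j k l → local m i j k l ≡ local ρ (e i) (e j) (e k) (e l)
      local-cong i j k l rewrite m≡ρ i j | m≡ρ j k | m≡ρ i k | m≡ρ i l | m≡ρ j l = refl

    -- The cost term does not see `d`, so the sum over `d` gives the factor n; the quadratic terms
    -- are dropped separately for each pair `a`, `b`.
    sum-local : sum⁴ (local ρ) ≤ + n * (+ 18 * total ρ - + 2 * (+ n * (+ n * + n)))
    sum-local = subst (sum⁴ (local ρ) ≤_) value (sum²-mono bound)
      where
      X : Fin n → Fin n → Fin n → ℤ
      X a b c = + 18 * cost ρ a b c - + 2
      Q : Fin n → Fin n → Fin n → Fin n → ℤ
      Q a b c d = quad (forms (ρ a b)) (ρ a c) (ρ b c) (ρ a d) (ρ b d)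
      bound : ∀ a b → sum² (λ c d → X a b c - Q a b c d) ≤ + n * sum (X a b)
      bound a b = ≤-by (sum² (Q a b)) (sum²-quad-nonneg (forms (ρ a b)) (ρ a) (ρ b))
        (trans (cong (λ x → + n * sum (X a b) - x) split) (cancel (+ n * sum (X a b)) (sum² (Q a b))))
        where
        cancel : ∀ x y → x - (x - y) ≡ y
        cancel = solve-∀
        split : sum² (λ c d → X a b c - Q a b c d) ≡ + n * sum (X a b) - sum² (Q a b)
        split = trans (sum-cong-≗ (λ c → trans (sum-sub (λ _ → X a b c) (Q a b c)) (cong (λ x → x - sum (Q a b c)) (sum-const n (X a b c)))))
          (trans (sum-sub (λ c → + n * X a b c) (λ c → sum (Q a b c))) (cong (λ x → x - sum² (Q a b)) (sum-*ˡ (+ n) (X a b))))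
      value : sum² (λ a b → + n * sum (X a b)) ≡ + n * (+ 18 * total ρ - + 2 * (+ n * (+ n * + n)))
      value = trans (sum²-*ˡ (+ n) (λ a b → sum (X a b))) (cong (λ x → + n * x)
        (trans (sum³-sub (λ a b c → + 18 * cost ρ a b c) (λ _ _ _ → + 2))
          (cong₂ _-_ (sum³-*ˡ (+ 18) (cost ρ))
            (trans (sum-cong-≗ {n} (λ _ → trans (sum-cong-≗ {n} (λ _ → sum-const n (+ 2))) (sum-const n (+ n * + 2))))
              (trans (sum-const n (+ n * (+ n * + 2))) (lemma (+ n)))))))
        where
        lemma : ∀ x → x * (x * (x * + 2)) ≡ + 2 * (x * (x * x))
        lemma = solve-∀

    sum-slack : sum⁴ (slackAt ρ) ≤ + 24 * (+ n * (+ 18 * total ρ - + 2 * (+ n * (+ n * + n))))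
    sum-slack = ≤-trans (≤-reflexive (trans (sum⁴-cong slackAt≡sym) (sum⁴-symmetrize (local ρ))))
      (*-monoˡ-≤-nonNeg (+ 24) {sum⁴ (local ρ)} {+ n * (+ 18 * total ρ - + 2 * (+ n * (+ n * + n)))} sum-local)

open FlagInequality

-- Local inequalities that turn slack into information about a partition.

module PointwiseBounds where

  open import Data.Integer hiding (suc; _≟_; _/_; _%_)
  open import Data.Integer.Properties hiding (_≟_)

  δ : Fin n → Fin n → ℤ
  δ i j = if does (i ≟ j) then 1ℤ else 0ℤ

  -- Subtraction in ℤ/3: p v ⊝ p u is the relation of u to v in the blow-up of the cyclic triangle with parts p.
  _⊝_ : Fin 3 → Fin 3 → Fin 3
  j ⊝ 0F = j
  0F ⊝ 1F = 2F
  1F ⊝ 1F = 0F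
  2F ⊝ 1F = 1F
  0F ⊝ 2F = 1F
  1F ⊝ 2F = 2F
  2F ⊝ 2F = 0F

  wrong : Fin 3 → Fin 3 → Fin 3 → ℤ
  wrong r i j = 1ℤ - δ r (j ⊝ i)

  -- The part of z relative to an edge x → y, read off from a = ρ x z and b = ρ y z.
  partOf : Fin 3 → Fin 3 → Fin 3
  partOf 1F 0F = 1F
  partOf 2F 1F = 2F
  partOf _  _  = 0F

  -- Zero on the three views of the edge that a vertex of the blow-up can have. On all other views
  -- the part `0F` given by `partOf` is only a default.
  exceptional : Fin 3 → Fin 3 → ℤ
  exceptional 0F 2F = 0ℤ
  exceptional 1F 0F = 0ℤ
  exceptional 2F 1F = 0ℤ
  exceptional _  _  = 1ℤ

  -- An arc between `z` and `c` together with a vertex `l` joined to neither end. In the blow-up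
  -- this requires a missing arc at `l`, so stars make missing arcs countable.
  star : Fin 3 → Fin 3 → Fin 3 → Fin 3 → ℤ
  star t zc zl cl = δ t zc * (δ 0F zl * δ 0F cl)

  abstract
    -- Since the arc xy is present, each exceptional vertex needs a deleted arc of its own, and zero
    -- slack allows a single one.
    exceptional-slack : ∀ a b c d e → exceptional a b * exceptional c d ≤ slack 1F a c b d e
    exceptional-slack = from-yes (all? λ a → all? λ b → all? λ c → all? λ d → all? λ e →
      exceptional a b * exceptional c d ≤? slack 1F a c b d e)

    -- If neither vertex is exceptional and the slack is zero, a wrong pair can only be a missing
    -- arc between two different parts. It then forms a star with an end of xy: at y with `2F` for
    -- the parts 0 and 1, at x with `2F` for 0 and 2, at y with `1F` for 1 and 2. Both orders of the
    -- pair are listed.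
    wrong-slack : ∀ a b c d e → wrong e (partOf a b) (partOf c d) ≤
      exceptional a b + exceptional c d + slack 1F a c b d e
      + (star 2F b d e + star 2F d b (flip e)) + (star 2F a c e + star 2F c a (flip e))
      + (star 1F b d e + star 1F d b (flip e))
    wrong-slack = from-yes (all? λ a → all? λ b → all? λ c → all? λ d → all? λ e →
      wrong e (partOf a b) (partOf c d) ≤?
      exceptional a b + exceptional c d + slack 1F a c b d e
      + (star 2F b d e + star 2F d b (flip e)) + (star 2F a c e + star 2F c a (flip e))
      + (star 1F b d e + star 1F d b (flip e)))

    -- Two stars over the same arc require two deleted arcs. The case of equal `l` and `l′` is
    -- included, which allows squares to be formed later.
    star-slack₁ : ∀ c l l′ cl cl′ ll′ → star 1F c l cl * star 1F c l′ cl′ ≤ slack c l l′ cl cl′ ll′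
    star-slack₁ = from-yes (all? λ c → all? λ l → all? λ l′ → all? λ cl → all? λ cl′ → all? λ ll′ →
      star 1F c l cl * star 1F c l′ cl′ ≤? slack c l l′ cl cl′ ll′)

    star-slack₂ : ∀ c l l′ cl cl′ ll′ → star 2F c l cl * star 2F c l′ cl′ ≤ slack c l l′ cl cl′ ll′
    star-slack₂ = from-yes (all? λ c → all? λ l → all? λ l′ → all? λ cl → all? λ cl′ → all? λ ll′ →
      star 2F c l cl * star 2F c l′ cl′ ≤? slack c l l′ cl cl′ ll′)

    nonadjacent-cost : ∀ a b c → 1ℤ - tripleCost a b c ≤ (δ 1F a + δ 1F (flip a)) + (δ 1F b + δ 1F (flip b)) + (δ 1F c + δ 1F (flip c))
    nonadjacent-cost = from-yes (all? λ a → all? λ b → all? λ c →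
      1ℤ - tripleCost a b c ≤? (δ 1F a + δ 1F (flip a)) + (δ 1F b + δ 1F (flip b)) + (δ 1F c + δ 1F (flip c)))

    δ-nonneg : ∀ (i j : Fin n) → 0ℤ ≤ δ i j
    δ-nonneg i j with does (i ≟ j)
    ... | true  = +≤+ ℕ.z≤n
    ... | false = +≤+ ℕ.z≤n

  δ≤1 : ∀ (i j : Fin n) → δ i j ≤ 1ℤ
  δ≤1 i j with does (i ≟ j)
  ... | true  = +≤+ (ℕ.s≤s ℕ.z≤n)
  ... | false = +≤+ ℕ.z≤n

  -- A square root without square roots: 2NLx ≤ N² + L²x² ≤ N² + L²KN ≤ 2N².
  linear-from-square : ∀ N L K x → 0ℤ < N → L * L * K ≤ N → x * x ≤ K * N → L * x ≤ N
  linear-from-square N L K x 0<N LK xx = cancel-≤ (+ 2 * N) (*-pos {+ 2} (+<+ (ℕ.s≤s ℕ.z≤n)) 0<N)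
    (≤-by ((N - L * x) * (N - L * x) + (L * L) * (K * N - x * x) + N * (N - L * L * K))
      (+-nonneg (+-nonneg (square-nonneg (N - L * x)) (*-nonneg (square-nonneg L) (Δ xx))) (*-nonneg (<⇒≤ 0<N) (Δ LK)))
      (identity N L K x))
    where
    identity : ∀ N L K x → + 2 * N * N - + 2 * N * (L * x) ≡ (N - L * x) * (N - L * x) + (L * L) * (K * N - x * x) + N * (N - L * L * K)
    identity = solve-∀

  -- The same estimate applied to every row sum and then added up, in place of the Cauchy-Schwarz
  -- inequality.
  sum-from-squares : ∀ {n} L K (h : Fin n → Fin n → ℤ) → 0ℤ < + n → L * L * K ≤ + n →
    sum (λ u → sum (h u) * sum (h u)) ≤ K * (+ n * + n) → L * sum² h ≤ + n * + n
  sum-from-squares {n} L K h 0<N LK hyp = cancel-≤ (+ 2 * N) (*-pos {+ 2} (+<+ (ℕ.s≤s ℕ.z≤n)) 0<N)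
    (≤-by (S + L * L * (K * (N * N) - Q) + N * N * (N - L * L * K))
      (+-nonneg (+-nonneg S-nonneg (*-nonneg (square-nonneg L) (Δ hyp))) (*-nonneg (square-nonneg N) (Δ LK)))
      (trans (identity N L K (sum² h) Q) (cong (λ x → x + L * L * (K * (N * N) - Q) + N * N * (N - L * L * K)) (sym S≡))))
    where
    N = + n
    m = λ u → sum (h u)
    Q = sum (λ u → m u * m u)
    S = sum (λ u → N * N + (L * L * (m u * m u) - + 2 * N * L * m u))
    S-nonneg : 0ℤ ≤ S
    S-nonneg = sum-nonneg (λ u → subst (0ℤ ≤_) (expand N L (m u)) (square-nonneg (N - L * m u)))
      where
      expand : ∀ N L m → (N - L * m) * (N - L * m) ≡ N * N + (L * L * (m * m) - + 2 * N * L * m)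
      expand = solve-∀
    S≡ : S ≡ N * (N * N) + (L * L * Q - + 2 * N * L * sum² h)
    S≡ = trans (∑-distrib-+ (λ _ → N * N) (λ u → L * L * (m u * m u) - + 2 * N * L * m u))
      (cong₂ _+_ (sum-const n (N * N)) (trans (sum-sub (λ u → L * L * (m u * m u)) (λ u → + 2 * N * L * m u))
        (cong₂ _-_ (sum-*ˡ (L * L) (λ u → m u * m u)) (sum-*ˡ (+ 2 * N * L) m))))
    identity : ∀ N L K M Q → + 2 * N * (N * N) - + 2 * N * (L * M) ≡
      N * (N * N) + (L * L * Q - + 2 * N * L * M) + L * L * (K * (N * N) - Q) + N * N * (N - L * L * K)
    identity = solve-∀

open PointwiseBounds

-- From small slack to a partition with few wrong pairs.

module FewWrongPairs where

  open import Data.Integer hiding (suc; _≟_; _/_; _%_)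
  open import Data.Integer.Properties hiding (_≟_)

  wrongs : (Fin n → Fin n → Fin 3) → (Fin n → Fin 3) → ℤ
  wrongs ρ p = sum² λ u v → wrong (ρ u v) (p u) (p v)

  δ-scale-< : ∀ (r : Fin 3) t k → δ 1F r * t < δ 1F r * k → r ≡ 1F × t < k
  δ-scale-< 0F t k (+<+ ())
  δ-scale-< 1F t k lt = refl , subst₂ _<_ (*-identityˡ t) (*-identityˡ k) lt
  δ-scale-< 2F t k (+<+ ())

  δ-scale-≤ : ∀ {m} (i j : Fin m) {t} → 0ℤ ≤ t → δ i j * t ≤ t
  δ-scale-≤ i j {t} 0≤t = subst (δ i j * t ≤_) (*-identityˡ t) (*-monoʳ-≤-nonNeg t {{nonNegative 0≤t}} (δ≤1 i j))

  abstract
    -- The total slack is at most 48n(9 `total` - n³), and the bracket is at most 27n².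
    C₀ : ℤ
    C₀ = + 48 * + 27

    -- The weight averaged in `good-edge` has total at most 3C₀n⁴ and is spread over at least n²/9
    -- arcs; the extra 1 makes the comparison strict.
    K : ℤ
    K = + 27 * C₀ + 1ℤ

    C₀≡ : C₀ ≡ + 48 * + 27
    C₀≡ = refl

    K≡ : K ≡ + 27 * C₀ + 1ℤ
    K≡ = refl

    0≤K : 0ℤ ≤ K
    0≤K = +≤+ ℕ.z≤n

  module Stability {n} {ρ : Fin n → Fin n → Fin 3} (anti : Antisymmetric ρ)
    (0<n : 14 ℕ.≤ n) (small : + 9 * total ρ ≤ + n * (+ n * + n) + + 27 * (+ n * + n)) where

    private
      N = + n
      14≤N : + 14 ≤ N
      14≤N = +≤+ 0<n
      0<N : 0ℤ < N
      0<N = <-≤-trans (+<+ (ℕ.s≤s ℕ.z≤n)) 14≤N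
      0≤N : 0ℤ ≤ N
      0≤N = <⇒≤ 0<N

    slack₂ : Fin n → Fin n → ℤ
    slack₂ x y = sum² (slackAt ρ x y)

    slack₃ : Fin n → ℤ
    slack₃ x = sum³ (slackAt ρ x)

    slack₂-nonneg : ∀ x y → 0ℤ ≤ slack₂ x y
    slack₂-nonneg x y = sum²-nonneg (slackAt-nonneg ρ x y)

    slack₃-nonneg : ∀ x → 0ℤ ≤ slack₃ x
    slack₃-nonneg x = sum-nonneg (slack₂-nonneg x)

    sum-slack≤ : sum slack₃ ≤ C₀ * (N * (N * N))
    sum-slack≤ = ≤-trans (sum-slack anti)
      (≤-by (+ 48 * (N * (N * (N * N) + + 27 * (N * N) - + 9 * total ρ))) (*-nonneg (0≤pos 48) (*-nonneg 0≤N (Δ small)))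
        (trans (cong (λ c → c * (N * (N * N)) - + 24 * (N * (+ 18 * total ρ - + 2 * (N * (N * N))))) C₀≡)
          (identity N (total ρ) (+ 27))))
      where
      identity : ∀ N t c → + 48 * c * (N * (N * N)) - + 24 * (N * (+ 18 * t - + 2 * (N * (N * N)))) ≡
        + 48 * (N * (N * (N * N) + c * (N * N) - + 9 * t))
      identity = solve-∀

    edges : ℤ
    edges = sum² λ x y → δ 1F (ρ x y)

    -- A triple of cost zero has an adjacent pair, so the arcs number at least 4N²/27 - N/2. This
    -- reaches N²/9 once N ≥ 27/2, which is the origin of 14.
    many-edges : N * N ≤ + 9 * edges
    many-edges = cancel-≤ (+ 6 * N) (*-pos {+ 6} (+<+ (ℕ.s≤s ℕ.z≤n)) 0<N)
      (≤-by (+ 9 * (+ 3 * (N * (edges + edges)) - (N * (N * N) - total ρ)) + (N * (N * N) + + 27 * (N * N) - + 9 * total ρ) + (N * N * (+ 2 * (N - + 14) + 1ℤ)))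
        (+-nonneg (+-nonneg (*-nonneg (0≤pos 9) (Δ bound)) (Δ small))
          (*-nonneg (square-nonneg N) (+-nonneg (*-nonneg (0≤pos 2) (Δ 14≤N)) (0≤pos 1))))
        (identity N edges (total ρ)))
      where
      identity : ∀ N e t → + 6 * N * (+ 9 * e) - + 6 * N * (N * N) ≡
        + 9 * (+ 3 * (N * (e + e)) - (N * (N * N) - t)) + (N * (N * N) + + 27 * (N * N) - + 9 * t) + N * N * (+ 2 * (N - + 14) + 1ℤ)
      identity = solve-∀
      joined : Fin n → Fin n → ℤ
      joined u v = δ 1F (ρ u v) + δ 1F (flip (ρ u v))
      sum-adj : sum² joined ≡ edges + edges
      sum-adj = trans (sum²-+ (λ u v → δ 1F (ρ u v)) (λ u v → δ 1F (flip (ρ u v))))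
        (cong (λ x → edges + x) (trans (sum²-cong (λ u v → cong (δ 1F) (sym (anti u v)))) (sum²-transpose (λ u v → δ 1F (ρ u v)))))
      bound : N * (N * N) - total ρ ≤ + 3 * (N * (edges + edges))
      bound = subst₂ _≤_ (trans (sum³-sub (λ _ _ _ → 1ℤ) (cost ρ)) (cong (λ x → x - total ρ) (sum³-1 n)))
        (trans (sum³-pairs joined) (cong (λ x → + 3 * (N * x)) sum-adj))
        (sum³-mono (λ u v w → nonadjacent-cost (ρ u v) (ρ v w) (ρ u w)))

    -- Averaging one combined weight over the arcs controls three quantities at once: the slack at
    -- the arc, which bounds exceptional vertices, and the slack at each end, which bounds stars.
    good-edge : ∃ λ x → ∃ λ y → ρ x y ≡ 1F × N * slack₂ x y + slack₃ x + slack₃ y < K * (N * N)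
    good-edge = package (sum²-<⇒∃ g h g<h)
      where
      t : Fin n → Fin n → ℤ
      t x y = N * slack₂ x y + slack₃ x + slack₃ y
      g h : Fin n → Fin n → ℤ
      g x y = δ 1F (ρ x y) * t x y
      h x y = δ 1F (ρ x y) * (K * (N * N))
      sum-h : sum² h ≡ K * (N * N) * edges
      sum-h = trans (sum²-cong (λ x y → *-comm (δ 1F (ρ x y)) (K * (N * N)))) (sum²-*ˡ (K * (N * N)) (λ x y → δ 1F (ρ x y)))
      sum-t : sum² t ≡ + 3 * (N * sum slack₃)
      sum-t = trans (sum²-+ (λ x y → N * slack₂ x y + slack₃ x) (λ _ y → slack₃ y))
        (trans (cong₂ _+_ (trans (sum²-+ (λ x y → N * slack₂ x y) (λ x _ → slack₃ x))
            (cong₂ _+_ (sum²-*ˡ N slack₂) (sum²-ignore₂ slack₃))) (sum²-ignore₁ slack₃))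
          (thrice (N * sum slack₃)))
        where
        thrice : ∀ x → x + x + x ≡ + 3 * x
        thrice = solve-∀
      sum-g : sum² g ≤ + 3 * (N * sum slack₃)
      sum-g = ≤-trans (sum²-mono (λ x y → δ-scale-≤ 1F (ρ x y)
        (+-nonneg (+-nonneg (*-nonneg 0≤N (slack₂-nonneg x y)) (slack₃-nonneg x)) (slack₃-nonneg y)))) (≤-reflexive sum-t)
      g<h : sum² g < sum² h
      g<h = cancel-< (+ 9) (0≤pos 9) (<-by
        (+ 9 * (+ 3 * (N * sum slack₃) - sum² g) + + 27 * N * (C₀ * (N * (N * N)) - sum slack₃) + K * (N * N) * (+ 9 * edges - N * N) + N * N * (N * N))
        (+-mono-≤-< (+-nonneg (+-nonneg (*-nonneg (0≤pos 9) (Δ sum-g)) (*-nonneg (*-nonneg (0≤pos 27) 0≤N) (Δ sum-slack≤)))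
            (*-nonneg (*-nonneg 0≤K (square-nonneg N)) (Δ many-edges)))
          (*-pos (*-pos 0<N 0<N) (*-pos 0<N 0<N)))
        (trans (cong (λ x → + 9 * x - + 9 * sum² g) sum-h)
          (subst (λ k → + 9 * (k * (N * N) * edges) - + 9 * sum² g ≡ + 9 * (+ 3 * (N * sum slack₃) - sum² g) + + 27 * N * (C₀ * (N * (N * N)) - sum slack₃) + k * (N * N) * (+ 9 * edges - N * N) + N * N * (N * N))
            (sym K≡) (identity N edges (sum slack₃) (sum² g) C₀))))
        where
        identity : ∀ N e s g c → + 9 * ((+ 27 * c + 1ℤ) * (N * N) * e) - + 9 * g ≡
          + 9 * (+ 3 * (N * s) - g) + + 27 * N * (c * (N * (N * N)) - s) + (+ 27 * c + 1ℤ) * (N * N) * (+ 9 * e - N * N) + N * N * (N * N)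
        identity = solve-∀
      package : (∃ λ x → ∃ λ y → g x y < h x y) → ∃ λ x → ∃ λ y → ρ x y ≡ 1F × t x y < K * (N * N)
      package (x , y , lt) = x , y , δ-scale-< (ρ x y) (t x y) (K * (N * N)) lt

    stars : Fin 3 → Fin n → ℤ
    stars t z = sum² λ c l → star t (ρ z c) (ρ z l) (ρ c l)

    module _ (L : ℤ) (0≤L : 0ℤ ≤ L) (LLK≤N : L * L * K ≤ N) (LK≤N : L * K ≤ N) where

      -- For fixed `z` and `c` the squared number of stars is a sum over pairs `l`, `l′`, each pair
      -- paid for by the slack at `z`.
      few-stars : ∀ t z →
        (∀ c l l′ cl cl′ ll′ → star t c l cl * star t c l′ cl′ ≤ slack c l l′ cl cl′ ll′) →
        slack₃ z ≤ K * (N * N) → L * stars t z ≤ N * N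
      few-stars t z star-slack bound = sum-from-squares L K s 0<N LLK≤N
        (≤-trans (≤-trans (≤-reflexive (sum-cong-≗ (λ c → sym (sum-product (s c) (s c)))))
          (sum³-mono (λ c l l′ → star-slack (ρ z c) (ρ z l) (ρ z l′) (ρ c l) (ρ c l′) (ρ l l′)))) bound)
        where
        s : Fin n → Fin n → ℤ
        s c l = star t (ρ z c) (ρ z l) (ρ c l)

      from-edge : ∀ x y → ρ x y ≡ 1F → N * slack₂ x y + slack₃ x + slack₃ y < K * (N * N) →
        ∃ λ p → L * wrongs ρ p ≤ + 9 * (N * N)
      few-wrongs : ∃ λ p → L * wrongs ρ p ≤ + 9 * (N * N)
      few-wrongs = from-edge (proj₁ good-edge) (proj₁ (proj₂ good-edge)) (proj₁ (proj₂ (proj₂ good-edge))) (proj₂ (proj₂ (proj₂ good-edge)))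

      -- The constant 9 is 2 for the exceptional vertices, 1 for the slack at the arc, and 6 for
      -- three kinds of stars, each in two orders.
      from-edge x y xy lt = p , ≤-by
          (L * (total-bound - wrongs ρ p) + + 2 * N * (N - L * X) + L * (K * N - slack₂ x y) + N * (N - L * K)
            + + 2 * (N * N - L * stars 2F y) + + 2 * (N * N - L * stars 2F x) + + 2 * (N * N - L * stars 1F y))
          (+-nonneg (+-nonneg (+-nonneg (+-nonneg (+-nonneg (+-nonneg
              (*-nonneg 0≤L (Δ wrongs≤)) (*-nonneg (*-nonneg (0≤pos 2) 0≤N) (Δ LX≤N))) (*-nonneg 0≤L (Δ slack₂≤)))
              (*-nonneg 0≤N (Δ LK≤N))) (*-nonneg (0≤pos 2) (Δ S2y))) (*-nonneg (0≤pos 2) (Δ S2x))) (*-nonneg (0≤pos 2) (Δ S1y)))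
          (identity N L K X (slack₂ x y) (stars 2F y) (stars 2F x) (stars 1F y) (wrongs ρ p))
        where
        p : Fin n → Fin 3
        p u = partOf (ρ x u) (ρ y u)
        exc : Fin n → ℤ
        exc u = exceptional (ρ x u) (ρ y u)
        X = sum exc
        s : Fin 3 → Fin n → Fin n → Fin n → ℤ
        s t z u v = star t (ρ z u) (ρ z v) (ρ u v)
        t = N * slack₂ x y + slack₃ x + slack₃ y
        slack₂≤ : slack₂ x y ≤ K * N
        slack₂≤ = cancel-≤ N 0<N (≤-by (slack₃ x + slack₃ y + (K * (N * N) - t))
          (+-nonneg (+-nonneg (slack₃-nonneg x) (slack₃-nonneg y)) (Δ (<⇒≤ lt)))
          (eq N K (slack₂ x y) (slack₃ x) (slack₃ y)))
          where
          eq : ∀ N K a b c → N * (K * N) - N * a ≡ b + c + (K * (N * N) - (N * a + b + c))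
          eq = solve-∀
        slack₃x≤ : slack₃ x ≤ K * (N * N)
        slack₃x≤ = ≤-by (N * slack₂ x y + slack₃ y + (K * (N * N) - t))
          (+-nonneg (+-nonneg (*-nonneg 0≤N (slack₂-nonneg x y)) (slack₃-nonneg y)) (Δ (<⇒≤ lt)))
          (eq (K * (N * N)) (N * slack₂ x y) (slack₃ x) (slack₃ y))
          where
          eq : ∀ k a b c → k - b ≡ a + c + (k - (a + b + c))
          eq = solve-∀
        slack₃y≤ : slack₃ y ≤ K * (N * N)
        slack₃y≤ = ≤-by (N * slack₂ x y + slack₃ x + (K * (N * N) - t))
          (+-nonneg (+-nonneg (*-nonneg 0≤N (slack₂-nonneg x y)) (slack₃-nonneg x)) (Δ (<⇒≤ lt)))
          (eq (K * (N * N)) (N * slack₂ x y) (slack₃ x) (slack₃ y))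
          where
          eq : ∀ k a b c → k - c ≡ a + b + (k - (a + b + c))
          eq = solve-∀
        LX≤N : L * X ≤ N
        LX≤N = linear-from-square N L K X 0<N LLK≤N (≤-trans
          (≤-trans (≤-reflexive (sym (sum-product exc exc)))
            (sum²-mono (λ u v → subst (λ r → exc u * exc v ≤ slack r (ρ x u) (ρ x v) (ρ y u) (ρ y v) (ρ u v)) (sym xy)
              (exceptional-slack (ρ x u) (ρ y u) (ρ x v) (ρ y v) (ρ u v)))))
          slack₂≤)
        S2y : L * stars 2F y ≤ N * N
        S2y = few-stars 2F y star-slack₂ slack₃y≤
        S2x : L * stars 2F x ≤ N * N
        S2x = few-stars 2F x star-slack₂ slack₃x≤
        S1y : L * stars 1F y ≤ N * N
        S1y = few-stars 1F y star-slack₁ slack₃y≤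
        total-bound : ℤ
        total-bound = N * X + N * X + slack₂ x y + (stars 2F y + stars 2F y) + (stars 2F x + stars 2F x) + (stars 1F y + stars 1F y)
        both : (Fin n → Fin n → ℤ) → Fin n → Fin n → ℤ
        both h u v = h u v + h v u
        sum-both : ∀ h → sum² (both h) ≡ sum² h + sum² h
        sum-both h = trans (sum²-+ h (λ u v → h v u)) (cong (λ x → sum² h + x) (sum²-transpose h))
        h₂ h₃ h₄ h₅ h₆ : Fin n → Fin n → ℤ
        h₂ u v = exc u + exc v
        h₃ u v = h₂ u v + slackAt ρ x y u v
        h₄ u v = h₃ u v + both (s 2F y) u v
        h₅ u v = h₄ u v + both (s 2F x) u v
        h₆ u v = h₅ u v + both (s 1F y) u v
        pointwise : ∀ u v → wrong (ρ u v) (p u) (p v) ≤ h₆ u v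
        pointwise u v = subst₂ (λ r q → wrong (ρ u v) (p u) (p v) ≤
              exc u + exc v + slack r (ρ x u) (ρ x v) (ρ y u) (ρ y v) (ρ u v)
              + (s 2F y u v + star 2F (ρ y v) (ρ y u) q) + (s 2F x u v + star 2F (ρ x v) (ρ x u) q)
              + (s 1F y u v + star 1F (ρ y v) (ρ y u) q))
            (sym xy) (sym (anti u v)) (wrong-slack (ρ x u) (ρ y u) (ρ x v) (ρ y v) (ρ u v))
        wrongs≤ : wrongs ρ p ≤ total-bound
        wrongs≤ = ≤-trans (sum²-mono pointwise) (≤-reflexive
          (trans (sum²-+ h₅ (both (s 1F y))) (cong₂ _+_
            (trans (sum²-+ h₄ (both (s 2F x))) (cong₂ _+_
              (trans (sum²-+ h₃ (both (s 2F y))) (cong₂ _+_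
                (trans (sum²-+ h₂ (slackAt ρ x y)) (cong₂ _+_
                  (trans (sum²-+ (λ u _ → exc u) (λ _ v → exc v)) (cong₂ _+_ (sum²-ignore₂ exc) (sum²-ignore₁ exc)))
                  refl))
                (sum-both (s 2F y))))
              (sum-both (s 2F x))))
            (sum-both (s 1F y)))))
        identity : ∀ N L K X s a b c w → + 9 * (N * N) - L * w ≡
          L * (N * X + N * X + s + (a + a) + (b + b) + (c + c) - w) + + 2 * N * (N - L * X) + L * (K * N - s) + N * (N - L * K)
            + + 2 * (N * N - L * a) + + 2 * (N * N - L * b) + + 2 * (N * N - L * c)
        identity = solve-∀

open FewWrongPairs

-- Balanced parts, and the cost of a vertex as a polynomial in nine counts.

module VertexPolynomial where

  open import Data.Integer hiding (suc; _≟_; _/_; _%_)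
  open import Data.Integer.Properties hiding (_≟_)

  0<pos : ∀ k → 0ℤ < + ℕ.suc k
  0<pos k = +<+ (ℕ.s≤s ℕ.z≤n)

  square-≤⇒≤ : ∀ {x N} → 0ℤ ≤ N → x * x ≤ N * N → x ≤ N
  square-≤⇒≤ {x} {N} 0≤N xx = ≮⇒≥ λ N<x → <⇒≱
    (<-≤-trans (*-monoˡ-<-pos x {{positive (≤-<-trans 0≤N N<x)}} N<x) (≤-refl {x * x}))
    (≤-trans xx (*-monoʳ-≤-nonNeg N {{nonNegative 0≤N}} (<⇒≤ N<x)))

  square-≤⇒-≤ : ∀ {x N} → 0ℤ ≤ N → x * x ≤ N * N → - N ≤ x
  square-≤⇒-≤ {x} {N} 0≤N xx = subst (- N ≤_) (neg-involutive x)
    (neg-mono-≤ (square-≤⇒≤ {x = - x} 0≤N (subst (_≤ N * N) (square-neg x) xx)))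
    where
    square-neg : ∀ x → x * x ≡ - x * - x
    square-neg = solve-∀

  -- Since Σ(3a-N) = 0, the excess of 27Σa³ over 3N³ + 2NΣ(3a-N)² is Σ(3a-N)²·3a ≥ 0.
  balanced-sizes : ∀ N L M t E a b c → 0ℤ < N → 0ℤ ≤ L → L * + 27 ≤ N → L ≡ + 366 * (M * M) →
    0ℤ ≤ a → 0ℤ ≤ b → 0ℤ ≤ c → a + b + c ≡ N →
    + 9 * t ≤ N * (N * N) + + 27 * (N * N) → L * E ≤ + 9 * (N * N) →
    a * (a * a) + b * (b * b) + c * (c * c) ≤ t + + 3 * (N * E) →
    M * (+ 3 * a - N) ≤ N × - N ≤ M * (+ 3 * a - N)
  balanced-sizes N L M t E a b c 0<N 0≤L 27L L≡ 0≤a 0≤b 0≤c refl ht hE hs =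
    square-≤⇒≤ 0≤N key , square-≤⇒-≤ 0≤N key
    where
    0≤N = <⇒≤ 0<N
    d = + 3 * a - N
    D = d * d + (+ 3 * b - N) * (+ 3 * b - N) + (+ 3 * c - N) * (+ 3 * c - N)
    cubes = a * (a * a) + b * (b * b) + c * (c * c)
    tangent : + 3 * (N * (N * N)) + + 2 * (N * D) ≤ + 27 * cubes
    tangent = ≤-by (+ 3 * (d * d * a + (+ 3 * b - N) * (+ 3 * b - N) * b + (+ 3 * c - N) * (+ 3 * c - N) * c))
      (*-nonneg (0≤pos 3) (+-nonneg (+-nonneg (*-nonneg (square-nonneg d) 0≤a)
        (*-nonneg (square-nonneg (+ 3 * b - N)) 0≤b)) (*-nonneg (square-nonneg (+ 3 * c - N)) 0≤c)))
      (identity a b c)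
      where
      identity : ∀ a b c → let N = a + b + c in
        + 27 * (a * (a * a) + b * (b * b) + c * (c * c)) - (+ 3 * (N * (N * N)) + + 2 * (N * ((+ 3 * a - N) * (+ 3 * a - N) + (+ 3 * b - N) * (+ 3 * b - N) + (+ 3 * c - N) * (+ 3 * c - N)))) ≡
        + 3 * ((+ 3 * a - N) * (+ 3 * a - N) * a + (+ 3 * b - N) * (+ 3 * b - N) * b + (+ 3 * c - N) * (+ 3 * c - N) * c)
      identity = solve-∀
    -- Twice 366 is 81 · 9 + 3: the wrong pairs contribute 81 · 9, and the error 27N² in the total
    -- contributes 3 because 27L ≤ N.
    LD : L * D ≤ + 366 * (N * N)
    LD = cancel-≤ (+ 2 * N) (*-pos (0<pos 1) 0<N)
      (≤-by (L * (+ 27 * cubes - (+ 3 * (N * (N * N)) + + 2 * (N * D))) + + 27 * L * (t + + 3 * (N * E) - cubes)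
          + + 3 * L * (N * (N * N) + + 27 * (N * N) - + 9 * t) + + 81 * N * (+ 9 * (N * N) - L * E) + + 3 * (N * N) * (N - L * + 27))
        (+-nonneg (+-nonneg (+-nonneg (+-nonneg (*-nonneg 0≤L (Δ tangent)) (*-nonneg (*-nonneg (0≤pos 27) 0≤L) (Δ hs)))
          (*-nonneg (*-nonneg (0≤pos 3) 0≤L) (Δ ht))) (*-nonneg (*-nonneg (0≤pos 81) 0≤N) (Δ hE)))
          (*-nonneg (*-nonneg (0≤pos 3) (square-nonneg N)) (Δ 27L)))
        (identity N L D t E cubes))
      where
      identity : ∀ N L D t E q → + 2 * N * (+ 366 * (N * N)) - + 2 * N * (L * D) ≡
        L * (+ 27 * q - (+ 3 * (N * (N * N)) + + 2 * (N * D))) + + 27 * L * (t + + 3 * (N * E) - q)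
          + + 3 * L * (N * (N * N) + + 27 * (N * N) - + 9 * t) + + 81 * N * (+ 9 * (N * N) - L * E) + + 3 * (N * N) * (N - L * + 27)
      identity = solve-∀
    key : M * d * (M * d) ≤ N * N
    key = cancel-≤ (+ 366) (0<pos 365)
      (≤-by (+ 366 * (N * N) - L * D + + 366 * (M * M) * (D - d * d))
        (+-nonneg (Δ LD) (*-nonneg (*-nonneg (0≤pos 366) (square-nonneg M))
          (subst (0ℤ ≤_) (rest (d * d) _ _) (+-nonneg (square-nonneg (+ 3 * b - N)) (square-nonneg (+ 3 * c - N))))))
        (trans (identity (+ 366) N M D d) (cong (λ l → + 366 * (N * N) - l * D + + 366 * (M * M) * (D - d * d)) (sym L≡))))
      where
      rest : ∀ x y z → y + z ≡ x + y + z - x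
      rest = solve-∀
      identity : ∀ k N M D d → k * (N * N) - k * (M * d * (M * d)) ≡ k * (N * N) - k * (M * M) * D + k * (M * M) * (D - d * d)
      identity = solve-∀

  -- The cost of a vertex with z_k non-neighbours, x_k out- and y_k in-neighbours in the k-th part.
  module Attachment (N : ℤ) (z₀ x₀ y₀ z₁ x₁ y₁ z₂ x₂ y₂ : ℤ) where

    s₀ = x₀ + y₀
    s₁ = x₁ + y₁
    s₂ = x₂ + y₂
    n₀ = z₀ + s₀
    n₁ = z₁ + s₁
    n₂ = z₂ + s₂
    d₀ = + 3 * n₀ - N
    d₁ = + 3 * n₁ - N
    d₂ = + 3 * n₂ - N

    vertexCost : ℤ
    vertexCost = z₀ * z₀ + z₁ * z₁ + z₂ * z₂
      + + 2 * (s₀ * s₁ - x₀ * y₁ + (s₁ * s₂ - x₁ * y₂) + (s₂ * s₀ - x₂ * y₀))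

    -- The transitive pairs between parts 1 and 2, less the cyclic pairs of part 0 with each of
    -- them.
    T : ℤ
    T = x₁ * x₂ + y₁ * x₂ + y₁ * y₂ - x₀ * y₁ - x₂ * y₀

    -- The negative terms of `T` are absorbed in two ways, by `T₁` when y₁ ≤ x₂ and by `T₂`
    -- otherwise; both need `s₀` to be the least degree.
    T₁ : T ≡ (s₁ - s₀) * x₂ + (y₁ * y₂ + x₀ * (x₂ - y₁))
    T₁ = identity x₀ y₀ x₁ y₁ x₂ y₂
      where
      identity : ∀ x₀ y₀ x₁ y₁ x₂ y₂ → x₁ * x₂ + y₁ * x₂ + y₁ * y₂ - x₀ * y₁ - x₂ * y₀ ≡
        (x₁ + y₁ - (x₀ + y₀)) * x₂ + (y₁ * y₂ + x₀ * (x₂ - y₁))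
      identity = solve-∀

    T₂ : T ≡ (s₂ - s₀) * y₁ + (x₁ * x₂ + y₀ * (y₁ - x₂))
    T₂ = identity x₀ y₀ x₁ y₁ x₂ y₂
      where
      identity : ∀ x₀ y₀ x₁ y₁ x₂ y₂ → x₁ * x₂ + y₁ * x₂ + y₁ * y₂ - x₀ * y₁ - x₂ * y₀ ≡
        (x₂ + y₂ - (x₀ + y₀)) * y₁ + (x₁ * x₂ + y₀ * (y₁ - x₂))
      identity = solve-∀

    -- Completing squares around the correct attachment to part 0, where s₀, z₁, z₂, y₁ and x₂ all
    -- vanish and n₀² remains.
    vertexCost≡ : vertexCost ≡ n₀ * n₀ + s₀ * (+ 2 * n₁ + + 2 * n₂ - + 2 * n₀ - s₀)
      + (z₁ - s₀) * (z₁ - s₀) + (z₂ - s₀) * (z₂ - s₀) + + 2 * T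
    vertexCost≡ = identity z₀ x₀ y₀ z₁ x₁ y₁ z₂ x₂ y₂
      where
      identity : ∀ z₀ x₀ y₀ z₁ x₁ y₁ z₂ x₂ y₂ →
        z₀ * z₀ + z₁ * z₁ + z₂ * z₂
         + + 2 * ((x₀ + y₀) * (x₁ + y₁) - x₀ * y₁ + ((x₁ + y₁) * (x₂ + y₂) - x₁ * y₂) + ((x₂ + y₂) * (x₀ + y₀) - x₂ * y₀)) ≡
        (z₀ + (x₀ + y₀)) * (z₀ + (x₀ + y₀)) + (x₀ + y₀) * (+ 2 * (z₁ + (x₁ + y₁)) + + 2 * (z₂ + (x₂ + y₂)) - + 2 * (z₀ + (x₀ + y₀)) - (x₀ + y₀))
        + (z₁ - (x₀ + y₀)) * (z₁ - (x₀ + y₀)) + (z₂ - (x₀ + y₀)) * (z₂ - (x₀ + y₀)) + + 2 * (x₁ * x₂ + y₁ * x₂ + y₁ * y₂ - x₀ * y₁ - x₂ * y₀)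
      identity = solve-∀

    module _ (L M m : ℤ) (0<N : 0ℤ < N) (0<L : 0ℤ < L) (0≤m : 0ℤ ≤ m) (0<M : 0ℤ < M)
      (162M : + 162 * M ≤ L) (108M : + 108 * M ≤ N) (M≡ : M ≡ + 7 + + 3 * (m * m)) (m≡20 : m ≡ + 20)
      (0≤z₀ : 0ℤ ≤ z₀) (0≤x₀ : 0ℤ ≤ x₀) (0≤y₀ : 0ℤ ≤ y₀) (0≤z₁ : 0ℤ ≤ z₁) (0≤x₁ : 0ℤ ≤ x₁) (0≤y₁ : 0ℤ ≤ y₁)
      (0≤z₂ : 0ℤ ≤ z₂) (0≤x₂ : 0ℤ ≤ x₂) (0≤y₂ : 0ℤ ≤ y₂)
      (d₀≤ : M * d₀ ≤ N) (≤d₀ : - N ≤ M * d₀) (≤d₁ : - N ≤ M * d₁) (≤d₂ : - N ≤ M * d₂)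
      (s₀≤s₁ : s₀ ≤ s₁) (s₀≤s₂ : s₀ ≤ s₂)
      (cheap : + 9 * (L * vertexCost) ≤ L * (N * N) + + 54 * (L * N) + + 81 * (N * N)) where

      private
        0≤N = <⇒≤ 0<N
        0≤L = <⇒≤ 0<L
        0≤M = <⇒≤ 0<M
        0≤s₀ = +-nonneg 0≤x₀ 0≤y₀

        T₁≥ : y₁ ≤ x₂ → (s₁ - s₀) * x₂ ≤ T
        T₁≥ y₁≤x₂ = ≤-by (y₁ * y₂ + x₀ * (x₂ - y₁)) (+-nonneg (*-nonneg 0≤y₁ 0≤y₂) (*-nonneg 0≤x₀ (Δ y₁≤x₂)))
          (trans (cong (λ t → t - (s₁ - s₀) * x₂) T₁) (drop ((s₁ - s₀) * x₂) _))
          where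
          drop : ∀ a b → a + b - a ≡ b
          drop = solve-∀

        T₂≥ : x₂ ≤ y₁ → (s₂ - s₀) * y₁ ≤ T
        T₂≥ x₂≤y₁ = ≤-by (x₁ * x₂ + y₀ * (y₁ - x₂)) (+-nonneg (*-nonneg 0≤x₁ 0≤x₂) (*-nonneg 0≤y₀ (Δ x₂≤y₁)))
          (trans (cong (λ t → t - (s₂ - s₀) * y₁) T₂) (drop ((s₂ - s₀) * y₁) _))
          where
          drop : ∀ a b → a + b - a ≡ b
          drop = solve-∀

        0≤T : 0ℤ ≤ T
        0≤T with ≤-total y₁ x₂
        ... | inj₁ p = ≤-trans (*-nonneg (Δ s₀≤s₁) 0≤x₂) (T₁≥ p)
        ... | inj₂ p = ≤-trans (*-nonneg (Δ s₀≤s₂) 0≤y₁) (T₂≥ p)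

        e₁ = z₁ - s₀
        e₂ = z₂ - s₀

        -- All deviations `d` are at most N/M in absolute value. In the factor of 3s they cost (2 +
        -- 2 + 3)N/M, hence M - 7. On the right, 2N² comes from `d₀` and N²/2 each from the terms
        -- 54N and 81N²/L.
        excess : ∀ s W → 0ℤ ≤ s →
          + 9 * vertexCost ≡ N * N + + 2 * (N * d₀) + d₀ * d₀ + + 3 * s * (N + + 2 * d₁ + + 2 * d₂ - + 3 * d₀) + W →
          M * W + + 3 * (s * N) * (M - + 7) ≤ + 3 * (N * N)
        excess s W 0≤s cost≡ = cancel-≤ (+ 2 * L) (*-pos (0<pos 1) 0<L)
          (≤-by (+ 2 * M * (L * (N * N) + + 54 * (L * N) + + 81 * (N * N) - + 9 * (L * vertexCost))
              + L * N * (N - + 108 * M) + N * N * (L - + 162 * M)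
              + + 4 * (L * N) * (N + M * d₀)
              + + 2 * (L * M) * (d₀ * d₀)
              + + 6 * (L * s) * (+ 2 * (M * d₁ - - N) + + 2 * (M * d₂ - - N) + + 3 * (N - M * d₀)))
            (+-nonneg (+-nonneg
              (+-nonneg (+-nonneg (+-nonneg (*-nonneg (*-nonneg (0≤pos 2) 0≤M) (Δ cheap))
                (*-nonneg (*-nonneg 0≤L 0≤N) (Δ 108M))) (*-nonneg (square-nonneg N) (Δ 162M)))
                (*-nonneg (*-nonneg (0≤pos 4) (*-nonneg 0≤L 0≤N)) (subst (0ℤ ≤_) (swap N (M * d₀)) (Δ ≤d₀))))
                (*-nonneg (*-nonneg (0≤pos 2) (*-nonneg 0≤L 0≤M)) (square-nonneg d₀)))
                (*-nonneg (*-nonneg (0≤pos 6) (*-nonneg 0≤L 0≤s))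
                  (+-nonneg (+-nonneg (*-nonneg (0≤pos 2) (Δ ≤d₁)) (*-nonneg (0≤pos 2) (Δ ≤d₂))) (*-nonneg (0≤pos 3) (Δ d₀≤)))))
            (trans (identity N L M d₀ d₁ d₂ s W)
              (cong (λ c → + 2 * M * (L * (N * N) + + 54 * (L * N) + + 81 * (N * N) - c)
                + L * N * (N - + 108 * M) + N * N * (L - + 162 * M)
                + + 4 * (L * N) * (N + M * d₀)
                + + 2 * (L * M) * (d₀ * d₀)
                + + 6 * (L * s) * (+ 2 * (M * d₁ - - N) + + 2 * (M * d₂ - - N) + + 3 * (N - M * d₀)))
                (trans (cong (L *_) (sym cost≡)) (rotate L vertexCost)))))
          where
          swap : ∀ a b → b - - a ≡ a + b
          swap = solve-∀
          rotate : ∀ l v → l * (+ 9 * v) ≡ + 9 * (l * v)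
          rotate = solve-∀
          identity : ∀ N L M d₀ d₁ d₂ s W → + 2 * L * (+ 3 * (N * N)) - + 2 * L * (M * W + + 3 * (s * N) * (M - + 7)) ≡
            + 2 * M * (L * (N * N) + + 54 * (L * N) + + 81 * (N * N) - L * (N * N + + 2 * (N * d₀) + d₀ * d₀ + + 3 * s * (N + + 2 * d₁ + + 2 * d₂ - + 3 * d₀) + W))
              + L * N * (N - + 108 * M) + N * N * (L - + 162 * M)
              + + 4 * (L * N) * (N + M * d₀)
              + + 2 * (L * M) * (d₀ * d₀)
              + + 6 * (L * s) * (+ 2 * (M * d₁ - - N) + + 2 * (M * d₂ - - N) + + 3 * (N - M * d₀))
          identity = solve-∀

        W : ℤ
        W = + 9 * (s₀ * z₀) + + 9 * (e₁ * e₁) + + 9 * (e₂ * e₂) + + 18 * T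

        main : M * W + + 3 * (s₀ * N) * (M - + 7) ≤ + 3 * (N * N)
        main = excess s₀ W 0≤s₀ (trans (cong (+ 9 *_) vertexCost≡) (identity N s₀ z₀ n₁ n₂ e₁ e₂ T))
          where
          identity : ∀ N s z n₁ n₂ e₁ e₂ T → let n₀ = z + s in
            + 9 * (n₀ * n₀ + s * (+ 2 * n₁ + + 2 * n₂ - + 2 * n₀ - s) + e₁ * e₁ + e₂ * e₂ + + 2 * T) ≡
            N * N + + 2 * (N * (+ 3 * n₀ - N)) + (+ 3 * n₀ - N) * (+ 3 * n₀ - N)
              + + 3 * s * (N + + 2 * (+ 3 * n₁ - N) + + 2 * (+ 3 * n₂ - N) - + 3 * (+ 3 * n₀ - N))
              + (+ 9 * (s * z) + + 9 * (e₁ * e₁) + + 9 * (e₂ * e₂) + + 18 * T)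
          identity = solve-∀

        main′ : (+ 7 + + 3 * (m * m)) * W + + 3 * (s₀ * N) * (+ 7 + + 3 * (m * m) - + 7) ≤ + 3 * (N * N)
        main′ = subst (λ M → M * W + + 3 * (s₀ * N) * (M - + 7) ≤ + 3 * (N * N)) M≡ main

        0≤9s₀z₀ = *-nonneg (0≤pos 9) (*-nonneg 0≤s₀ 0≤z₀)
        0≤9e₁² = *-nonneg (0≤pos 9) (square-nonneg e₁)
        0≤9e₂² = *-nonneg (0≤pos 9) (square-nonneg e₂)
        0≤18T = *-nonneg (0≤pos 18) 0≤T
        0≤W = +-nonneg (+-nonneg (+-nonneg 0≤9s₀z₀ 0≤9e₁²) 0≤9e₂²) 0≤18T
        0≤sN3mm = *-nonneg (*-nonneg (0≤pos 9) (square-nonneg m)) (*-nonneg 0≤s₀ 0≤N)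

        s₀-small : + 3 * (m * m) * s₀ ≤ N
        s₀-small = cancel-≤ (+ 3 * N) (*-pos (0<pos 2) 0<N)
          (≤-by (+ 3 * (N * N) - ((+ 7 + + 3 * (m * m)) * W + + 3 * (s₀ * N) * (+ 7 + + 3 * (m * m) - + 7)) + (+ 7 + + 3 * (m * m)) * W)
            (+-nonneg (Δ main′) (*-nonneg (+-nonneg (0≤pos 7) (*-nonneg (0≤pos 3) (square-nonneg m))) 0≤W))
            (identity N m s₀ W))
          where
          identity : ∀ N m s W → + 3 * N * N - + 3 * N * (+ 3 * (m * m) * s) ≡
            + 3 * (N * N) - ((+ 7 + + 3 * (m * m)) * W + + 3 * (s * N) * (+ 7 + + 3 * (m * m) - + 7)) + (+ 7 + + 3 * (m * m)) * W
          identity = solve-∀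

        -- `W` is a sum of nonnegative terms and M ≥ 3m², so each of its terms obeys the bound by
        -- itself.
        piece : ∀ a b → 0ℤ ≤ a → 0ℤ ≤ b → W ≡ a + b → m * m * a ≤ N * N
        piece a b 0≤a 0≤b W≡ = cancel-≤ (+ 3) (0<pos 2)
          (≤-by (+ 3 * (N * N) - ((+ 7 + + 3 * (m * m)) * W + + 3 * (s₀ * N) * (+ 7 + + 3 * (m * m) - + 7))
                 + + 9 * (m * m) * (s₀ * N) + + 7 * W + + 3 * (m * m) * b)
            (+-nonneg (+-nonneg (+-nonneg (Δ main′) 0≤sN3mm) (*-nonneg (0≤pos 7) 0≤W))
              (*-nonneg (*-nonneg (0≤pos 3) (square-nonneg m)) 0≤b))
            (subst (λ w → + 3 * (N * N) - + 3 * (m * m * a) ≡ + 3 * (N * N) - ((+ 7 + + 3 * (m * m)) * w + + 3 * (s₀ * N) * (+ 7 + + 3 * (m * m) - + 7))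
                 + + 9 * (m * m) * (s₀ * N) + + 7 * w + + 3 * (m * m) * b) (sym W≡) (identity N m s₀ a b)))
          where
          identity : ∀ N m s a b → + 3 * (N * N) - + 3 * (m * m * a) ≡ + 3 * (N * N) - ((+ 7 + + 3 * (m * m)) * (a + b) + + 3 * (s * N) * (+ 7 + + 3 * (m * m) - + 7))
                 + + 9 * (m * m) * (s * N) + + 7 * (a + b) + + 3 * (m * m) * b
          identity = solve-∀

        e₁-small : + 3 * m * e₁ ≤ N
        e₁-small = square-≤⇒≤ 0≤N (subst (_≤ N * N) (identity m e₁)
          (piece (+ 9 * (e₁ * e₁)) (+ 9 * (s₀ * z₀) + + 9 * (e₂ * e₂) + + 18 * T) 0≤9e₁² (+-nonneg (+-nonneg 0≤9s₀z₀ 0≤9e₂²) 0≤18T)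
            (reorder (+ 9 * (s₀ * z₀)) (+ 9 * (e₁ * e₁)) (+ 9 * (e₂ * e₂)) (+ 18 * T))))
          where
          identity : ∀ m e → m * m * (+ 9 * (e * e)) ≡ + 3 * m * e * (+ 3 * m * e)
          identity = solve-∀
          reorder : ∀ a b c d → a + b + c + d ≡ b + (a + c + d)
          reorder = solve-∀

        e₂-small : + 3 * m * e₂ ≤ N
        e₂-small = square-≤⇒≤ 0≤N (subst (_≤ N * N) (identity m e₂)
          (piece (+ 9 * (e₂ * e₂)) (+ 9 * (s₀ * z₀) + + 9 * (e₁ * e₁) + + 18 * T) 0≤9e₂² (+-nonneg (+-nonneg 0≤9s₀z₀ 0≤9e₁²) 0≤18T)
            (reorder (+ 9 * (s₀ * z₀)) (+ 9 * (e₁ * e₁)) (+ 9 * (e₂ * e₂)) (+ 18 * T))))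
          where
          identity : ∀ m e → m * m * (+ 9 * (e * e)) ≡ + 3 * m * e * (+ 3 * m * e)
          identity = solve-∀
          reorder : ∀ a b c d → a + b + c + d ≡ c + (a + b + d)
          reorder = solve-∀

        T-small : m * m * (+ 18 * T) ≤ N * N
        T-small = piece (+ 18 * T) (+ 9 * (s₀ * z₀) + + 9 * (e₁ * e₁) + + 9 * (e₂ * e₂)) 0≤18T
          (+-nonneg (+-nonneg 0≤9s₀z₀ 0≤9e₁²) 0≤9e₂²) (+-comm (+ 9 * (s₀ * z₀) + + 9 * (e₁ * e₁) + + 9 * (e₂ * e₂)) (+ 18 * T))

        s₀≤ : + 1200 * s₀ ≤ N
        s₀≤ = subst (λ m → + 3 * (m * m) * s₀ ≤ N) m≡20 s₀-small

        e₁≤ : + 60 * e₁ ≤ N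
        e₁≤ = subst (λ m → + 3 * m * e₁ ≤ N) m≡20 e₁-small

        e₂≤ : + 60 * e₂ ≤ N
        e₂≤ = subst (λ m → + 3 * m * e₂ ≤ N) m≡20 e₂-small

        T≤ : + 400 * (+ 18 * T) ≤ N * N
        T≤ = subst (λ m → m * m * (+ 18 * T) ≤ N * N) m≡20 T-small

        k : ℤ
        k = + 60

        0≤margin : 0ℤ ≤ + 5 * (k * M) - + 20 * k - + 66 * M
        0≤margin = subst (λ M → 0ℤ ≤ + 5 * (k * M) - + 20 * k - + 66 * M)
          (sym (trans M≡ (cong (λ m → + 7 + + 3 * (m * m)) m≡20))) (0≤pos 281238)

        -- Such a part has about N/3 vertices and few of them are non-neighbours, so its degree
        -- exceeds the tiny `s₀` by nearly N/3.
        far : ∀ z s → - N ≤ M * (+ 3 * (z + s) - N) → k * (z - s₀) ≤ N → N ≤ + 4 * (s - s₀)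
        far z s ≤d e≤ = cancel-≤ (+ 15 * (k * M)) (*-pos (0<pos 14) (*-pos (0<pos 59) 0<M))
          (≤-by (+ 20 * k * (M * (+ 3 * (z + s) - N) - - N) + + 60 * M * (N - k * (z - s₀)) + + 6 * M * (N - + 20 * k * s₀)
              + N * (+ 5 * (k * M) - + 20 * k - + 66 * M))
            (+-nonneg (+-nonneg (+-nonneg (*-nonneg (0≤pos 1200) (Δ ≤d)) (*-nonneg (*-nonneg (0≤pos 60) 0≤M) (Δ e≤)))
              (*-nonneg (*-nonneg (0≤pos 6) 0≤M) (Δ s₀≤))) (*-nonneg 0≤N 0≤margin))
            (identity N M z s s₀ k))
          where
          identity : ∀ N M z s s₀ k → + 15 * (k * M) * (+ 4 * (s - s₀)) - + 15 * (k * M) * N ≡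
            + 20 * k * (M * (+ 3 * (z + s) - N) - - N) + + 60 * M * (N - k * (z - s₀)) + + 6 * M * (N - + 20 * k * s₀)
              + N * (+ 5 * (k * M) - + 20 * k - + 66 * M)
          identity = solve-∀

        -- The product is at most T ≤ N²/7200 while its first factor is at least N/4, so `x` has
        -- order N/1800; the weaker N/600 suffices.
        tiny : ∀ s x → 0ℤ ≤ x → N ≤ + 4 * (s - s₀) → (s - s₀) * x ≤ T → + 10 * k * x ≤ N
        tiny s x 0≤x far sx≤T = ≤-trans (*-monoʳ-≤-nonNeg x {{nonNegative 0≤x}} {+ 600} {+ 800} (from-yes (+ 600 ≤? + 800)))
          (cancel-≤ (+ 9 * N) (*-pos (0<pos 8) 0<N)
            (≤-by (+ 4 * (N * N - + 400 * (+ 18 * T)) + + 72 * + 400 * (T - (s - s₀) * x) + + 18 * + 400 * x * (+ 4 * (s - s₀) - N) + + 5 * (N * N))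
              (+-nonneg (+-nonneg (+-nonneg (*-nonneg (0≤pos 4) (Δ T≤)) (*-nonneg (0≤pos 28800) (Δ sx≤T)))
                (*-nonneg (*-nonneg (0≤pos 7200) 0≤x) (Δ far))) (*-nonneg (0≤pos 5) (square-nonneg N)))
              (identity N s s₀ x T (+ 400))))
          where
          identity : ∀ N s s₀ x T c → + 9 * N * N - + 9 * N * (+ 2 * c * x) ≡
            + 4 * (N * N - c * (+ 18 * T)) + + 72 * c * (T - (s - s₀) * x) + + 18 * c * x * (+ 4 * (s - s₀) - N) + + 5 * (N * N)
          identity = solve-∀

        far₁ : N ≤ + 4 * (s₁ - s₀)
        far₁ = far z₁ s₁ ≤d₁ e₁≤

        far₂ : N ≤ + 4 * (s₂ - s₀)
        far₂ = far z₂ s₂ ≤d₂ e₂≤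

        x₂-and-y₁ : + 10 * k * x₂ ≤ N × + 10 * k * y₁ ≤ N
        x₂-and-y₁ with ≤-total y₁ x₂
        ... | inj₁ y₁≤x₂ = x₂≤ , ≤-trans (*-monoˡ-≤-nonNeg (+ 600) y₁≤x₂) x₂≤
          where x₂≤ = tiny s₁ x₂ 0≤x₂ far₁ (T₁≥ y₁≤x₂)
        ... | inj₂ x₂≤y₁ = ≤-trans (*-monoˡ-≤-nonNeg (+ 600) x₂≤y₁) y₁≤ , y₁≤
          where y₁≤ = tiny s₂ y₁ 0≤y₁ far₂ (T₂≥ x₂≤y₁)

      -- The sum equals 3s₀ + e₁ + e₂ + y₁ + x₂, at most (3 + 20 + 20 + 2 + 2)N/1200, which is just
      -- below N/25.
      few-wrong-neighbours : + 25 * (x₀ + y₀ + (z₁ + y₁) + (z₂ + x₂)) ≤ N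
      few-wrong-neighbours = cancel-≤ (+ 48) (0<pos 47)
        (≤-by (+ 3 * (N - + 20 * k * s₀) + + 20 * (N - k * e₁) + + 20 * (N - k * e₂)
            + + 2 * (N - + 10 * k * x₂) + + 2 * (N - + 10 * k * y₁) + N)
          (+-nonneg (+-nonneg (+-nonneg (+-nonneg (+-nonneg (*-nonneg (0≤pos 3) (Δ s₀≤)) (*-nonneg (0≤pos 20) (Δ e₁≤)))
            (*-nonneg (0≤pos 20) (Δ e₂≤))) (*-nonneg (0≤pos 2) (Δ (proj₁ x₂-and-y₁)))) (*-nonneg (0≤pos 2) (Δ (proj₂ x₂-and-y₁)))) 0≤N)
          (trans (cong (λ x → + 48 * N - x) (scale (x₀ + y₀ + (z₁ + y₁) + (z₂ + x₂)))) (identity N x₀ y₀ z₁ y₁ z₂ x₂ k)))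
        where
        scale : ∀ x → + 48 * (+ 25 * x) ≡ + 20 * k * x
        scale x = sym (*-assoc (+ 48) (+ 25) x)
        identity : ∀ N x₀ y₀ z₁ y₁ z₂ x₂ k → + 48 * N - + 20 * k * (x₀ + y₀ + (z₁ + y₁) + (z₂ + x₂)) ≡
          + 3 * (N - + 20 * k * (x₀ + y₀)) + + 20 * (N - k * (z₁ - (x₀ + y₀))) + + 20 * (N - k * (z₂ - (x₀ + y₀)))
            + + 2 * (N - + 10 * k * x₂) + + 2 * (N - + 10 * k * y₁) + N
        identity = solve-∀

open VertexPolynomial

-- Distinct triples, and cloning a vertex of an optimal graph.

module Symmetrization where

  open import Data.Integer hiding (suc; _≟_; _/_; _%_)
  open import Data.Integer.Properties hiding (_≟_)

  δ-refl : (i : Fin n) → δ i i ≡ 1ℤ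
  δ-refl i with i ≟ i
  ... | yes _  = refl
  ... | no i≢i = contradiction refl i≢i

  δ-≢ : {i j : Fin n} → i ≢ j → δ i j ≡ 0ℤ
  δ-≢ {i = i} {j} i≢j with i ≟ j
  ... | yes i≡j = contradiction i≡j i≢j
  ... | no _    = refl

  sum-δ : (v : Fin n) (h : Fin n → ℤ) → sum (λ u → δ v u * h u) ≡ h v
  sum-δ {ℕ.suc n} zero h = trans (cong₂ _+_ (*-identityˡ (h zero)) (sum-0 n)) (+-identityʳ (h zero))
  sum-δ (suc v) h = trans (+-identityˡ _) (sum-δ v (λ u → h (suc u)))

  sum-δ-1 : (v : Fin n) → sum (δ v) ≡ 1ℤ
  sum-δ-1 v = trans (sum-cong-≗ (λ u → sym (*-identityʳ (δ v u)))) (sum-δ v (λ _ → 1ℤ))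

  sum²-δ : ∀ n → sum² {n} δ ≡ + n
  sum²-δ n = trans (sum-cong-≗ {n} sum-δ-1) (trans (sum-const n 1ℤ) (*-identityʳ (+ n)))

  distinct : Fin n → Fin n → Fin n → ℤ
  distinct u v w = (1ℤ - δ u v) * ((1ℤ - δ v w) * (1ℤ - δ u w))

  δ-sym : (i j : Fin n) → δ i j ≡ δ j i
  δ-sym i j with i ≟ j
  ... | yes refl = sym (δ-refl i)
  ... | no i≢j   = sym (δ-≢ (λ j≡i → i≢j (sym j≡i)))

  distinct-swap₁₂ : (u v w : Fin n) → distinct v u w ≡ distinct u v w
  distinct-swap₁₂ u v w = trans (cong (λ d → (1ℤ - d) * ((1ℤ - δ u w) * (1ℤ - δ v w))) (δ-sym v u))
    (eq (1ℤ - δ u v) (1ℤ - δ u w) (1ℤ - δ v w))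
    where
    eq : ∀ a b c → a * (b * c) ≡ a * (c * b)
    eq = solve-∀

  distinct-swap₂₃ : (u v w : Fin n) → distinct u w v ≡ distinct u v w
  distinct-swap₂₃ u v w = trans (cong (λ d → (1ℤ - δ u w) * ((1ℤ - d) * (1ℤ - δ u v))) (δ-sym w v))
    (eq (1ℤ - δ u v) (1ℤ - δ v w) (1ℤ - δ u w))
    where
    eq : ∀ a b c → c * (b * a) ≡ a * (b * c)
    eq = solve-∀

  distinct₁₂ : (u v w : Fin n) → u ≡ v → distinct u v w ≡ 0ℤ
  distinct₁₂ u v w refl = cong (λ d → (1ℤ - d) * ((1ℤ - δ u w) * (1ℤ - δ u w))) (δ-refl u)

  distinct₂₃ : (u v w : Fin n) → v ≡ w → distinct u v w ≡ 0ℤ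
  distinct₂₃ u v w refl = trans (cong (λ d → (1ℤ - δ u v) * ((1ℤ - d) * (1ℤ - δ u v))) (δ-refl v)) (*-zeroʳ (1ℤ - δ u v))

  distinct₁₃ : (u v w : Fin n) → u ≡ w → distinct u v w ≡ 0ℤ
  distinct₁₃ u v w refl = trans (cong (λ d → (1ℤ - δ u v) * ((1ℤ - δ v u) * (1ℤ - d))) (δ-refl u))
    (trans (cong (λ x → (1ℤ - δ u v) * x) (*-zeroʳ (1ℤ - δ v u))) (*-zeroʳ (1ℤ - δ u v)))

  distinct-≢ : {u v w : Fin n} → u ≢ v → v ≢ w → u ≢ w → distinct u v w ≡ 1ℤ
  distinct-≢ u≢v v≢w u≢w rewrite δ-≢ u≢v | δ-≢ v≢w | δ-≢ u≢w = refl

  data Distinctness (u v w : Fin n) : Set where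
    equal₁₂ : u ≡ v → Distinctness u v w
    equal₂₃ : v ≡ w → Distinctness u v w
    equal₁₃ : u ≡ w → Distinctness u v w
    all-distinct : u ≢ v → v ≢ w → u ≢ w → Distinctness u v w

  distinctness : (u v w : Fin n) → Distinctness u v w
  distinctness u v w with u ≟ v | v ≟ w | u ≟ w
  ... | yes p | _     | _     = equal₁₂ p
  ... | no _  | yes p | _     = equal₂₃ p
  ... | no _  | no _  | yes p = equal₁₃ p
  ... | no p  | no q  | no r  = all-distinct p q r

  distinct-nonneg : ∀ (u v w : Fin n) {c} → 0ℤ ≤ c → 0ℤ ≤ distinct u v w * c
  distinct-nonneg u v w {c} 0≤c with distinctness u v w
  ... | equal₁₂ p rewrite distinct₁₂ u v w p = ≤-refl
  ... | equal₂₃ p rewrite distinct₂₃ u v w p = ≤-refl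
  ... | equal₁₃ p rewrite distinct₁₃ u v w p = ≤-refl
  ... | all-distinct p q r rewrite distinct-≢ p q r = subst (0ℤ ≤_) (sym (*-identityˡ c)) 0≤c

  distinct-lower : ∀ (u v w : Fin n) {c} → 0ℤ ≤ c → c ≤ 1ℤ → c - distinct u v w * c ≤ δ u v + δ v w + δ u w
  distinct-lower u v w {c} 0≤c c≤1 with distinctness u v w
  ... | equal₁₂ refl rewrite distinct₁₂ u u w refl | δ-refl u = ≤-by (1ℤ - c + (δ u w + δ u w)) (+-nonneg (Δ c≤1) (+-nonneg (δ-nonneg u w) (δ-nonneg u w))) (eq c (δ u w))
    where
    eq : ∀ c d → 1ℤ + d + d - (c - 0ℤ) ≡ 1ℤ - c + (d + d)
    eq = solve-∀
  ... | equal₂₃ refl rewrite distinct₂₃ u v v refl | δ-refl v = ≤-by (1ℤ - c + (δ u v + δ u v)) (+-nonneg (Δ c≤1) (+-nonneg (δ-nonneg u v) (δ-nonneg u v))) (eq c (δ u v))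
    where
    eq : ∀ c d → d + 1ℤ + d - (c - 0ℤ) ≡ 1ℤ - c + (d + d)
    eq = solve-∀
  ... | equal₁₃ refl rewrite distinct₁₃ u v u refl | δ-refl u = ≤-by (1ℤ - c + (δ u v + δ v u)) (+-nonneg (Δ c≤1) (+-nonneg (δ-nonneg u v) (δ-nonneg v u))) (eq c (δ u v) (δ v u))
    where
    eq : ∀ c d e → d + e + 1ℤ - (c - 0ℤ) ≡ 1ℤ - c + (d + e)
    eq = solve-∀
  ... | all-distinct p q r rewrite distinct-≢ p q r = ≤-by (δ u v + δ v w + δ u w) (+-nonneg (+-nonneg (δ-nonneg u v) (δ-nonneg v w)) (δ-nonneg u w)) (eq c (δ u v + δ v w + δ u w))
    where
    eq : ∀ c d → d - (c - 1ℤ * c) ≡ d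
    eq = solve-∀

  abstract
    tripleCost-nonneg : ∀ a b c → 0ℤ ≤ tripleCost a b c
    tripleCost-nonneg = from-yes (all? λ a → all? λ b → all? λ c → 0ℤ ≤? tripleCost a b c)

    tripleCost≤1 : ∀ a b c → tripleCost a b c ≤ 1ℤ
    tripleCost≤1 = from-yes (all? λ a → all? λ b → all? λ c → tripleCost a b c ≤? 1ℤ)

    tripleCost-swap₁₂ : ∀ a b c → tripleCost (flip a) c b ≡ tripleCost a b c
    tripleCost-swap₁₂ = from-yes (all? λ a → all? λ b → all? λ c → tripleCost (flip a) c b ℤ.≟ tripleCost a b c)

    tripleCost-swap₂₃ : ∀ a b c → tripleCost c (flip b) a ≡ tripleCost a b c
    tripleCost-swap₂₃ = from-yes (all? λ a → all? λ b → all? λ c → tripleCost c (flip b) a ℤ.≟ tripleCost a b c)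

  distinctTotal : (Fin n → Fin n → Fin 3) → ℤ
  distinctTotal ρ = sum³ λ u v w → distinct u v w * cost ρ u v w

  Optimal : (Fin n → Fin n → Fin 3) → Set
  Optimal {n} ρ = ∀ (ρ′ : Fin n → Fin n → Fin 3) → Antisymmetric ρ′ → distinctTotal ρ ≤ distinctTotal ρ′

  module _ {ρ : Fin n → Fin n → Fin 3} (anti : Antisymmetric ρ) where

    cost-swap₁₂ : ∀ u v w → cost ρ v u w ≡ cost ρ u v w
    cost-swap₁₂ u v w rewrite anti u v = tripleCost-swap₁₂ (ρ u v) (ρ v w) (ρ u w)

    cost-swap₂₃ : ∀ u v w → cost ρ u w v ≡ cost ρ u v w
    cost-swap₂₃ u v w rewrite anti v w = tripleCost-swap₂₃ (ρ u v) (ρ v w) (ρ u w)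

  cost-nonneg : ∀ (ρ : Fin n → Fin n → Fin 3) u v w → 0ℤ ≤ cost ρ u v w
  cost-nonneg ρ u v w = tripleCost-nonneg (ρ u v) (ρ v w) (ρ u w)

  -- A triple missed by `distinctTotal` has one of three coincidences, each with n² triples.
  -- Multiplied by 9 this is the error 27n² carried through the stability argument.
  total-≤-distinct : ∀ {n} (ρ : Fin n → Fin n → Fin 3) → total ρ ≤ distinctTotal ρ + + 3 * (+ n * + n)
  total-≤-distinct {n} ρ = ≤-by (+ 3 * (+ n * + n) - (total ρ - distinctTotal ρ)) (Δ bound) (eq (total ρ) (distinctTotal ρ) (+ 3 * (+ n * + n)))
    where
    eq : ∀ a b c → b + c - a ≡ c - (a - b)
    eq = solve-∀
    bound : total ρ - distinctTotal ρ ≤ + 3 * (+ n * + n)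
    bound = subst₂ _≤_ (sum³-sub {n} (cost ρ) (λ u v w → distinct u v w * cost ρ u v w))
      (trans (sum³-pairs {n} δ) (cong (λ x → + 3 * (+ n * x)) (sum²-δ n)))
      (sum³-mono {n} (λ u v w → distinct-lower u v w (cost-nonneg ρ u v w) (tripleCost≤1 (ρ u v) (ρ v w) (ρ u w))))

  vertexTotal : (Fin n → Fin n → Fin 3) → Fin n → ℤ
  vertexTotal ρ v = sum² (cost ρ v)

  module Cloning {n} {ρ : Fin n → Fin n → Fin 3} (anti : Antisymmetric ρ) (optimal : Optimal ρ) (v₀ u₀ : Fin n) where

    -- Pulling `ρ` back along `φ` makes `v₀` a twin of `u₀`; the two are not adjacent because the
    -- diagonal of `ρ` is `0F`.
    φ : Fin n → Fin n
    φ x = if does (v₀ ≟ x) then u₀ else x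

    ρ′ : Fin n → Fin n → Fin 3
    ρ′ x y = ρ (φ x) (φ y)

    anti′ : Antisymmetric ρ′
    anti′ x y = anti (φ x) (φ y)

    change : Fin n → Fin n → Fin n → ℤ
    change u x y = distinct u x y * (cost ρ′ u x y - cost ρ u x y)

    private
      vanish : ∀ {d} k (a b c : ℤ) → d ≡ 0ℤ → d * k ≡ a * (d * k) + b * (d * k) + c * (d * k)
      vanish k a b c refl = eq a b c
        where
        eq : ∀ a b c → 0ℤ ≡ a * 0ℤ + b * 0ℤ + c * 0ℤ
        eq = solve-∀
      first : ∀ g → g ≡ 1ℤ * g + 0ℤ * g + 0ℤ * g
      first = solve-∀
      second : ∀ g → g ≡ 0ℤ * g + 1ℤ * g + 0ℤ * g
      second = solve-∀
      third : ∀ g → g ≡ 0ℤ * g + 0ℤ * g + 1ℤ * g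
      third = solve-∀
      none : ∀ d c → d * (c - c) ≡ 0ℤ * (d * (c - c)) + 0ℤ * (d * (c - c)) + 0ℤ * (d * (c - c))
      none = solve-∀

    -- A triple without `v₀` does not change, and one that meets `v₀` twice is killed by `distinct`;
    -- in the remaining case exactly one summand survives.
    change-split : ∀ u x y → change u x y ≡ δ v₀ u * change u x y + δ v₀ x * change u x y + δ v₀ y * change u x y
    change-split u x y with v₀ ≟ u | v₀ ≟ x | v₀ ≟ y
    ... | no _  | no _  | no _  = none (distinct u x y) (cost ρ u x y)
    ... | yes p | no _  | no _  = first _
    ... | no _  | yes p | no _  = second _
    ... | no _  | no _  | yes p = third _
    ... | yes p | yes q | no _  = vanish _ 1ℤ 1ℤ 0ℤ (distinct₁₂ u x y (trans (sym p) q))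
    ... | yes p | yes q | yes _ = vanish _ 1ℤ 1ℤ 1ℤ (distinct₁₂ u x y (trans (sym p) q))
    ... | yes p | no _  | yes q = vanish _ 1ℤ 0ℤ 1ℤ (distinct₁₃ u x y (trans (sym p) q))
    ... | no _  | yes p | yes q = vanish _ 0ℤ 1ℤ 1ℤ (distinct₂₃ u x y (trans (sym p) q))

    change-swap₁₂ : ∀ u x y → change x u y ≡ change u x y
    change-swap₁₂ u x y = cong₂ _*_ (distinct-swap₁₂ u x y) (cong₂ _-_ (cost-swap₁₂ anti′ u x y) (cost-swap₁₂ anti u x y))

    change-swap₂₃ : ∀ u x y → change u y x ≡ change u x y
    change-swap₂₃ u x y = cong₂ _*_ (distinct-swap₂₃ u x y) (cong₂ _-_ (cost-swap₂₃ anti′ u x y) (cost-swap₂₃ anti u x y))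

    sum-change : sum³ change ≡ + 3 * sum² (change v₀)
    sum-change = trans (sum³-cong change-split)
      (trans (sum³-+ (λ u x y → δ v₀ u * change u x y + δ v₀ x * change u x y) (λ u x y → δ v₀ y * change u x y))
        (trans (cong₂ _+_ (trans (sum³-+ (λ u x y → δ v₀ u * change u x y) (λ u x y → δ v₀ x * change u x y)) (cong₂ _+_ one two)) three)
          (thrice (sum² (change v₀)))))
      where
      thrice : ∀ x → x + x + x ≡ + 3 * x
      thrice = solve-∀
      g₁ g₂ : Fin n → Fin n → Fin n → ℤ
      g₁ u x y = δ v₀ u * change u x y
      g₂ u x y = δ v₀ x * change u x y
      one : sum³ g₁ ≡ sum² (change v₀)
      one = trans (sum-cong-≗ (λ u → sum²-*ˡ (δ v₀ u) (change u))) (sum-δ v₀ (λ u → sum² (change u)))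
      two : sum³ g₂ ≡ sum² (change v₀)
      two = trans (sym (sum³-swap₁₂ g₂)) (trans (sum³-cong (λ u x y → cong (δ v₀ u *_) (change-swap₁₂ u x y))) one)
      three : sum³ (λ u x y → δ v₀ y * change u x y) ≡ sum² (change v₀)
      three = trans (sym (sum³-swap₂₃ (λ u x y → δ v₀ y * change u x y)))
        (trans (sum³-cong (λ u x y → cong (δ v₀ x *_) (change-swap₂₃ u x y))) two)

    change-upper : ∀ x y → change v₀ x y ≤ cost ρ u₀ x y - cost ρ v₀ x y + (δ v₀ x + δ x y + δ v₀ y)
    change-upper x y = ≤-by
      (cost ρ u₀ x y - distinct v₀ x y * cost ρ′ v₀ x y
        + (δ v₀ x + δ x y + δ v₀ y - (cost ρ v₀ x y - distinct v₀ x y * cost ρ v₀ x y)))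
      (+-nonneg (Δ gain) (Δ (distinct-lower v₀ x y (cost-nonneg ρ v₀ x y) (tripleCost≤1 (ρ v₀ x) (ρ x y) (ρ v₀ y)))))
      (eq (cost ρ u₀ x y) (cost ρ v₀ x y) (cost ρ′ v₀ x y) (distinct v₀ x y) (δ v₀ x + δ x y + δ v₀ y))
      where
      eq : ∀ a b b′ d e → a - b + e - d * (b′ - b) ≡ a - d * b′ + (e - (b - d * b))
      eq = solve-∀
      φ-fixes : ∀ {z} → v₀ ≢ z → φ z ≡ z
      φ-fixes {z} v₀≢z with v₀ ≟ z
      ... | yes p = contradiction p v₀≢z
      ... | no _  = refl
      φ-v₀ : φ v₀ ≡ u₀
      φ-v₀ with v₀ ≟ v₀
      ... | yes _ = refl
      ... | no v₀≢v₀ = contradiction refl v₀≢v₀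
      gain : distinct v₀ x y * cost ρ′ v₀ x y ≤ cost ρ u₀ x y
      gain with distinctness v₀ x y
      ... | equal₁₂ p rewrite distinct₁₂ v₀ x y p = cost-nonneg ρ u₀ x y
      ... | equal₂₃ p rewrite distinct₂₃ v₀ x y p = cost-nonneg ρ u₀ x y
      ... | equal₁₃ p rewrite distinct₁₃ v₀ x y p = cost-nonneg ρ u₀ x y
      ... | all-distinct p q r rewrite distinct-≢ p q r | φ-v₀ | φ-fixes p | φ-fixes r = ≤-reflexive (*-identityˡ _)

    -- Optimality makes the change of the objective nonnegative. The term 3n pays for pairs `x`, `y`
    -- that coincide with each other or with `v₀`.
    clone-bound : vertexTotal ρ v₀ ≤ vertexTotal ρ u₀ + + 3 * + n
    clone-bound = ≤-by (vertexTotal ρ u₀ - vertexTotal ρ v₀ + (+ n + + n + + n) - sum² (change v₀) + sum² (change v₀))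
        (+-nonneg (Δ (≤-trans (sum²-mono change-upper) (≤-reflexive sum-upper))) 0≤change)
        (eq (vertexTotal ρ u₀) (vertexTotal ρ v₀) (+ n) (sum² (change v₀)))
      where
      eq : ∀ a b n c → a + + 3 * n - b ≡ a - b + (n + n + n) - c + c
      eq = solve-∀
      0≤change : 0ℤ ≤ sum² (change v₀)
      0≤change = *-cancelˡ-≤-pos 0ℤ (sum² (change v₀)) (+ 3) (subst (0ℤ ≤_)
        (trans (sym (sum³-sub (λ u v w → distinct u v w * cost ρ′ u v w) (λ u v w → distinct u v w * cost ρ u v w)))
          (trans (sum³-cong (λ u v w → distrib (distinct u v w) (cost ρ′ u v w) (cost ρ u v w))) sum-change))
        (Δ {distinctTotal ρ} {distinctTotal ρ′} (optimal ρ′ anti′)))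
        where
        distrib : ∀ d a b → d * a - d * b ≡ d * (a - b)
        distrib = solve-∀
      sum-upper : sum² (λ x y → cost ρ u₀ x y - cost ρ v₀ x y + (δ v₀ x + δ x y + δ v₀ y)) ≡
        vertexTotal ρ u₀ - vertexTotal ρ v₀ + (+ n + + n + + n)
      sum-upper = trans (sum²-+ (λ x y → cost ρ u₀ x y - cost ρ v₀ x y) (λ x y → δ v₀ x + δ x y + δ v₀ y))
        (cong₂ _+_ (trans (sum-cong-≗ (λ x → sum-sub (cost ρ u₀ x) (cost ρ v₀ x))) (sum-sub (λ x → sum (cost ρ u₀ x)) (λ x → sum (cost ρ v₀ x))))
          (trans (sum²-+ (λ x y → δ v₀ x + δ x y) (λ _ y → δ v₀ y)) (cong₂ _+_
            (trans (sum²-+ (λ x _ → δ v₀ x) δ) (cong₂ _+_ (trans (sum²-ignore₂ (δ v₀)) ones) (sum²-δ n)))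
            (trans (sum²-ignore₁ (δ v₀)) ones))))
        where
        ones : + n * sum (δ v₀) ≡ + n
        ones = trans (cong (+ n *_) (sum-δ-1 v₀)) (*-identityʳ (+ n))

open Symmetrization

-- How a single vertex is joined to the parts.

module Attachments where

  open import Data.Integer hiding (suc; _≟_; _/_; _%_)
  open import Data.Integer.Properties hiding (_≟_)

  vertexTotal-average : ∀ {n} {ρ : Fin n → Fin n → Fin 3} → Antisymmetric ρ → Optimal ρ →
    ∀ v → + n * vertexTotal ρ v ≤ total ρ + + 3 * (+ n * + n)
  vertexTotal-average {n} {ρ} anti optimal v = subst₂ _≤_ (sum-const n (vertexTotal ρ v))
    (trans (∑-distrib-+ (vertexTotal ρ) (λ _ → + 3 * + n)) (cong (λ x → total ρ + x) (trans (sum-const n (+ 3 * + n)) (eq (+ n)))))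
    (sum-mono (λ u → Cloning.clone-bound anti optimal v u))
    where
    eq : ∀ N → N * (+ 3 * N) ≡ + 3 * (N * N)
    eq = solve-∀

  size : (Fin n → Fin 3) → Fin 3 → ℤ
  size p i = sum λ v → δ i (p v)

  same : Fin 3 → Fin 3 → Fin 3 → ℤ
  same i j k = δ 0F i * (δ 0F j * δ 0F k) + δ 1F i * (δ 1F j * δ 1F k) + δ 2F i * (δ 2F j * δ 2F k)

  abstract
    same-cost : ∀ a b c i j k → same i j k ≤ tripleCost a b c + (wrong a i j + wrong b j k + wrong c i k)
    same-cost = from-yes (all? λ a → all? λ b → all? λ c → all? λ i → all? λ j → all? λ k →
      same i j k ≤? tripleCost a b c + (wrong a i j + wrong b j k + wrong c i k))

    one-part : ∀ (i : Fin 3) → δ 0F i + δ 1F i + δ 2F i ≡ 1ℤ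
    one-part = from-yes (all? λ (i : Fin 3) → δ 0F i + δ 1F i + δ 2F i ℤ.≟ 1ℤ)

  size-nonneg : ∀ (p : Fin n → Fin 3) i → 0ℤ ≤ size p i
  size-nonneg p i = sum-nonneg (λ v → δ-nonneg i (p v))

  sum-size : ∀ {n} (p : Fin n → Fin 3) → size p 0F + size p 1F + size p 2F ≡ + n
  sum-size {n} p = trans (sym (trans (∑-distrib-+ (λ v → δ 0F (p v) + δ 1F (p v)) (λ v → δ 2F (p v)))
      (cong (λ x → x + size p 2F) (∑-distrib-+ (λ v → δ 0F (p v)) (λ v → δ 1F (p v))))))
    (trans (sum-cong-≗ (λ v → one-part (p v))) (trans (sum-const n 1ℤ) (*-identityʳ (+ n))))

  cube : ℤ → ℤ
  cube a = a * (a * a)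

  sum³-product : ∀ {n} (g : Fin n → ℤ) → sum³ (λ u v w → g u * (g v * g w)) ≡ cube (sum g)
  sum³-product g = trans (sum-cong-≗ (λ u → trans (sum²-*ˡ (g u) (λ v w → g v * g w)) (cong (g u *_) (sum-product g g))))
    (sum-*ʳ (sum g * sum g) g)

  sum³-same : ∀ {n} (p : Fin n → Fin 3) → sum³ (λ u v w → same (p u) (p v) (p w)) ≡ cube (size p 0F) + cube (size p 1F) + cube (size p 2F)
  sum³-same p = trans (sum³-+ (λ u v w → g 0F u v w + g 1F u v w) (g 2F))
    (cong₂ _+_ (trans (sum³-+ (g 0F) (g 1F)) (cong₂ _+_ (sum³-product (λ v → δ 0F (p v))) (sum³-product (λ v → δ 1F (p v)))))
      (sum³-product (λ v → δ 2F (p v))))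
    where
    g : Fin 3 → _ → _ → _ → ℤ
    g i u v w = δ i (p u) * (δ i (p v) * δ i (p w))

  -- Three vertices of one part are independent unless one of their pairs is wrong, and every wrong
  -- pair is met in three positions with n completions each.
  cubes-bound : ∀ {n} (ρ : Fin n → Fin n → Fin 3) (p : Fin n → Fin 3) →
    cube (size p 0F) + cube (size p 1F) + cube (size p 2F) ≤ total ρ + + 3 * (+ n * wrongs ρ p)
  cubes-bound {n} ρ p = subst₂ _≤_ (sum³-same p)
    (trans (sum³-+ (cost ρ) (λ u v w → h u v + h v w + h u w)) (cong (λ x → total ρ + x) (sum³-pairs h)))
    (sum³-mono (λ u v w → same-cost (ρ u v) (ρ v w) (ρ u w) (p u) (p v) (p w)))
    where
    h : Fin n → Fin n → ℤ
    h u v = wrong (ρ u v) (p u) (p v)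

  argmin : (g : Fin 3 → ℤ) → ∃ λ i → ∀ k → g i ≤ g k
  argmin g with ≤-total (g 0F) (g 1F) | ≤-total (g 0F) (g 2F) | ≤-total (g 1F) (g 2F)
  ... | inj₁ a | inj₁ b | _      = 0F , λ { 0F → ≤-refl ; 1F → a ; 2F → b }
  ... | inj₂ a | _      | inj₁ c = 1F , λ { 0F → a ; 1F → ≤-refl ; 2F → c }
  ... | _      | inj₂ b | inj₂ c = 2F , λ { 0F → b ; 1F → c ; 2F → ≤-refl }
  ... | inj₁ a | inj₂ b | inj₁ c = 0F , λ { 0F → ≤-refl ; 1F → a ; 2F → ≤-trans a c }
  ... | inj₂ a | inj₁ b | inj₂ c = 1F , λ { 0F → a ; 1F → ≤-refl ; 2F → ≤-trans a b }

  -- The pairs ((a , i) , (b , j)) for which two vertices in parts i and j, seen as a and b from a third one, cost 1.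
  costly : List ((Fin 3 × Fin 3) × (Fin 3 × Fin 3))
  costly = ((0F , 0F) , (0F , 0F)) ∷ ((0F , 1F) , (0F , 1F)) ∷ ((0F , 2F) , (0F , 2F))
         ∷ ((1F , 0F) , (1F , 1F)) ∷ ((2F , 0F) , (1F , 1F)) ∷ ((2F , 0F) , (2F , 1F))
         ∷ ((1F , 1F) , (1F , 2F)) ∷ ((2F , 1F) , (1F , 2F)) ∷ ((2F , 1F) , (2F , 2F))
         ∷ ((1F , 2F) , (1F , 0F)) ∷ ((2F , 2F) , (1F , 0F)) ∷ ((2F , 2F) , (2F , 0F))
         ∷ ((1F , 1F) , (1F , 0F)) ∷ ((1F , 1F) , (2F , 0F)) ∷ ((2F , 1F) , (2F , 0F))
         ∷ ((1F , 2F) , (1F , 1F)) ∷ ((1F , 2F) , (2F , 1F)) ∷ ((2F , 2F) , (2F , 1F))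
         ∷ ((1F , 0F) , (1F , 2F)) ∷ ((1F , 0F) , (2F , 2F)) ∷ ((2F , 0F) , (2F , 2F))
         ∷ []

  bilinear : {A B : Set} → List (A × A) → (A → B → ℤ) → B → B → ℤ
  bilinear []             g x y = 0ℤ
  bilinear ((a , b) ∷ ts) g x y = g a x * g b y + bilinear ts g x y

  products : {A : Set} → List (A × A) → (A → ℤ) → ℤ
  products []             k = 0ℤ
  products ((a , b) ∷ ts) k = k a * k b + products ts k

  sum²-bilinear : ∀ {n} {A : Set} (ts : List (A × A)) (g : A → Fin n → ℤ) →
    sum² (bilinear ts g) ≡ products ts (λ a → sum (g a))
  sum²-bilinear {n} [] g = trans (sum-cong-≗ {n} (λ _ → sum-0 n)) (sum-0 n)
  sum²-bilinear ((a , b) ∷ ts) g = trans (sum²-+ (λ x y → g a x * g b y) (bilinear ts g))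
    (cong₂ _+_ (sum-product (g a) (g b)) (sum²-bilinear ts g))

  class : Fin 3 × Fin 3 → Fin 3 × Fin 3 → ℤ
  class (r , k) (a , i) = δ r a * δ k i

  abstract
    -- Separates the two vertices seen from the third one, so that the double sum becomes a
    -- quadratic polynomial in nine class sizes.
    pattern-cost : ∀ a i b j → tripleCost a (j ⊝ i) b ≡ bilinear costly class (a , i) (b , j)
    pattern-cost = from-yes (all? λ a → all? λ i → all? λ b → all? λ j →
      tripleCost a (j ⊝ i) b ℤ.≟ bilinear costly class (a , i) (b , j))

    pattern-lower : ∀ a r b i j → tripleCost a (j ⊝ i) b ≤ tripleCost a r b + wrong r i j
    pattern-lower = from-yes (all? λ a → all? λ r → all? λ b → all? λ i → all? λ j →
      tripleCost a (j ⊝ i) b ≤? tripleCost a r b + wrong r i j)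

    class-sum : ∀ a (k i : Fin 3) → δ k i ≡ class (0F , k) (a , i) + (class (1F , k) (a , i) + class (2F , k) (a , i))
    class-sum = from-yes (all? λ a → all? λ k → all? λ i →
      δ k i ℤ.≟ class (0F , k) (a , i) + (class (1F , k) (a , i) + class (2F , k) (a , i)))

    wrong-classes : ∀ a i → wrong a 0F i ≡ class (1F , 0F) (a , i) + class (2F , 0F) (a , i)
      + (class (0F , 1F) (a , i) + class (2F , 1F) (a , i)) + (class (0F , 2F) (a , i) + class (1F , 2F) (a , i))
    wrong-classes = from-yes (all? λ a → all? λ i → wrong a 0F i ℤ.≟ class (1F , 0F) (a , i) + class (2F , 0F) (a , i)
      + (class (0F , 1F) (a , i) + class (2F , 1F) (a , i)) + (class (0F , 2F) (a , i) + class (1F , 2F) (a , i)))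

    class-shift : ∀ r k a i s → class (r , k) (a , i ⊝ s) ≡ class (r , k ⊝ flip s) (a , i)
    class-shift = from-yes (all? λ r → all? λ k → all? λ a → all? λ i → all? λ s →
      class (r , k) (a , i ⊝ s) ℤ.≟ class (r , k ⊝ flip s) (a , i))

    wrong-shift : ∀ r i j s → wrong r (i ⊝ s) (j ⊝ s) ≡ wrong r i j
    wrong-shift = from-yes (all? λ r → all? λ i → all? λ j → all? λ s →
      wrong r (i ⊝ s) (j ⊝ s) ℤ.≟ wrong r i j)

    wrong-shift₀ : ∀ r i s → wrong r 0F (i ⊝ s) ≡ wrong r s i
    wrong-shift₀ = from-yes (all? λ r → all? λ i → all? λ s → wrong r 0F (i ⊝ s) ℤ.≟ wrong r s i)

    class-nonneg : ∀ r k a i → 0ℤ ≤ class (r , k) (a , i)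
    class-nonneg = from-yes (all? λ r → all? λ k → all? λ a → all? λ i → 0ℤ ≤? class (r , k) (a , i))

  module Neighbourhood {n} (ρ : Fin n → Fin n → Fin 3) (v : Fin n) where

    count : (Fin n → Fin 3) → Fin 3 → Fin 3 → ℤ
    count p r k = sum λ w → class (r , k) (ρ v w , p w)

    degreeTo : (Fin n → Fin 3) → Fin 3 → ℤ
    degreeTo p k = count p 1F k + count p 2F k

    wrongNeighbours : (Fin n → Fin 3) → Fin 3 → ℤ
    wrongNeighbours p i = sum λ w → wrong (ρ v w) i (p w)

    module _ (p : Fin n → Fin 3) where

      open Attachment (+ n) (count p 0F 0F) (count p 1F 0F) (count p 2F 0F)
        (count p 0F 1F) (count p 1F 1F) (count p 2F 1F) (count p 0F 2F) (count p 1F 2F) (count p 2F 2F) public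

      size≡ : ∀ k → size p k ≡ count p 0F k + (count p 1F k + count p 2F k)
      size≡ k = trans (sum-cong-≗ (λ w → class-sum (ρ v w) k (p w)))
        (trans (∑-distrib-+ (λ w → class (0F , k) (ρ v w , p w)) (λ w → class (1F , k) (ρ v w , p w) + class (2F , k) (ρ v w , p w)))
          (cong (λ x → count p 0F k + x) (∑-distrib-+ (λ w → class (1F , k) (ρ v w , p w)) (λ w → class (2F , k) (ρ v w , p w)))))

      -- The polynomial treats the other pairs as if they followed the blow-up; each pair that does
      -- not is charged at most 1.
      vertexCost≤ : vertexCost ≤ vertexTotal ρ v + wrongs ρ p
      vertexCost≤ = subst₂ _≤_ lhs (sum²-+ (cost ρ v) (λ x y → wrong (ρ x y) (p x) (p y)))
        (sum²-mono (λ x y → pattern-lower (ρ v x) (ρ x y) (ρ v y) (p x) (p y)))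
        where
        lhs : sum² (λ x y → tripleCost (ρ v x) (p y ⊝ p x) (ρ v y)) ≡ vertexCost
        lhs = trans (sum²-cong (λ x y → trans (pattern-cost (ρ v x) (p x) (ρ v y) (p y)) (pull costly x y)))
          (trans (sum²-bilinear costly (λ c w → class c (ρ v w , p w)))
            (identity (count p 0F 0F) (count p 1F 0F) (count p 2F 0F)
              (count p 0F 1F) (count p 1F 1F) (count p 2F 1F) (count p 0F 2F) (count p 1F 2F) (count p 2F 2F)))
          where
          pull : ∀ ts x y → bilinear ts class (ρ v x , p x) (ρ v y , p y) ≡ bilinear ts (λ c w → class c (ρ v w , p w)) x y
          pull [] x y = refl
          pull ((a , b) ∷ ts) x y = cong (λ t → class a (ρ v x , p x) * class b (ρ v y , p y) + t) (pull ts x y)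
          identity : ∀ z₀ x₀ y₀ z₁ x₁ y₁ z₂ x₂ y₂ →
            z₀ * z₀ + (z₁ * z₁ + (z₂ * z₂ + (x₀ * x₁ + (y₀ * x₁ + (y₀ * y₁ + (x₁ * x₂ + (y₁ * x₂ + (y₁ * y₂ + (x₂ * x₀ + (y₂ * x₀ + (y₂ * y₀
            + (x₁ * x₀ + (x₁ * y₀ + (y₁ * y₀ + (x₂ * x₁ + (x₂ * y₁ + (y₂ * y₁ + (x₀ * x₂ + (x₀ * y₂ + (y₀ * y₂ + 0ℤ)))))))))))))))))))) ≡
            z₀ * z₀ + z₁ * z₁ + z₂ * z₂
             + + 2 * ((x₀ + y₀) * (x₁ + y₁) - x₀ * y₁ + ((x₁ + y₁) * (x₂ + y₂) - x₁ * y₂) + ((x₂ + y₂) * (x₀ + y₀) - x₂ * y₀))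
          identity = solve-∀

      wrongNeighbours₀ : wrongNeighbours p 0F ≡
        count p 1F 0F + count p 2F 0F + (count p 0F 1F + count p 2F 1F) + (count p 0F 2F + count p 1F 2F)
      wrongNeighbours₀ = trans (sum-cong-≗ (λ w → wrong-classes (ρ v w) (p w)))
        (trans (∑-distrib-+ (λ w → c 1F 0F w + c 2F 0F w + (c 0F 1F w + c 2F 1F w)) (λ w → c 0F 2F w + c 1F 2F w))
          (cong₂ _+_ (trans (∑-distrib-+ (λ w → c 1F 0F w + c 2F 0F w) (λ w → c 0F 1F w + c 2F 1F w))
            (cong₂ _+_ (∑-distrib-+ (c 1F 0F) (c 2F 0F)) (∑-distrib-+ (c 0F 1F) (c 2F 1F)))) (∑-distrib-+ (c 0F 2F) (c 1F 2F))))
        where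
        c : Fin 3 → Fin 3 → Fin n → ℤ
        c r k w = class (r , k) (ρ v w , p w)

      count-nonneg : ∀ r k → 0ℤ ≤ count p r k
      count-nonneg r k = sum-nonneg (λ w → class-nonneg r k (ρ v w) (p w))

    module _ (L M m : ℤ) (0<N : 0ℤ < + n) (0<L : 0ℤ < L) (0≤m : 0ℤ ≤ m) (0<M : 0ℤ < M)
      (162M : + 162 * M ≤ L) (108M : + 108 * M ≤ + n) (M≡ : M ≡ + 7 + + 3 * (m * m)) (m≡20 : m ≡ + 20)
      (L≡ : L ≡ + 366 * (M * M)) (27L : L * + 27 ≤ + n)
      (small : + 9 * total ρ ≤ + n * (+ n * + n) + + 27 * (+ n * + n))
      (cheap : + n * vertexTotal ρ v ≤ total ρ + + 3 * (+ n * + n)) where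

      private
        N = + n
        0≤L = <⇒≤ 0<L

        vertexTotal≤ : + 9 * vertexTotal ρ v ≤ N * N + + 54 * N
        vertexTotal≤ = cancel-≤ N 0<N (≤-by (+ 9 * (total ρ + + 3 * (N * N) - N * vertexTotal ρ v) + (N * (N * N) + + 27 * (N * N) - + 9 * total ρ))
          (+-nonneg (*-nonneg (0≤pos 9) (Δ cheap)) (Δ small)) (identity N (vertexTotal ρ v) (total ρ)))
          where
          identity : ∀ N v t → N * (N * N + + 54 * N) - N * (+ 9 * v) ≡
            + 9 * (t + + 3 * (N * N) - N * v) + (N * (N * N) + + 27 * (N * N) - + 9 * t)
          identity = solve-∀

      balanced : ∀ p → L * wrongs ρ p ≤ + 9 * (N * N) → ∀ k → M * (+ 3 * size p k - N) ≤ N × - N ≤ M * (+ 3 * size p k - N)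
      balanced p few k = go k
        where
        b = size-nonneg p
        bound = cubes-bound ρ p
        a₀ = size p 0F
        a₁ = size p 1F
        a₂ = size p 2F
        rotate : ∀ x y z → x + y + z ≡ y + z + x
        rotate = solve-∀
        go : ∀ k → M * (+ 3 * size p k - N) ≤ N × - N ≤ M * (+ 3 * size p k - N)
        go 0F = balanced-sizes N L M (total ρ) (wrongs ρ p) a₀ a₁ a₂ 0<N 0≤L 27L L≡ (b 0F) (b 1F) (b 2F) (sum-size p) small few bound
        go 1F = balanced-sizes N L M (total ρ) (wrongs ρ p) a₁ a₂ a₀ 0<N 0≤L 27L L≡ (b 1F) (b 2F) (b 0F)
          (trans (sym (rotate a₀ a₁ a₂)) (sum-size p)) small few
          (≤-trans (≤-reflexive (sym (rotate (cube a₀) (cube a₁) (cube a₂)))) bound)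
        go 2F = balanced-sizes N L M (total ρ) (wrongs ρ p) a₂ a₀ a₁ 0<N 0≤L 27L L≡ (b 2F) (b 0F) (b 1F)
          (trans (rotate a₂ a₀ a₁) (sum-size p)) small few
          (≤-trans (≤-reflexive (rotate (cube a₂) (cube a₀) (cube a₁))) bound)

      first-part : ∀ p → L * wrongs ρ p ≤ + 9 * (N * N) → (∀ k → degreeTo p 0F ≤ degreeTo p k) → + 25 * wrongNeighbours p 0F ≤ N
      first-part p few least = subst (λ x → + 25 * x ≤ N) (sym (wrongNeighbours₀ p))
        (few-wrong-neighbours p L M m 0<N 0<L 0≤m 0<M 162M 108M M≡ m≡20
          (c 0F 0F) (c 1F 0F) (c 2F 0F) (c 0F 1F) (c 1F 1F) (c 2F 1F) (c 0F 2F) (c 1F 2F) (c 2F 2F)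
          (subst (λ s → M * (+ 3 * s - N) ≤ N) (size≡ p 0F) (proj₁ (balanced p few 0F)))
          (subst (λ s → - N ≤ M * (+ 3 * s - N)) (size≡ p 0F) (proj₂ (balanced p few 0F)))
          (subst (λ s → - N ≤ M * (+ 3 * s - N)) (size≡ p 1F) (proj₂ (balanced p few 1F)))
          (subst (λ s → - N ≤ M * (+ 3 * s - N)) (size≡ p 2F) (proj₂ (balanced p few 2F)))
          (least 1F) (least 2F)
          (≤-by (+ 9 * L * (vertexTotal ρ v + wrongs ρ p - vertexCost p) + L * (N * N + + 54 * N - + 9 * vertexTotal ρ v) + + 9 * (+ 9 * (N * N) - L * wrongs ρ p))
            (+-nonneg (+-nonneg (*-nonneg (*-nonneg (0≤pos 9) 0≤L) (Δ (vertexCost≤ p))) (*-nonneg 0≤L (Δ vertexTotal≤))) (*-nonneg (0≤pos 9) (Δ few)))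
            (identity N L (vertexCost p) (vertexTotal ρ v) (wrongs ρ p))))
        where
        c = count-nonneg p
        identity : ∀ N L c v w → L * (N * N) + + 54 * (L * N) + + 81 * (N * N) - + 9 * (L * c) ≡
          + 9 * L * (v + w - c) + L * (N * N + + 54 * N - + 9 * v) + + 9 * (+ 9 * (N * N) - L * w)
        identity = solve-∀

      -- The vertex belongs to the part where it has fewest neighbours. The cyclic symmetry of the
      -- pattern rotates that part to `0F`, the case treated by the polynomial.
      some-part : ∀ p → L * wrongs ρ p ≤ + 9 * (N * N) → ∃ λ i → + 25 * wrongNeighbours p i ≤ N
      some-part p few with argmin (degreeTo p)
      ... | i , least = i , subst (λ x → + 25 * x ≤ N) (sum-cong-≗ (λ w → wrong-shift₀ (ρ v w) (p w) i))
        (first-part q (subst (λ x → L * x ≤ + 9 * (N * N)) (sym (sum²-cong (λ x y → wrong-shift (ρ x y) (p x) (p y) i))) few)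
          (λ k → subst₂ _≤_ (sym (degree-shift 0F i refl′)) (sym (degree-shift k (k ⊝ flip i) refl)) (least (k ⊝ flip i))))
        where
        q : Fin n → Fin 3
        q w = p w ⊝ i
        zero-shift : ∀ i → 0F ⊝ flip i ≡ i
        zero-shift 0F = refl
        zero-shift 1F = refl
        zero-shift 2F = refl
        refl′ : 0F ⊝ flip i ≡ i
        refl′ = zero-shift i
        degree-shift : ∀ k l → k ⊝ flip i ≡ l → degreeTo q k ≡ degreeTo p l
        degree-shift k l refl = cong₂ _+_ (sum-cong-≗ (λ w → class-shift 1F k (ρ v w) (p w) i)) (sum-cong-≗ (λ w → class-shift 2F k (ρ v w) (p w) i))

open Attachments

-- Comparing a graph with the blow-up on a nearly correct partition.

module PatternExcess where

  open import Data.Integer hiding (suc; _≟_; _/_; _%_)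
  open import Data.Integer.Properties hiding (_≟_)

  patternOf : (Fin n → Fin 3) → Fin n → Fin n → Fin 3
  patternOf p u v = p v ⊝ p u

  falling₃ : ℤ → ℤ
  falling₃ a = a * (a - 1ℤ) * (a - + 2)

  abstract
    ⊝-flip : ∀ i j → i ⊝ j ≡ flip (j ⊝ i)
    ⊝-flip = from-yes (all? λ i → all? λ j → i ⊝ j ≟ flip (j ⊝ i))

    pattern-same : ∀ i j k → tripleCost (j ⊝ i) (k ⊝ j) (k ⊝ i) ≡ same i j k
    pattern-same = from-yes (all? λ i → all? λ j → all? λ k → tripleCost (j ⊝ i) (k ⊝ j) (k ⊝ i) ℤ.≟ same i j k)

  patternOf-anti : (p : Fin n → Fin 3) → Antisymmetric (patternOf p)
  patternOf-anti p u v = ⊝-flip (p u) (p v)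

  distinct-expand : ∀ (u v w : Fin n) → distinct u v w ≡ 1ℤ - (δ u v + δ v w + δ u w) + + 2 * (δ u v * δ v w)
  distinct-expand u v w with distinctness u v w
  ... | equal₁₂ refl = trans (distinct₁₂ u u w refl) (trans (eq (δ u w)) (cong (λ d → 1ℤ - (d + δ u w + δ u w) + + 2 * (d * δ u w)) (sym (δ-refl u))))
    where
    eq : ∀ d → 0ℤ ≡ 1ℤ - (1ℤ + d + d) + + 2 * (1ℤ * d)
    eq = solve-∀
  ... | equal₂₃ refl = trans (distinct₂₃ u v v refl) (trans (eq (δ u v)) (cong (λ d → 1ℤ - (δ u v + d + δ u v) + + 2 * (δ u v * d)) (sym (δ-refl v))))
    where
    eq : ∀ d → 0ℤ ≡ 1ℤ - (d + 1ℤ + d) + + 2 * (d * 1ℤ)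
    eq = solve-∀
  ... | equal₁₃ refl = trans (distinct₁₃ u v u refl) (trans (idem u v)
      (cong₂ (λ d e → 1ℤ - (δ u v + e + d) + + 2 * (δ u v * e)) (sym (δ-refl u)) (δ-sym u v)))
    where
    idem : ∀ (u v : Fin n) → 0ℤ ≡ 1ℤ - (δ u v + δ u v + 1ℤ) + + 2 * (δ u v * δ u v)
    idem u v with u ≟ v
    ... | yes _ = refl
    ... | no _  = refl
  ... | all-distinct p q r rewrite δ-≢ p | δ-≢ q | δ-≢ r = refl

  sum³-distinct-product : ∀ {n} (g : Fin n → ℤ) → (∀ u → g u * g u ≡ g u) →
    sum³ (λ u v w → distinct u v w * (g u * (g v * g w))) ≡ falling₃ (sum g)
  sum³-distinct-product {n} g idem =
    trans (sum³-cong (λ u v w → trans (cong (λ d → d * c u v w) (distinct-expand u v w))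
        (expand (δ u v) (δ v w) (δ u w) (c u v w))))
      (trans (sum³-+ (λ u v w → c u v w - (c₁ u v w + c₂ u v w + c₃ u v w)) (λ u v w → + 2 * c₄ u v w))
        (trans (cong₂ _+_ (trans (sum³-sub c (λ u v w → c₁ u v w + c₂ u v w + c₃ u v w)) (cong₂ _-_ (sum³-product g)
            (trans (sum³-+ (λ u v w → c₁ u v w + c₂ u v w) c₃) (cong₂ _+_ (trans (sum³-+ c₁ c₂) (cong₂ _+_ e₁ e₂)) e₃))))
            (trans (sum³-*ˡ (+ 2) c₄) (cong (λ x → + 2 * x) e₄)))
          (collect (sum g))))
    where
    c c₁ c₂ c₃ c₄ : Fin n → Fin n → Fin n → ℤ
    c u v w = g u * (g v * g w)
    c₁ u v w = δ u v * c u v w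
    c₂ u v w = δ v w * c u v w
    c₃ u v w = δ u w * c u v w
    c₄ u v w = δ u v * (δ v w * c u v w)
    expand : ∀ a b d c → (1ℤ - (a + b + d) + + 2 * (a * b)) * c ≡ c - (a * c + b * c + d * c) + + 2 * (a * (b * c))
    expand = solve-∀
    collect : ∀ A → A * (A * A) - (A * A + A * A + A * A) + + 2 * A ≡ A * (A - 1ℤ) * (A - + 2)
    collect = solve-∀
    A² = sum g * sum g
    merge : ∀ a b → a * (a * b) ≡ a * a * b
    merge a b = sym (*-assoc a a b)
    two : ∀ u w → g u * (g u * g w) ≡ g u * g w
    two u w = trans (merge (g u) (g w)) (cong (λ x → x * g w) (idem u))
    e₂ : sum³ c₂ ≡ A²
    e₂ = trans (sum²-cong (λ u v → sum-δ v (c u v))) (trans (sum²-cong (λ u v → cong (λ x → g u * x) (idem v))) (sum-product g g))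
    e₃ : sum³ c₃ ≡ A²
    e₃ = trans (sum²-cong (λ u v → sum-δ u (c u v)))
      (trans (sum²-cong (λ u v → trans (swap (g u) (g v)) (cong (λ x → x * g v) (idem u)))) (sum-product g g))
      where
      swap : ∀ a b → a * (b * a) ≡ a * a * b
      swap = solve-∀
    e₁ : sum³ c₁ ≡ A²
    e₁ = trans (sum-cong-≗ (λ u → trans (sum-cong-≗ (λ v → sum-*ˡ (δ u v) (c u v))) (sum-δ u (λ v → sum (c u v)))))
      (trans (sum²-cong two) (sum-product g g))
    e₄ : sum³ c₄ ≡ sum g
    e₄ = trans (sum-cong-≗ (λ u → trans (sum-cong-≗ (λ v → sum-*ˡ (δ u v) (λ w → δ v w * c u v w))) (sum-δ u (λ v → sum (λ w → δ v w * c u v w)))))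
      (sum-cong-≗ (λ u → trans (sum-δ u (c u u)) (trans (two u u) (idem u))))

  δ-idem : ∀ (i j : Fin n) → δ i j * δ i j ≡ δ i j
  δ-idem i j with i ≟ j
  ... | yes _ = refl
  ... | no _  = refl

  fallingSizes : (Fin n → Fin 3) → ℤ
  fallingSizes p = falling₃ (size p 0F) + falling₃ (size p 1F) + falling₃ (size p 2F)

  distinctTotal-pattern : (p : Fin n → Fin 3) → distinctTotal (patternOf p) ≡ fallingSizes p
  distinctTotal-pattern {n} p = trans (sum³-cong (λ u v w → trans (cong (distinct u v w *_) (pattern-same (p u) (p v) (p w)))
      (distrib (distinct u v w) (g 0F u v w) (g 1F u v w) (g 2F u v w))))
    (trans (sum³-+ (λ u v w → distinct u v w * g 0F u v w + distinct u v w * g 1F u v w) (λ u v w → distinct u v w * g 2F u v w))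
      (cong₂ _+_ (trans (sum³-+ (λ u v w → distinct u v w * g 0F u v w) (λ u v w → distinct u v w * g 1F u v w))
        (cong₂ _+_ (each 0F) (each 1F))) (each 2F)))
    where
    g : Fin 3 → Fin n → Fin n → Fin n → ℤ
    g i u v w = δ i (p u) * (δ i (p v) * δ i (p w))
    distrib : ∀ d a b c → d * (a + b + c) ≡ d * a + d * b + d * c
    distrib = solve-∀
    each : ∀ i → sum³ (λ u v w → distinct u v w * g i u v w) ≡ falling₃ (size p i)
    each i = sum³-distinct-product (λ u → δ i (p u)) (λ u → δ-idem i (p u))

  -- Edges inside a part and reversed arcs. A missing arc is wrong but not active, since it costs
  -- nothing by itself.
  active : Fin 3 → Fin 3 → Fin 3 → ℤ
  active r i j = (1ℤ - δ 0F r) * wrong r i j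

  -- The effect on the triple uvw of the active pair uv, with r = ρ u v, s = ρ u w, t = ρ v w: the pair creates a
  -- transitive triangle if w is in another part and correctly joined, and destroys an independent set inside a part.
  effect : (r s t i j k : Fin 3) → ℤ
  effect r s t i j k = active r i j * ((1ℤ - wrong s i k) * (1ℤ - wrong t j k) * ((1ℤ - δ i k) * (1ℤ - δ j k)) - δ i j * δ j k)

  -- Independent triples that missing arcs create across the parts; those inside one part are
  -- already counted by `same`.
  mixed : (a b c i j k : Fin 3) → ℤ
  mixed a b c i j k = δ 0F a * (δ 0F b * δ 0F c) * (1ℤ - same i j k)

  abstract
    -- A triangle is credited to an active pair only if its other two pairs are correct, so it is
    -- credited at most once. A triple inside one part may lose 1 for each of its edges, which only
    -- weakens the lower bound.
    cost-effect : ∀ a b c i j k →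
      same i j k + (effect a c b i j k + effect b (flip a) (flip c) j k i + effect c a (flip b) i k j) + mixed a b c i j k ≤ tripleCost a b c
    cost-effect = from-yes (all? λ a → all? λ b → all? λ c → all? λ i → all? λ j → all? λ k →
      same i j k + (effect a c b i j k + effect b (flip a) (flip c) j k i + effect c a (flip b) i k j) + mixed a b c i j k ≤? tripleCost a b c)

    active-nonneg : ∀ r i j → 0ℤ ≤ active r i j
    active-nonneg = from-yes (all? λ r → all? λ i → all? λ j → 0ℤ ≤? active r i j)

    mixed-nonneg : ∀ a b c i j k → 0ℤ ≤ mixed a b c i j k
    mixed-nonneg = from-yes (all? λ a → all? λ b → all? λ c → all? λ i → all? λ j → all? λ k → 0ℤ ≤? mixed a b c i j k)

    effect-lower : ∀ s t (i j k : Fin 3) → 1ℤ - (δ i k + δ j k) - (wrong s i k + wrong t j k) ≤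
      (1ℤ - wrong s i k) * (1ℤ - wrong t j k) * ((1ℤ - δ i k) * (1ℤ - δ j k)) - δ i j * δ j k
    effect-lower = from-yes (all? λ s → all? λ t → all? λ (i : Fin 3) → all? λ (j : Fin 3) → all? λ (k : Fin 3) →
      1ℤ - (δ i k + δ j k) - (wrong s i k + wrong t j k) ≤?
      (1ℤ - wrong s i k) * (1ℤ - wrong t j k) * ((1ℤ - δ i k) * (1ℤ - δ j k)) - δ i j * δ j k)

    -- Effects are summed over every third vertex, also one equal to an end of the pair. On such
    -- degenerate triples they must not be positive, because the true objective omits them.
    effect-13 : ∀ r s t i j → effect r s t i j i ≤ 0ℤ
    effect-13 = from-yes (all? λ r → all? λ s → all? λ t → all? λ i → all? λ j → effect r s t i j i ≤? 0ℤ)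

    effect-23 : ∀ r s t i j → effect r s t i j j ≤ 0ℤ
    effect-23 = from-yes (all? λ r → all? λ s → all? λ t → all? λ i → all? λ j → effect r s t i j j ≤? 0ℤ)

    effect-12 : ∀ s t i k → effect 0F s t i i k ≤ 0ℤ
    effect-12 = from-yes (all? λ s → all? λ t → all? λ i → all? λ k → effect 0F s t i i k ≤? 0ℤ)

    changed-wrong : ∀ r (i j k : Fin 3) → 1ℤ - δ i j ≤ wrong r i k + wrong r j k
    changed-wrong = from-yes (all? λ r → all? λ (i : Fin 3) → all? λ (j : Fin 3) → all? λ k → 1ℤ - δ i j ≤? wrong r i k + wrong r j k)

    wrong-changed : ∀ r i (j k : Fin 3) → wrong r i k ≤ wrong r i j + (1ℤ - δ j k)
    wrong-changed = from-yes (all? λ r → all? λ i → all? λ (j : Fin 3) → all? λ k → wrong r i k ≤? wrong r i j + (1ℤ - δ j k))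

    δ-changed : ∀ (i j k : Fin 3) → δ i k ≤ δ i j + (1ℤ - δ j k)
    δ-changed = from-yes (all? λ (i : Fin 3) → all? λ (j : Fin 3) → all? λ k → δ i k ≤? δ i j + (1ℤ - δ j k))

  module Excess {n} {ρ : Fin n → Fin n → Fin 3} (anti : Antisymmetric ρ) (p : Fin n → Fin 3) where

    effectAt : Fin n → Fin n → Fin n → ℤ
    effectAt u v w = effect (ρ u v) (ρ u w) (ρ v w) (p u) (p v) (p w)

    mixedAt : Fin n → Fin n → Fin n → ℤ
    mixedAt u v w = mixed (ρ u v) (ρ v w) (ρ u w) (p u) (p v) (p w)

    activeAt : Fin n → Fin n → ℤ
    activeAt u v = active (ρ u v) (p u) (p v)

    wrongDegree : Fin n → ℤ
    wrongDegree v = sum λ w → wrong (ρ v w) (p v) (p w)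

    gainAt : Fin n → Fin n → Fin n → ℤ
    gainAt u v w = (1ℤ - wrong (ρ u w) (p u) (p w)) * (1ℤ - wrong (ρ v w) (p v) (p w))
      * ((1ℤ - δ (p u) (p w)) * (1ℤ - δ (p v) (p w))) - δ (p u) (p v) * δ (p v) (p w)

    gain : Fin n → Fin n → ℤ
    gain u v = sum (gainAt u v)

    effectAt-distinct : ∀ u v w → effectAt u v w ≤ distinct u v w * effectAt u v w
    effectAt-distinct u v w with distinctness u v w
    ... | equal₁₂ refl rewrite distinct₁₂ u u w refl | diagonal anti u = effect-12 (ρ u w) (ρ u w) (p u) (p w)
    ... | equal₂₃ refl rewrite distinct₂₃ u v v refl = effect-23 (ρ u v) (ρ u v) (ρ v v) (p u) (p v)
    ... | equal₁₃ refl rewrite distinct₁₃ u v u refl = effect-13 (ρ u v) (ρ u u) (ρ v u) (p u) (p v)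
    ... | all-distinct a b c rewrite distinct-≢ a b c = ≤-reflexive (sym (*-identityˡ (effectAt u v w)))

    distinct-cost : ∀ u v w →
      distinct u v w * same (p u) (p v) (p w) + (effectAt u v w + effectAt v w u + effectAt u w v) + distinct u v w * mixedAt u v w
        ≤ distinct u v w * cost ρ u v w
    distinct-cost u v w = ≤-by
      (distinct u v w * (cost ρ u v w - (same (p u) (p v) (p w) + (effectAt u v w + effectAt v w u + effectAt u w v) + mixedAt u v w))
        + (distinct u v w * effectAt u v w - effectAt u v w)
        + (distinct u v w * effectAt v w u - effectAt v w u)
        + (distinct u v w * effectAt u w v - effectAt u w v))
      (+-nonneg (+-nonneg (+-nonneg (distinct-nonneg u v w (Δ pointwise))
          (Δ (effectAt-distinct u v w)))
          (Δ (subst (λ d → effectAt v w u ≤ d * effectAt v w u) cyclic (effectAt-distinct v w u))))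
          (Δ (subst (λ d → effectAt u w v ≤ d * effectAt u w v) (distinct-swap₂₃ u v w) (effectAt-distinct u w v))))
      (identity (distinct u v w) (cost ρ u v w) (same (p u) (p v) (p w)) (effectAt u v w) (effectAt v w u) (effectAt u w v) (mixedAt u v w))
      where
      identity : ∀ d c s e₁ e₂ e₃ m → d * c - (d * s + (e₁ + e₂ + e₃) + d * m) ≡
        d * (c - (s + (e₁ + e₂ + e₃) + m)) + (d * e₁ - e₁) + (d * e₂ - e₂) + (d * e₃ - e₃)
      identity = solve-∀
      cyclic : distinct v w u ≡ distinct u v w
      cyclic = trans (distinct-swap₂₃ v u w) (distinct-swap₁₂ u v w)
      pointwise : same (p u) (p v) (p w) + (effectAt u v w + effectAt v w u + effectAt u w v) + mixedAt u v w ≤ cost ρ u v w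
      pointwise rewrite anti u v | anti u w | anti v w = cost-effect (ρ u v) (ρ v w) (ρ u w) (p u) (p v) (p w)

    -- Each of the three pairs of a triple can be the active one, and relabelling makes the three
    -- sums equal.
    total-effect : fallingSizes p + + 3 * sum³ effectAt + sum³ (λ u v w → distinct u v w * mixedAt u v w) ≤ distinctTotal ρ
    total-effect = subst (_≤ distinctTotal ρ)
      (trans (sum³-+ (λ u v w → s u v w + e u v w) m) (cong (λ x → x + sum³ m) (trans (sum³-+ s e) (cong₂ _+_ sum-s sum-e))))
      (sum³-mono distinct-cost)
      where
      s e m : Fin n → Fin n → Fin n → ℤ
      s u v w = distinct u v w * same (p u) (p v) (p w)
      e u v w = effectAt u v w + effectAt v w u + effectAt u w v
      m u v w = distinct u v w * mixedAt u v w
      sum-s : sum³ s ≡ fallingSizes p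
      sum-s = trans (sum³-cong (λ u v w → cong (distinct u v w *_) (sym (pattern-same (p u) (p v) (p w))))) (distinctTotal-pattern p)
      thrice : ∀ x → x + x + x ≡ + 3 * x
      thrice = solve-∀
      sum-e : sum³ e ≡ + 3 * sum³ effectAt
      sum-e = trans (sum³-+ (λ u v w → effectAt u v w + effectAt v w u) (λ u v w → effectAt u w v))
        (trans (cong₂ _+_ (trans (sum³-+ effectAt (λ u v w → effectAt v w u)) (cong (λ x → sum³ effectAt + x)
            (trans (sum³-swap₁₂ (λ u v w → effectAt u w v)) (sum³-swap₂₃ effectAt))))
          (sum³-swap₂₃ effectAt)) (thrice (sum³ effectAt)))

    effect-sum : ∀ u v → + n - (size p (p u) + size p (p v)) - (wrongDegree u + wrongDegree v) ≤
      gain u v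
    effect-sum u v = subst (_≤ gain u v) lhs (sum-mono (λ w → effect-lower (ρ u w) (ρ v w) (p u) (p v) (p w)))
      where
      lhs : sum (λ w → 1ℤ - (δ (p u) (p w) + δ (p v) (p w)) - (wrong (ρ u w) (p u) (p w) + wrong (ρ v w) (p v) (p w))) ≡
        + n - (size p (p u) + size p (p v)) - (wrongDegree u + wrongDegree v)
      lhs = trans (sum-sub (λ w → 1ℤ - (δ (p u) (p w) + δ (p v) (p w))) (λ w → wrong (ρ u w) (p u) (p w) + wrong (ρ v w) (p v) (p w)))
        (cong₂ _-_ (trans (sum-sub (λ _ → 1ℤ) (λ w → δ (p u) (p w) + δ (p v) (p w)))
            (cong₂ _-_ (trans (sum-const n 1ℤ) (*-identityʳ (+ n))) (∑-distrib-+ (λ w → δ (p u) (p w)) (λ w → δ (p v) (p w)))))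
          (∑-distrib-+ (λ w → wrong (ρ u w) (p u) (p w)) (λ w → wrong (ρ v w) (p v) (p w))))

    module _ (sizes : ∀ i → + 100 * size p i ≤ + 39 * + n) (degrees : ∀ v → + 100 * wrongDegree v ≤ + 9 * + n) (0<n : 0ℤ < + n) where

      -- The margin is 100 - 2 · 39 - 2 · 9 = 4 percent of n: at least the vertices outside both
      -- parts, less the wrong neighbours of either end.
      effect-positive : ∀ u v → + n ≤ + 25 * gain u v
      effect-positive u v = cancel-≤ (+ 4) (0<pos 3) (≤-by
        (+ 100 * (Γ - (N - (a + b) - (c + d))) + (+ 39 * N - + 100 * a) + (+ 39 * N - + 100 * b) + (+ 9 * N - + 100 * c) + (+ 9 * N - + 100 * d))
        (+-nonneg (+-nonneg (+-nonneg (+-nonneg (*-nonneg (0≤pos 100) (Δ (effect-sum u v))) (Δ (sizes (p u)))) (Δ (sizes (p v))))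
          (Δ (degrees u))) (Δ (degrees v)))
        (identity N Γ a b c d))
        where
        N = + n
        a = size p (p u)
        b = size p (p v)
        c = wrongDegree u
        d = wrongDegree v
        Γ = gain u v
        identity : ∀ N Γ a b c d → + 4 * (+ 25 * Γ) - + 4 * N ≡
          + 100 * (Γ - (N - (a + b) - (c + d))) + (+ 39 * N - + 100 * a) + (+ 39 * N - + 100 * b) + (+ 9 * N - + 100 * c) + (+ 9 * N - + 100 * d)
        identity = solve-∀

      active-bound : + n * sum² activeAt ≤ + 25 * sum³ effectAt
      active-bound = subst₂ _≤_ (sum²-*ˡ (+ n) activeAt) (sum²-*ˡ (+ 25) (λ u v → sum (effectAt u v)))
        (sum²-mono (λ u v → subst₂ _≤_ (*-comm (activeAt u v) (+ n)) (rearrange u v)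
          (*-monoˡ-≤-nonNeg (activeAt u v) {{nonNegative (active-nonneg (ρ u v) (p u) (p v))}} (effect-positive u v))))
        where
        rearrange : ∀ u v → activeAt u v * (+ 25 * gain u v) ≡ + 25 * sum (effectAt u v)
        rearrange u v = trans (swap (activeAt u v) (gain u v)) (cong (λ x → + 25 * x) (sym (sum-*ˡ (activeAt u v) (gainAt u v))))
          where
          swap : ∀ a b → a * (+ 25 * b) ≡ + 25 * (a * b)
          swap = solve-∀

      sum-effect-nonneg : 0ℤ ≤ sum³ effectAt
      sum-effect-nonneg = cancel-≤ (+ 25) (0<pos 24) (≤-trans (*-nonneg (<⇒≤ 0<n)
        (sum²-nonneg (λ u v → active-nonneg (ρ u v) (p u) (p v)))) active-bound)

      fallingSizes≤ : fallingSizes p ≤ distinctTotal ρ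
      fallingSizes≤ = ≤-trans (≤-by (+ 3 * sum³ effectAt + sum³ m) (+-nonneg (*-nonneg (0≤pos 3) sum-effect-nonneg)
          (sum-nonneg (λ u → sum²-nonneg (λ v w → distinct-nonneg u v w (mixed-nonneg (ρ u v) (ρ v w) (ρ u w) (p u) (p v) (p w))))))
          (identity (fallingSizes p) (+ 3 * sum³ effectAt) (sum³ m))) total-effect
        where
        m : Fin n → Fin n → Fin n → ℤ
        m u v w = distinct u v w * mixedAt u v w
        identity : ∀ a b c → a + b + c - a ≡ b + c
        identity = solve-∀

      -- The sum of effects dominates a multiple of the number of active pairs, so equality forces
      -- every nonnegative term to vanish separately.
      tight : distinctTotal ρ ≤ fallingSizes p →
        (∀ u v → activeAt u v ≡ 0ℤ) × (∀ u v w → distinct u v w * mixedAt u v w ≡ 0ℤ)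
      tight le = (λ u v → ≤-antisym (≤-trans (term u v) A≤0) (active-nonneg (ρ u v) (p u) (p v)))
               , (λ u v w → ≤-antisym (≤-trans (term₃ u v w) M≤0) (m≥0 u v w))
        where
        m : Fin n → Fin n → Fin n → ℤ
        m u v w = distinct u v w * mixedAt u v w
        m≥0 : ∀ u v w → 0ℤ ≤ m u v w
        m≥0 u v w = distinct-nonneg u v w (mixed-nonneg (ρ u v) (ρ v w) (ρ u w) (p u) (p v) (p w))
        A = sum² activeAt
        Ef = sum³ effectAt
        Mx = sum³ m
        a≥0 : ∀ u v → 0ℤ ≤ activeAt u v
        a≥0 u v = active-nonneg (ρ u v) (p u) (p v)
        Mx≥0 : 0ℤ ≤ Mx
        Mx≥0 = sum-nonneg (λ u → sum²-nonneg (m≥0 u))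
        A≥0 : 0ℤ ≤ A
        A≥0 = sum²-nonneg a≥0
        both : + 3 * Ef + Mx ≤ 0ℤ
        both = ≤-by (fallingSizes p - distinctTotal ρ + (distinctTotal ρ - (fallingSizes p + + 3 * Ef + Mx)))
          (+-nonneg (Δ le) (Δ total-effect)) (identity (fallingSizes p) (distinctTotal ρ) Ef Mx)
          where
          identity : ∀ F T E M → 0ℤ - (+ 3 * E + M) ≡ F - T + (T - (F + + 3 * E + M))
          identity = solve-∀
        A≤0 : A ≤ 0ℤ
        A≤0 = cancel-≤ (+ 3 * + n) (*-pos (0<pos 2) 0<n) (≤-by (+ 25 * (0ℤ - (+ 3 * Ef + Mx)) + + 3 * (+ 25 * Ef - + n * A) + + 25 * Mx)
          (+-nonneg (+-nonneg (*-nonneg (0≤pos 25) (Δ both)) (*-nonneg (0≤pos 3) (Δ active-bound))) (*-nonneg (0≤pos 25) Mx≥0))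
          (identity (+ n) A Ef Mx))
          where
          identity : ∀ N A E M → + 3 * N * 0ℤ - + 3 * N * A ≡ + 25 * (0ℤ - (+ 3 * E + M)) + + 3 * (+ 25 * E - N * A) + + 25 * M
          identity = solve-∀
        M≤0 : Mx ≤ 0ℤ
        M≤0 = cancel-≤ (+ 25) (0<pos 24) (≤-by (+ 25 * (0ℤ - (+ 3 * Ef + Mx)) + + 3 * (+ 25 * Ef - + n * A) + + 3 * (+ n * A))
          (+-nonneg (+-nonneg (*-nonneg (0≤pos 25) (Δ both)) (*-nonneg (0≤pos 3) (Δ active-bound))) (*-nonneg (0≤pos 3) (*-nonneg (<⇒≤ 0<n) A≥0)))
          (identity (+ n) A Ef Mx))
          where
          identity : ∀ N A E M → + 25 * 0ℤ - + 25 * M ≡ + 25 * (0ℤ - (+ 3 * E + M)) + + 3 * (+ 25 * E - N * A) + + 3 * (N * A)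
          identity = solve-∀
        term : ∀ u v → activeAt u v ≤ A
        term u v = ≤-trans (term≤sum (a≥0 u) v) (term≤sum {f = λ u → sum (activeAt u)} (λ u → sum-nonneg (a≥0 u)) u)
        term₃ : ∀ u v w → m u v w ≤ Mx
        term₃ u v w = ≤-trans (term≤sum (m≥0 u v) w) (≤-trans (term≤sum {f = λ v → sum (m u v)} (λ v → sum-nonneg (m≥0 u v)) v) (term≤sum {f = λ u → sum² (m u)} (λ u → sum²-nonneg (m≥0 u)) u))

open PatternExcess

-- Moving vertices, and comparing partitions by their part sizes.

module BalancedPartitions where

  open import Data.Integer hiding (suc; _≟_; _/_; _%_)
  open import Data.Integer.Properties hiding (_≟_)

  module Repartition {n} {ρ : Fin n → Fin n → Fin 3} (p p′ : Fin n → Fin 3)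
    (L M : ℤ) (0<n : 0ℤ < + n) (0<L : 0ℤ < L) (900≤L : + 900 ≤ L) (0<M : 0ℤ < M) (100≤M : + 100 ≤ M)
    (few : L * wrongs ρ p ≤ + 9 * (+ n * + n))
    (close : ∀ v → + 25 * Neighbourhood.wrongNeighbours ρ v p (p′ v) ≤ + n)
    (balanced : ∀ i → M * (+ 3 * size p i - + n) ≤ + n) where

    private
      N = + n
      wn : Fin n → Fin 3 → ℤ
      wn v i = Neighbourhood.wrongNeighbours ρ v p i

    changed : Fin n → ℤ
    changed v = 1ℤ - δ (p v) (p′ v)

    changes : ℤ
    changes = sum changed

    -- A moved vertex is in a wrong pair with every other vertex under its old part or under its new
    -- one. This gives the fraction 9/900 + 1/25 = 1/20.
    few-changes : + 20 * changes ≤ N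
    few-changes = cancel-≤ (+ 5 * L * N) (*-pos (*-pos (0<pos 4) 0<L) 0<n)
      (≤-by (+ 100 * L * (wrongs ρ p + S - N * changes) + + 100 * (+ 9 * (N * N) - L * wrongs ρ p) + + 4 * L * (N * N - + 25 * S) + N * N * (L - + 900))
        (+-nonneg (+-nonneg (+-nonneg (*-nonneg (*-nonneg (0≤pos 100) 0≤L) (Δ per-vertex)) (*-nonneg (0≤pos 100) (Δ few)))
          (*-nonneg (*-nonneg (0≤pos 4) 0≤L) (Δ S≤))) (*-nonneg (square-nonneg N) (Δ 900≤L)))
        (identity N L (wrongs ρ p) S changes))
      where
      0≤L = <⇒≤ 0<L
      S = sum (λ v → wn v (p′ v))
      S≤ : + 25 * S ≤ N * N
      S≤ = subst₂ _≤_ (sum-*ˡ (+ 25) (λ v → wn v (p′ v))) (sum-const n N) (sum-mono close)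
      per-vertex : N * changes ≤ wrongs ρ p + S
      per-vertex = subst₂ _≤_ (sum²-ignore₂ changed)
        (sum²-+ (λ v w → wrong (ρ v w) (p v) (p w)) (λ v w → wrong (ρ v w) (p′ v) (p w)))
        (sum²-mono (λ v w → changed-wrong (ρ v w) (p v) (p′ v) (p w)))
      identity : ∀ N L W S Y → + 5 * L * N * N - + 5 * L * N * (+ 20 * Y) ≡
        + 100 * L * (W + S - N * Y) + + 100 * (+ 9 * (N * N) - L * W) + + 4 * L * (N * N - + 25 * S) + N * N * (L - + 900)
      identity = solve-∀

    -- One third, plus 1/(3M) with M ≥ 100, plus the fraction 1/20 of moved vertices, is below
    -- 39/100.
    sizes : ∀ i → + 100 * size p′ i ≤ + 39 * N
    sizes i = cancel-≤ (+ 3 * M) (*-pos (0<pos 2) 0<M)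
      (≤-by (+ 300 * M * (size p i + changes - size p′ i) + + 15 * M * (N - + 20 * changes) + + 100 * (N - M * (+ 3 * size p i - N)) + + 2 * (M - + 100) * N + + 100 * N)
        (+-nonneg (+-nonneg (+-nonneg (+-nonneg (*-nonneg (*-nonneg (0≤pos 300) 0≤M) (Δ bound)) (*-nonneg (*-nonneg (0≤pos 15) 0≤M) (Δ few-changes)))
          (*-nonneg (0≤pos 100) (Δ (balanced i)))) (*-nonneg (*-nonneg (0≤pos 2) (Δ 100≤M)) (<⇒≤ 0<n))) (*-nonneg (0≤pos 100) (<⇒≤ 0<n)))
        (identity N M (size p i) (size p′ i) changes))
      where
      0≤M = <⇒≤ 0<M
      bound : size p′ i ≤ size p i + changes
      bound = subst (size p′ i ≤_) (∑-distrib-+ (λ v → δ i (p v)) changed) (sum-mono (λ v → δ-changed i (p v) (p′ v)))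
      identity : ∀ N M s s′ Y → + 3 * M * (+ 39 * N) - + 3 * M * (+ 100 * s′) ≡
        + 300 * M * (s + Y - s′) + + 15 * M * (N - + 20 * Y) + + 100 * (N - M * (+ 3 * s - N)) + + 2 * (M - + 100) * N + + 100 * N
      identity = solve-∀

    -- 1/25 against the old parts of the other vertices, plus 1/20 for those that moved.
    degrees : ∀ v → + 100 * (sum λ w → wrong (ρ v w) (p′ v) (p′ w)) ≤ + 9 * N
    degrees v = ≤-by (+ 100 * (wn v (p′ v) + changes - D) + + 4 * (N - + 25 * wn v (p′ v)) + + 5 * (N - + 20 * changes))
      (+-nonneg (+-nonneg (*-nonneg (0≤pos 100) (Δ bound)) (*-nonneg (0≤pos 4) (Δ (close v)))) (*-nonneg (0≤pos 5) (Δ few-changes)))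
      (identity N D (wn v (p′ v)) changes)
      where
      D = sum λ w → wrong (ρ v w) (p′ v) (p′ w)
      bound : D ≤ wn v (p′ v) + changes
      bound = subst (D ≤_) (∑-distrib-+ (λ w → wrong (ρ v w) (p′ v) (p w)) changed)
        (sum-mono (λ w → wrong-changed (ρ v w) (p′ v) (p w) (p′ w)))
      identity : ∀ N D w Y → + 9 * N - + 100 * D ≡ + 100 * (w + Y - D) + + 4 * (N - + 25 * w) + + 5 * (N - + 20 * Y)
      identity = solve-∀

  x[x-1]-nonneg : ∀ x → 0ℤ ≤ x * (x - 1ℤ)
  x[x-1]-nonneg (+ 0)           = ≤-refl
  x[x-1]-nonneg (+ ℕ.suc n)     = *-nonneg (0≤pos (ℕ.suc n)) (0≤pos n)
  x[x-1]-nonneg (-[1+ n ])      = +≤+ ℕ.z≤n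

  x[x-1]≡0 : ∀ x → x * (x - 1ℤ) ≡ 0ℤ → ∃ λ (e : Fin 2) → x ≡ + toℕ e
  x[x-1]≡0 (+ 0)                 _ = 0F , refl
  x[x-1]≡0 (+ 1)                 _ = 1F , refl
  x[x-1]≡0 (+ ℕ.suc (ℕ.suc n))   ()
  x[x-1]≡0 (-[1+ n ])            ()

  -- The chord of falling₃ through q and q+1: by convexity it lies below falling₃ at every other integer.
  module Tangent (q : ℤ) (2≤q : + 2 ≤ q) where

    line remainder : ℤ → ℤ
    line a = + 3 * (q * (q - 1ℤ)) * (a - q) + q * (q - 1ℤ) * (q - + 2)
    remainder a = (a - q) * (a - q - 1ℤ) * (a + + 2 * (q - + 2) + + 2)

    falling₃-split : ∀ a → falling₃ a ≡ line a + remainder a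
    falling₃-split a = identity q a
      where
      identity : ∀ q a → a * (a - 1ℤ) * (a - + 2) ≡
        + 3 * (q * (q - 1ℤ)) * (a - q) + q * (q - 1ℤ) * (q - + 2) + (a - q) * (a - q - 1ℤ) * (a + + 2 * (q - + 2) + + 2)
      identity = solve-∀

    -- The third root of cubic minus chord is 2 - 2q, because the roots of `falling₃` and of the
    -- difference both add up to 3.
    slope-pos : ∀ {a} → 0ℤ ≤ a → 0ℤ < a + + 2 * (q - + 2) + + 2
    slope-pos 0≤a = +-mono-≤-< (+-nonneg 0≤a (*-nonneg (0≤pos 2) (Δ 2≤q))) (0<pos 1)

    remainder-nonneg : ∀ {a} → 0ℤ ≤ a → 0ℤ ≤ remainder a
    remainder-nonneg {a} 0≤a = *-nonneg (x[x-1]-nonneg (a - q)) (<⇒≤ (slope-pos 0≤a))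

    remainder≤0 : ∀ {a} → 0ℤ ≤ a → remainder a ≤ 0ℤ → ∃ λ (e : Fin 2) → a ≡ q + + toℕ e
    remainder≤0 {a} 0≤a le = proj₁ e , trans (shift a q) (cong (λ x → q + x) (proj₂ e))
      where
      s = a + + 2 * (q - + 2) + + 2
      x = a - q
      shift : ∀ a q → a ≡ q + (a - q)
      shift = solve-∀
      e = x[x-1]≡0 x (≤-antisym (cancel-≤ s (slope-pos 0≤a)
        (subst₂ _≤_ (*-comm (x * (x - 1ℤ)) s) (sym (*-zeroʳ s)) le)) (x[x-1]-nonneg x))

    remainder≡0 : ∀ (e : Fin 2) → remainder (q + + toℕ e) ≡ 0ℤ
    remainder≡0 0F = identity q
      where
      identity : ∀ q → (q + 0ℤ - q) * (q + 0ℤ - q - 1ℤ) * (q + 0ℤ + + 2 * (q - + 2) + + 2) ≡ 0ℤ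
      identity = solve-∀
    remainder≡0 1F = identity q
      where
      identity : ∀ q → (q + 1ℤ - q) * (q + 1ℤ - q - 1ℤ) * (q + 1ℤ + + 2 * (q - + 2) + + 2) ≡ 0ℤ
      identity = solve-∀

    remainders : (Fin n → Fin 3) → ℤ
    remainders p = remainder (size p 0F) + remainder (size p 1F) + remainder (size p 2F)

    fallingSizes-split : ∀ {n} (p : Fin n → Fin 3) →
      fallingSizes p ≡ + 3 * (q * (q - 1ℤ)) * (+ n - + 3 * q) + + 3 * (q * (q - 1ℤ) * (q - + 2)) + remainders p
    fallingSizes-split {n} p = trans (cong₂ _+_ (cong₂ _+_ (falling₃-split (size p 0F)) (falling₃-split (size p 1F))) (falling₃-split (size p 2F)))
      (trans (identity q (size p 0F) (size p 1F) (size p 2F) (remainder (size p 0F)) (remainder (size p 1F)) (remainder (size p 2F)))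
        (cong (λ N → + 3 * (q * (q - 1ℤ)) * (N - + 3 * q) + + 3 * (q * (q - 1ℤ) * (q - + 2)) + remainders p) (sum-size p)))
      where
      identity : ∀ q a b c x y z →
        + 3 * (q * (q - 1ℤ)) * (a - q) + q * (q - 1ℤ) * (q - + 2) + x + (+ 3 * (q * (q - 1ℤ)) * (b - q) + q * (q - 1ℤ) * (q - + 2) + y)
          + (+ 3 * (q * (q - 1ℤ)) * (c - q) + q * (q - 1ℤ) * (q - + 2) + z) ≡
        + 3 * (q * (q - 1ℤ)) * (a + b + c - + 3 * q) + + 3 * (q * (q - 1ℤ) * (q - + 2)) + (x + y + z)
      identity = solve-∀

    module _ {n} (p₀ : Fin n → Fin 3) (near₀ : ∀ i → ∃ λ (e : Fin 2) → size p₀ i ≡ q + + toℕ e) where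

      remainders₀ : remainders p₀ ≡ 0ℤ
      remainders₀ = cong₂ _+_ (cong₂ _+_ (zero-at 0F) (zero-at 1F)) (zero-at 2F)
        where
        zero-at : ∀ i → remainder (size p₀ i) ≡ 0ℤ
        zero-at i = trans (cong remainder (proj₂ (near₀ i))) (remainder≡0 (proj₁ (near₀ i)))

      excess≡ : ∀ p → fallingSizes p - fallingSizes p₀ ≡ remainders p
      excess≡ p = trans (cong₂ _-_ (fallingSizes-split p) (trans (fallingSizes-split p₀) (cong (λ x → base + x) remainders₀)))
        (identity base (remainders p))
        where
        base = + 3 * (q * (q - 1ℤ)) * (+ n - + 3 * q) + + 3 * (q * (q - 1ℤ) * (q - + 2))
        identity : ∀ b r → b + r - (b + 0ℤ) ≡ r
        identity = solve-∀

      minimal : ∀ p → fallingSizes p₀ ≤ fallingSizes p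
      minimal p = ≤-by (remainders p) (+-nonneg (+-nonneg (r≥0 0F) (r≥0 1F)) (r≥0 2F)) (excess≡ p)
        where
        r≥0 : ∀ i → 0ℤ ≤ remainder (size p i)
        r≥0 i = remainder-nonneg (size-nonneg p i)

      minimizers : ∀ p → fallingSizes p ≤ fallingSizes p₀ → ∀ i → ∃ λ (e : Fin 2) → size p i ≡ q + + toℕ e
      minimizers p le i = remainder≤0 (size-nonneg p i) (r≤0 i)
        where
        r = λ i → remainder (size p i)
        r≥0 : ∀ i → 0ℤ ≤ r i
        r≥0 i = remainder-nonneg (size-nonneg p i)
        total≤0 : r 0F + r 1F + r 2F ≤ 0ℤ
        total≤0 = subst₂ _≤_ (excess≡ p) (+-inverseʳ (fallingSizes p₀)) (+-monoˡ-≤ (- fallingSizes p₀) le)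
        r≤0 : ∀ i → r i ≤ 0ℤ
        r≤0 0F = ≤-trans (≤-by (r 1F + r 2F) (+-nonneg (r≥0 1F) (r≥0 2F)) (identity (r 0F) (r 1F) (r 2F))) total≤0
          where
          identity : ∀ a b c → a + b + c - a ≡ b + c
          identity = solve-∀
        r≤0 1F = ≤-trans (≤-by (r 0F + r 2F) (+-nonneg (r≥0 0F) (r≥0 2F)) (identity (r 0F) (r 1F) (r 2F))) total≤0
          where
          identity : ∀ a b c → a + b + c - b ≡ a + c
          identity = solve-∀
        r≤0 2F = ≤-trans (≤-by (r 0F + r 1F) (+-nonneg (r≥0 0F) (r≥0 1F)) (identity (r 0F) (r 1F) (r 2F))) total≤0
          where
          identity : ∀ a b c → a + b + c - c ≡ a + b
          identity = solve-∀

      n≥3q : 0ℤ ≤ + n - + 3 * q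
      n≥3q = subst (0ℤ ≤_) (trans (identity (size p₀ 0F) (size p₀ 1F) (size p₀ 2F) q) (cong (λ N → N - + 3 * q) (sum-size p₀)))
        (+-nonneg (+-nonneg (above 0F) (above 1F)) (above 2F))
        where
        above : ∀ i → 0ℤ ≤ size p₀ i - q
        above i = subst (λ s → 0ℤ ≤ s - q) (sym (proj₂ (near₀ i))) (subst (0ℤ ≤_) (cancel q (+ toℕ (proj₁ (near₀ i)))) (0≤pos (toℕ (proj₁ (near₀ i)))))
          where
          cancel : ∀ q e → e ≡ q + e - q
          cancel = solve-∀
        identity : ∀ a b c q → (a - q) + (b - q) + (c - q) ≡ a + b + c - + 3 * q
        identity = solve-∀

      -- With n = 3q + E, the difference expands into nonnegative monomials in E and q.
      fallingSizes-small : + 9 * fallingSizes p₀ ≤ + n * (+ n * + n)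
      fallingSizes-small = ≤-by (+ 9 * (q * (E * E)) + E * (E * E) + + 81 * (q * (q - + 2)) + + 108 * q + + 27 * (q * E))
        (+-nonneg (+-nonneg (+-nonneg (+-nonneg (*-nonneg (0≤pos 9) (*-nonneg 0≤q (square-nonneg E))) (*-nonneg n≥3q (square-nonneg E)))
          (*-nonneg (0≤pos 81) (*-nonneg 0≤q (Δ 2≤q)))) (*-nonneg (0≤pos 108) 0≤q)) (*-nonneg (0≤pos 27) (*-nonneg 0≤q n≥3q)))
        (trans (cong (λ F → + n * (+ n * + n) - + 9 * F) (trans (fallingSizes-split p₀) (cong (λ x → + 3 * (q * (q - 1ℤ)) * (+ n - + 3 * q) + + 3 * (q * (q - 1ℤ) * (q - + 2)) + x) remainders₀)))
          (identity (+ n) q))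
        where
        E = + n - + 3 * q
        0≤q : 0ℤ ≤ q
        0≤q = ≤-trans (0≤pos 2) 2≤q
        identity : ∀ N q → let E = N - + 3 * q in
          N * (N * N) - + 9 * (+ 3 * (q * (q - 1ℤ)) * (N - + 3 * q) + + 3 * (q * (q - 1ℤ) * (q - + 2)) + 0ℤ) ≡
          + 9 * (q * (E * E)) + E * (E * E) + + 81 * (q * (q - + 2)) + + 108 * q + + 27 * (q * E)
        identity = solve-∀

  abstract
    -- Subsets of ℤ/3 of equal size differ by a rotation. A rotation is what is wanted, because a
    -- transposition of the parts would reverse the arcs of the blow-up.
    rotation : ∀ (a b c a′ b′ c′ : Fin 2) → + toℕ a + + toℕ b + + toℕ c ≡ + toℕ a′ + + toℕ b′ + + toℕ c′ →
      ∃ λ s → ∀ i → select (a , b , c) (i ⊝ flip s) ≡ select (a′ , b′ , c′) i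
    rotation = from-yes (all? λ (a : Fin 2) → all? λ (b : Fin 2) → all? λ (c : Fin 2) → all? λ (a′ : Fin 2) → all? λ (b′ : Fin 2) → all? λ (c′ : Fin 2) →
      (+ toℕ a + + toℕ b + + toℕ c ℤ.≟ + toℕ a′ + + toℕ b′ + + toℕ c′) →-dec
      any? λ s → all? λ i → select (a , b , c) (i ⊝ flip s) ≟ select (a′ , b′ , c′) i)

    active≡0 : ∀ r i j → active r i j ≡ 0ℤ → r ≡ 0F ⊎ r ≡ j ⊝ i
    active≡0 = from-yes (all? λ r → all? λ i → all? λ j → (active r i j ℤ.≟ 0ℤ) →-dec ((r ≟ 0F) ⊎-dec (r ≟ j ⊝ i)))

    mixed≡0 : ∀ i j k → mixed 0F 0F 0F i j k ≡ 0ℤ → i ≡ j × j ≡ k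
    mixed≡0 = from-yes (all? λ i → all? λ j → all? λ k → (mixed 0F 0F 0F i j k ℤ.≟ 0ℤ) →-dec ((i ≟ j) ×-dec (j ≟ k)))

    δ-shift : ∀ (i j s : Fin 3) → δ i (j ⊝ s) ≡ δ (i ⊝ flip s) j
    δ-shift = from-yes (all? λ (i : Fin 3) → all? λ j → all? λ s → δ i (j ⊝ s) ℤ.≟ δ (i ⊝ flip s) j)

    ⊝-shift : ∀ i j s → (i ⊝ s) ⊝ (j ⊝ s) ≡ i ⊝ j
    ⊝-shift = from-yes (all? λ i → all? λ j → all? λ s → (i ⊝ s) ⊝ (j ⊝ s) ≟ i ⊝ j)

  module _ {n} (q : ℤ) (p p₀ : Fin n → Fin 3)
    (near : ∀ i → ∃ λ (e : Fin 2) → size p i ≡ q + + toℕ e)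
    (near₀ : ∀ i → ∃ λ (e : Fin 2) → size p₀ i ≡ q + + toℕ e) where

    matching-shift : ∃ λ s → ∀ i → size (λ v → p v ⊝ s) i ≡ size p₀ i
    matching-shift = proj₁ r , λ i → trans (sum-cong-≗ (λ v → δ-shift i (p v) (proj₁ r)))
      (trans (at p near (i ⊝ flip (proj₁ r))) (trans (cong (λ e → q + + toℕ e) (proj₂ r i)) (sym (at p₀ near₀ i))))
      where
      Near : (Fin n → Fin 3) → Set
      Near p = ∀ i → ∃ λ (e : Fin 2) → size p i ≡ q + + toℕ e
      digits : ∀ p → Near p → Fin 2 × Fin 2 × Fin 2
      digits p near = proj₁ (near 0F) , proj₁ (near 1F) , proj₁ (near 2F)
      at : ∀ p (near : Near p) i → size p i ≡ q + + toℕ (select (digits p near) i)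
      at p near 0F = proj₂ (near 0F)
      at p near 1F = proj₂ (near 1F)
      at p near 2F = proj₂ (near 2F)
      digit-sum : ∀ p (near : Near p) →
        + toℕ (proj₁ (near 0F)) + + toℕ (proj₁ (near 1F)) + + toℕ (proj₁ (near 2F)) ≡ + n - + 3 * q
      digit-sum p near = trans (identity q (+ toℕ (proj₁ (near 0F))) (+ toℕ (proj₁ (near 1F))) (+ toℕ (proj₁ (near 2F))))
        (cong (λ x → x - + 3 * q) (trans (sym (cong₂ _+_ (cong₂ _+_ (proj₂ (near 0F)) (proj₂ (near 1F))) (proj₂ (near 2F)))) (sum-size p)))
        where
        identity : ∀ q a b c → a + b + c ≡ q + a + (q + b) + (q + c) - + 3 * q
        identity = solve-∀
      r : ∃ λ s → ∀ i → select (digits p near) (i ⊝ flip s) ≡ select (digits p₀ near₀) i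
      r = rotation (proj₁ (near 0F)) (proj₁ (near 1F)) (proj₁ (near 2F)) (proj₁ (near₀ 0F)) (proj₁ (near₀ 1F)) (proj₁ (near₀ 2F))
        (trans (digit-sum p near) (sym (digit-sum p₀ near₀)))

  record Extremal {n} (ρ : Fin n → Fin n → Fin 3) (p : Fin n → Fin 3) : Set where
    field
      relation    : ∀ u v → ρ u v ≡ 0F ⊎ ρ u v ≡ p v ⊝ p u
      independent : ∀ {u v w} → u ≢ v → v ≢ w → u ≢ w →
                    ρ u v ≡ 0F → ρ v w ≡ 0F → ρ u w ≡ 0F → p u ≡ p v × p v ≡ p w

  extremal-shift : ∀ {ρ : Fin n → Fin n → Fin 3} {p : Fin n → Fin 3} s → Extremal ρ p → Extremal ρ (λ v → p v ⊝ s)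
  extremal-shift {ρ = ρ} {p} s ext = record
    { relation    = λ u v → go u v (relation u v)
    ; independent = λ u≢v v≢w u≢w a b c → let e = independent u≢v v≢w u≢w a b c in
                    cong (_⊝ s) (proj₁ e) , cong (_⊝ s) (proj₂ e) }
    where
    open Extremal ext
    go : ∀ u v → ρ u v ≡ 0F ⊎ ρ u v ≡ p v ⊝ p u → ρ u v ≡ 0F ⊎ ρ u v ≡ (p v ⊝ s) ⊝ (p u ⊝ s)
    go u v (inj₁ e) = inj₁ e
    go u v (inj₂ e) = inj₂ (trans e (sym (⊝-shift (p v) (p u) s)))

  tight-extremal : ∀ {n} {ρ : Fin n → Fin n → Fin 3} (anti : Antisymmetric ρ) p →
    (∀ u v → Excess.activeAt anti p u v ≡ 0ℤ) → (∀ u v w → distinct u v w * Excess.mixedAt anti p u v w ≡ 0ℤ) → Extremal ρ p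
  tight-extremal {ρ = ρ} anti p act mix = record
    { relation    = λ u v → active≡0 (ρ u v) (p u) (p v) (act u v)
    ; independent = λ {u} {v} {w} u≢v v≢w u≢w a b c → mixed≡0 (p u) (p v) (p w)
        (trans (sym (trans {j = 1ℤ * Excess.mixedAt anti p u v w} (cong (λ d → d * Excess.mixedAt anti p u v w) (distinct-≢ u≢v v≢w u≢w))
          (trans (*-identityˡ (Excess.mixedAt anti p u v w)) (mixed-at (p u) (p v) (p w) a b c)))) (mix u v w)) }
    where
    mixed-at : ∀ {a b c} i j k → a ≡ 0F → b ≡ 0F → c ≡ 0F → mixed a b c i j k ≡ mixed 0F 0F 0F i j k
    mixed-at i j k refl refl refl = refl

open BalancedPartitions

-- Choice of constants, and the structure of optimal relations.

module StructureTheorem where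

  open import Data.Integer hiding (suc; _≟_; _/_; _%_)
  open import Data.Integer.Properties hiding (_≟_)

  abstract
    -- Kept abstract together with the facts used about them, so that these large numbers never
    -- unfold in later terms.
    m₀ M₀ L₀ : ℤ
    m₀ = + 20
    M₀ = + 1207
    L₀ = + 366 * (M₀ * M₀)

    m₀≡ : m₀ ≡ + 20
    m₀≡ = refl

    M₀≡ : M₀ ≡ + 7 + + 3 * (m₀ * m₀)
    M₀≡ = refl

    L₀≡ : L₀ ≡ + 366 * (M₀ * M₀)
    L₀≡ = refl

    0≤m₀ : 0ℤ ≤ m₀
    0≤m₀ = 0≤pos 20

    0<M₀ : 0ℤ < M₀
    0<M₀ = from-yes (0ℤ <? M₀)

    100≤M₀ : + 100 ≤ M₀
    100≤M₀ = from-yes (+ 100 ≤? M₀)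

    0<L₀ : 0ℤ < L₀
    0<L₀ = from-yes (0ℤ <? L₀)

    162M₀≤L₀ : + 162 * M₀ ≤ L₀
    162M₀≤L₀ = from-yes (+ 162 * M₀ ≤? L₀)

    900≤L₀ : + 900 ≤ L₀
    900≤L₀ = from-yes (+ 900 ≤? L₀)

  -- A sum instead of a maximum: all summands are nonnegative, so every requirement on N follows
  -- from the single bound.
  bound : ℤ
  bound = L₀ * L₀ * K + L₀ * K + L₀ * + 27 + + 108 * M₀ + + 14

  module Large {N : ℤ} (bound≤N : bound ≤ N) where

    private
      0≤L₀ = <⇒≤ 0<L₀
      a b c d e : ℤ
      a = L₀ * L₀ * K
      b = L₀ * K
      c = L₀ * + 27
      d = + 108 * M₀
      e = + 14
      0≤a : 0ℤ ≤ a
      0≤a = *-nonneg (square-nonneg L₀) 0≤K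
      0≤b : 0ℤ ≤ b
      0≤b = *-nonneg 0≤L₀ 0≤K
      0≤c : 0ℤ ≤ c
      0≤c = *-nonneg 0≤L₀ (0≤pos 27)
      0≤d : 0ℤ ≤ d
      0≤d = *-nonneg (0≤pos 108) (<⇒≤ 0<M₀)
      0≤e : 0ℤ ≤ e
      0≤e = 0≤pos 14

    LLK≤N : a ≤ N
    LLK≤N = ≤-trans (≤-by (b + c + d + e) (+-nonneg (+-nonneg (+-nonneg 0≤b 0≤c) 0≤d) 0≤e) (identity a b c d e)) bound≤N
      where
      identity : ∀ a b c d e → a + b + c + d + e - a ≡ b + c + d + e
      identity = solve-∀

    LK≤N : b ≤ N
    LK≤N = ≤-trans (≤-by (a + c + d + e) (+-nonneg (+-nonneg (+-nonneg 0≤a 0≤c) 0≤d) 0≤e) (identity a b c d e)) bound≤N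
      where
      identity : ∀ a b c d e → a + b + c + d + e - b ≡ a + c + d + e
      identity = solve-∀

    27L≤N : c ≤ N
    27L≤N = ≤-trans (≤-by (a + b + d + e) (+-nonneg (+-nonneg (+-nonneg 0≤a 0≤b) 0≤d) 0≤e) (identity a b c d e)) bound≤N
      where
      identity : ∀ a b c d e → a + b + c + d + e - c ≡ a + b + d + e
      identity = solve-∀

    108M≤N : d ≤ N
    108M≤N = ≤-trans (≤-by (a + b + c + e) (+-nonneg (+-nonneg (+-nonneg 0≤a 0≤b) 0≤c) 0≤e) (identity a b c d e)) bound≤N
      where
      identity : ∀ a b c d e → a + b + c + d + e - d ≡ a + b + c + e
      identity = solve-∀

    14≤N : e ≤ N
    14≤N = ≤-trans (≤-by (a + b + c + d) (+-nonneg (+-nonneg (+-nonneg 0≤a 0≤b) 0≤c) 0≤d) (identity a b c d e)) bound≤N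
      where
      identity : ∀ a b c d e → a + b + c + d + e - e ≡ a + b + c + d
      identity = solve-∀

  threshold : ℕ
  threshold = ∣ bound ∣

  bound≡ : + threshold ≡ bound
  bound≡ = 0≤i⇒+∣i∣≡i (+-nonneg (+-nonneg (+-nonneg (+-nonneg (*-nonneg (square-nonneg L₀) 0≤K) (*-nonneg (<⇒≤ 0<L₀) 0≤K))
    (*-nonneg (<⇒≤ 0<L₀) (0≤pos 27))) (*-nonneg (0≤pos 108) (<⇒≤ 0<M₀))) (0≤pos 14))

  module Structure {n} (large : threshold ℕ.< n) {ρ : Fin n → Fin n → Fin 3} (anti : Antisymmetric ρ) (optimal : Optimal ρ)
    (q : ℤ) (2≤q : + 2 ≤ q) (p₀ : Fin n → Fin 3) (near₀ : ∀ i → ∃ λ (e : Fin 2) → size p₀ i ≡ q + + toℕ e) where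

    private
      N = + n
      bound≤N : bound ≤ N
      bound≤N = subst (_≤ N) bound≡ (+≤+ (ℕ.<⇒≤ large))
      open Large bound≤N
      open Tangent q 2≤q
      14≤n : 14 ℕ.≤ n
      14≤n = drop‿+≤+ 14≤N
      0<N : 0ℤ < N
      0<N = <-≤-trans (0<pos 13) 14≤N

    -- The balanced blow-up is a competitor. Together with `fallingSizes≤` and `minimal` this closes
    -- a cycle of inequalities, so all of them are equalities.
    reference : distinctTotal ρ ≤ fallingSizes p₀
    reference = subst (distinctTotal ρ ≤_) (distinctTotal-pattern p₀) (optimal (patternOf p₀) (patternOf-anti p₀))

    small : + 9 * total ρ ≤ N * (N * N) + + 27 * (N * N)
    small = ≤-by (+ 9 * (distinctTotal ρ + + 3 * (N * N) - total ρ) + + 9 * (fallingSizes p₀ - distinctTotal ρ) + (N * (N * N) - + 9 * fallingSizes p₀))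
      (+-nonneg (+-nonneg (*-nonneg (0≤pos 9) (Δ (total-≤-distinct ρ))) (*-nonneg (0≤pos 9) (Δ reference))) (Δ (fallingSizes-small p₀ near₀)))
      (identity N (total ρ) (distinctTotal ρ) (fallingSizes p₀))
      where
      identity : ∀ N t d F → N * (N * N) + + 27 * (N * N) - + 9 * t ≡
        + 9 * (d + + 3 * (N * N) - t) + + 9 * (F - d) + (N * (N * N) - + 9 * F)
      identity = solve-∀

    first-partition : ∃ λ p → L₀ * wrongs ρ p ≤ + 9 * (N * N)
    first-partition = Stability.few-wrongs anti 14≤n small L₀ (<⇒≤ 0<L₀) LLK≤N LK≤N

    private
      p : Fin n → Fin 3
      p = proj₁ first-partition
      few = proj₂ first-partition

    some-part : ∀ v → ∃ λ i → + 25 * Neighbourhood.wrongNeighbours ρ v p i ≤ N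
    some-part v = Neighbourhood.some-part ρ v L₀ M₀ m₀ 0<N 0<L₀ 0≤m₀ 0<M₀ 162M₀≤L₀ 108M≤N M₀≡ m₀≡ L₀≡ 27L≤N small
      (vertexTotal-average anti optimal v) p few

    p′ : Fin n → Fin 3
    p′ v = proj₁ (some-part v)

    private
      v₀ : Fin n
      v₀ = fromℕ< (ℕ.≤-trans (ℕ.s≤s ℕ.z≤n) 14≤n)

      open Repartition {ρ = ρ} p p′ L₀ M₀ 0<N 0<L₀ 900≤L₀ 0<M₀ 100≤M₀ few (λ v → proj₂ (some-part v))
        (λ i → proj₁ (Neighbourhood.balanced ρ v₀ L₀ M₀ m₀ 0<N 0<L₀ 0≤m₀ 0<M₀ 162M₀≤L₀ 108M≤N M₀≡ m₀≡ L₀≡ 27L≤N small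
          (vertexTotal-average anti optimal v₀) p few i))

    p′-extremal : Extremal ρ p′
    p′-extremal = tight-extremal anti p′ (proj₁ t) (proj₂ t)
      where
      t : (∀ u v → Excess.activeAt anti p′ u v ≡ 0ℤ) × (∀ u v w → distinct u v w * Excess.mixedAt anti p′ u v w ≡ 0ℤ)
      t = Excess.tight anti p′ sizes degrees 0<N (≤-trans reference (minimal p₀ near₀ p′))

    p′-near : ∀ i → ∃ λ (e : Fin 2) → size p′ i ≡ q + + toℕ e
    p′-near = minimizers p₀ near₀ p′ (≤-trans (Excess.fallingSizes≤ anti p′ sizes degrees 0<N) reference)

    structure : ∃ λ p → (∀ i → size p i ≡ size p₀ i) × Extremal ρ p
    structure = (λ v → p′ v ⊝ proj₁ s) , proj₂ s , extremal-shift (proj₁ s) p′-extremal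
      where
      s = matching-shift q p′ p₀ p′-near near₀

open StructureTheorem

-- Oriented graphs as relations, counts as sums, and the parts of `B`.

module Encoding where

  open import Data.Integer hiding (suc; _≟_; _/_; _%_)
  open import Data.Integer.Properties hiding (_≟_)
  open import Data.Bool using (T)
  open import Data.Unit using (tt)

  isOut isIn : Fin 3 → Bool
  isOut r = does (r ≟ 1F)
  isIn  r = does (r ≟ 2F)

  code : Bool → Bool → Fin 3
  code a b = if a then 1F else if b then 2F else 0F

  isOut-code : ∀ a b → a ≡ isOut (code a b)
  isOut-code true  _     = refl
  isOut-code false true  = refl
  isOut-code false false = refl

  isIn-code : ∀ a b → (a ≡ true → b ≡ false) → b ≡ isIn (code a b)
  isIn-code true  _     h = h refl
  isIn-code false true  _ = refl
  isIn-code false false _ = refl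

  code-flip : ∀ a b → (a ≡ true → b ≡ false) → code b a ≡ flip (code a b)
  code-flip true  true  h = contradiction (h refl) λ ()
  code-flip true  false _ = refl
  code-flip false true  _ = refl
  code-flip false false _ = refl

  relOf : OrientedGraph n → Fin n → Fin n → Fin 3
  relOf G u v = code (adj G u v) (adj G v u)

  relOf-anti : (G : OrientedGraph n) → Antisymmetric (relOf G)
  relOf-anti G u v = code-flip (adj G u v) (adj G v u) (noAnti G u v)

  adj-out : (G : OrientedGraph n) → ∀ u v → adj G u v ≡ isOut (relOf G u v)
  adj-out G u v = isOut-code (adj G u v) (adj G v u)

  adj-in : (G : OrientedGraph n) → ∀ u v → adj G v u ≡ isIn (relOf G u v)
  adj-in G u v = isIn-code (adj G u v) (adj G v u) (noAnti G u v)

  isOut-flip : ∀ r → isOut r ≡ true → isOut (flip r) ≡ false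
  isOut-flip 1F _ = refl

  code-isOut : ∀ r → code (isOut r) (isOut (flip r)) ≡ r
  code-isOut 0F = refl
  code-isOut 1F = refl
  code-isOut 2F = refl

  graphOf : (ρ : Fin n → Fin n → Fin 3) → Antisymmetric ρ → OrientedGraph n
  graphOf ρ anti = record
    { adj    = λ u v → isOut (ρ u v)
    ; noLoop = λ v → cong isOut (diagonal anti v)
    ; noAnti = λ u v e → trans (cong isOut (anti u v)) (isOut-flip (ρ u v) e) }

  relOf-graphOf : (ρ : Fin n → Fin n → Fin 3) (anti : Antisymmetric ρ) → ∀ u v → relOf (graphOf ρ anti) u v ≡ ρ u v
  relOf-graphOf ρ anti u v = trans (cong (λ r → code (isOut (ρ u v)) (isOut r)) (anti u v)) (code-isOut (ρ u v))

  ⟦_⟧ᵇ : Bool → ℤ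
  ⟦ b ⟧ᵇ = if b then 1ℤ else 0ℤ

  -- The Boolean expressions are the unfolded `transitiveTriple` and `independentTriple`; primed
  -- variables stand for reversed pairs.
  triple-cost : ∀ {a a′ b b′ c c′} r s t → a ≡ isOut r → a′ ≡ isIn r → b ≡ isOut s → b′ ≡ isIn s → c ≡ isOut t → c′ ≡ isIn t →
    ⟦ (a ∨ a′) ∧ (b ∨ b′) ∧ (c ∨ c′) ∧ not ((a ∧ b ∧ c′) ∨ (c ∧ b′ ∧ a′)) ⟧ᵇ + ⟦ not ((a ∨ a′) ∨ (b ∨ b′) ∨ (c ∨ c′)) ⟧ᵇ ≡ tripleCost r s t
  triple-cost r s t refl refl refl refl refl refl = check r s t
    where
    check : ∀ r s t → let a = isOut r ; a′ = isIn r ; b = isOut s ; b′ = isIn s ; c = isOut t ; c′ = isIn t in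
      ⟦ (a ∨ a′) ∧ (b ∨ b′) ∧ (c ∨ c′) ∧ not ((a ∧ b ∧ c′) ∨ (c ∧ b′ ∧ a′)) ⟧ᵇ + ⟦ not ((a ∨ a′) ∨ (b ∨ b′) ∨ (c ∨ c′)) ⟧ᵇ ≡ tripleCost r s t
    check = from-yes (all? λ r → all? λ s → all? λ t → let a = isOut r ; a′ = isIn r ; b = isOut s ; b′ = isIn s ; c = isOut t ; c′ = isIn t in
      ⟦ (a ∨ a′) ∧ (b ∨ b′) ∧ (c ∨ c′) ∧ not ((a ∧ b ∧ c′) ∨ (c ∧ b′ ∧ a′)) ⟧ᵇ + ⟦ not ((a ∨ a′) ∨ (b ∨ b′) ∨ (c ∨ c′)) ⟧ᵇ ℤ.≟ tripleCost r s t)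

  sum-list : (g : Fin n → ℕ) → + List.sum (map g (allFin n)) ≡ sum (λ i → + g i)
  sum-list {n} g = trans (cong (λ xs → + List.sum xs) (map-tabulate (λ i → i) g)) (go g)
    where
    go : ∀ {n} (g : Fin n → ℕ) → + List.sum (tabulate g) ≡ sum (λ i → + g i)
    go {ℕ.zero}  g = refl
    go {ℕ.suc n} g = cong (λ x → + g 0F + x) (go (λ i → g (suc i)))

  lt : Fin n → Fin n → ℤ
  lt u v = ⟦ toℕ u <ᵇ toℕ v ⟧ᵇ

  count3-sum : ∀ n P → + count3 n P ≡ sum³ (λ u v w → lt u v * (lt v w * ⟦ P u v w ⟧ᵇ))
  count3-sum n P = trans (sum-list (λ u → List.sum (map (λ v → List.sum (map (g u v) (allFin n))) (allFin n))))
    (sum-cong-≗ λ u → trans (sum-list (λ v → List.sum (map (g u v) (allFin n))))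
      (sum-cong-≗ λ v → trans (sum-list (g u v)) (sum-cong-≗ λ w → bool (toℕ u <ᵇ toℕ v) (toℕ v <ᵇ toℕ w) (P u v w))))
    where
    g : Fin n → Fin n → Fin n → ℕ
    g u v w = if (toℕ u <ᵇ toℕ v) ∧ (toℕ v <ᵇ toℕ w) ∧ P u v w then 1 else 0
    bool : ∀ x y z → + (if x ∧ y ∧ z then 1 else 0) ≡ ⟦ x ⟧ᵇ * (⟦ y ⟧ᵇ * ⟦ z ⟧ᵇ)
    bool true  true  true  = refl
    bool true  true  false = refl
    bool true  false true  = refl
    bool true  false false = refl
    bool false true  true  = refl
    bool false true  false = refl
    bool false false true  = refl
    bool false false false = refl

  data Order (x y : Fin n) : Set where
    less : toℕ x ℕ.< toℕ y → lt x y ≡ 1ℤ → Order x y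
    notLess : ¬ (toℕ x ℕ.< toℕ y) → lt x y ≡ 0ℤ → Order x y

  order : (x y : Fin n) → Order x y
  order x y with toℕ x <ᵇ toℕ y in eq
  ... | true  = less (ℕ.<ᵇ⇒< (toℕ x) (toℕ y) (subst T (sym eq) tt)) (cong ⟦_⟧ᵇ eq)
  ... | false = notLess (λ x<y → subst T eq (ℕ.<⇒<ᵇ x<y)) (cong ⟦_⟧ᵇ eq)

  lt≡1 : {x y : Fin n} → toℕ x ℕ.< toℕ y → lt x y ≡ 1ℤ
  lt≡1 {x = x} {y} x<y with order x y
  ... | less _ e      = e
  ... | notLess x≮y _ = contradiction x<y x≮y

  lt≡0 : {x y : Fin n} → ¬ (toℕ x ℕ.< toℕ y) → lt x y ≡ 0ℤ
  lt≡0 {x = x} {y} x≮y with order x y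
  ... | less x<y _  = contradiction x<y x≮y
  ... | notLess _ e = e

  lt-trans : (x y z : Fin n) → lt x y * (lt y z * lt x z) ≡ lt x y * lt y z
  lt-trans x y z with order x y | order y z
  ... | notLess _ e | _ = trans (cong (λ a → a * (lt y z * lt x z)) e) (cong (λ a → a * lt y z) (sym e))
  ... | less _ _ | notLess _ e = cong (λ a → lt x y * a) (trans (cong (λ a → a * lt x z) e) (sym e))
  ... | less x<y _ | less y<z _ = cong (λ a → lt x y * a)
    (trans (cong (λ a → lt y z * a) (lt≡1 (ℕ.<-trans x<y y<z))) (*-identityʳ (lt y z)))

  lt-acyclic : (x y z : Fin n) → lt x y * (lt y z * lt z x) ≡ 0ℤ
  lt-acyclic x y z with order x y | order y z
  ... | notLess _ e | _ = cong (λ a → a * (lt y z * lt z x)) e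
  ... | less _ _ | notLess _ e = trans (cong (λ a → lt x y * (a * lt z x)) e) (*-zeroʳ (lt x y))
  ... | less x<y _ | less y<z _ = trans (cong (λ a → lt x y * (lt y z * a)) (lt≡0 (ℕ.<⇒≯ (ℕ.<-trans x<y y<z))))
    (trans (cong (λ a → lt x y * a) (*-zeroʳ (lt y z))) (*-zeroʳ (lt x y)))

  lt-total : (x y : Fin n) → 1ℤ - δ x y ≡ lt x y + lt y x
  lt-total x y with ℕ.<-cmp (toℕ x) (toℕ y)
  ... | tri< x<y x≢y y≮x = trans (cong (λ d → 1ℤ - d) (δ-≢ (λ e → x≢y (cong toℕ e)))) (sym (cong₂ _+_ (lt≡1 x<y) (lt≡0 y≮x)))
  ... | tri≈ x≮y x≡y y≮x = trans (cong (λ d → 1ℤ - d) (trans (cong (δ x) (sym (toℕ-injective x≡y))) (δ-refl x))) (sym (cong₂ _+_ (lt≡0 x≮y) (lt≡0 y≮x)))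
  ... | tri> x≮y x≢y y<x = trans (cong (λ d → 1ℤ - d) (δ-≢ (λ e → x≢y (cong toℕ e)))) (sym (cong₂ _+_ (lt≡0 x≮y) (lt≡1 y<x)))

  -- Expanding the three comparisons gives eight tournaments on three points: six are linear orders,
  -- and the two cyclic ones contradict transitivity.
  distinct-orders : (u v w : Fin n) → distinct u v w ≡
    lt u v * lt v w + lt u w * lt w v + lt v u * lt u w + lt v w * lt w u + lt w u * lt u v + lt w v * lt v u
  distinct-orders u v w = trans (cong₂ _*_ (lt-total u v) (cong₂ _*_ (lt-total v w) (lt-total u w)))
    (trans (expand (lt u v) (lt v u) (lt v w) (lt w v) (lt u w) (lt w u))
      (trans (cong₂ _+_ (cong₂ _+_ (cong₂ _+_ (cong₂ _+_ (cong₂ _+_ (cong₂ _+_ (cong₂ _+_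
          (lt-trans u v w) (lt-trans u w v)) (lt-trans v u w)) (lt-trans v w u)) (lt-trans w u v)) (lt-trans w v u))
          (lt-acyclic u v w)) (lt-acyclic v u w))
        (drop (lt u v * lt v w + lt u w * lt w v + lt v u * lt u w + lt v w * lt w u + lt w u * lt u v + lt w v * lt v u))))
    where
    drop : ∀ x → x + 0ℤ + 0ℤ ≡ x
    drop = solve-∀
    expand : ∀ a a′ b b′ c c′ → (a + a′) * ((b + b′) * (c + c′)) ≡
      a * (b * c) + c * (b′ * a) + a′ * (c * b) + b * (c′ * a′) + c′ * (a * b′) + b′ * (a′ * c′)
        + a * (b * c′) + a′ * (c * b′)
    expand = solve-∀

  module _ {ρ : Fin n → Fin n → Fin 3} (anti : Antisymmetric ρ) where

    orderedCost : Fin n → Fin n → Fin n → ℤ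
    orderedCost u v w = lt u v * (lt v w * cost ρ u v w)

    distinctTotal-ordered : distinctTotal ρ ≡ + 6 * sum³ orderedCost
    distinctTotal-ordered = trans (sum³-cong pointwise)
      (trans (sum³-+ (λ u v w → h u v w + h u w v + h v u w + h v w u + h w u v) (λ u v w → h w v u))
      (trans (cong₂ _+_ (trans (sum³-+ (λ u v w → h u v w + h u w v + h v u w + h v w u) (λ u v w → h w u v))
        (cong₂ _+_ (trans (sum³-+ (λ u v w → h u v w + h u w v + h v u w) (λ u v w → h v w u))
          (cong₂ _+_ (trans (sum³-+ (λ u v w → h u v w + h u w v) (λ u v w → h v u w))
            (cong₂ _+_ (trans (sum³-+ h (λ u v w → h u w v)) (cong (λ x → sum³ h + x) (sum³-swap₂₃ h)))
              (sum³-swap₁₂ h)))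
            vwu)) wuv)) wvu) (six (sum³ h))))
      where
      h = orderedCost
      vwu : sum³ (λ u v w → h v w u) ≡ sum³ h
      vwu = trans (sum³-swap₁₂ (λ u v w → h u w v)) (sum³-swap₂₃ h)
      wuv : sum³ (λ u v w → h w u v) ≡ sum³ h
      wuv = trans (sum³-swap₂₃ (λ u v w → h v u w)) (sum³-swap₁₂ h)
      wvu : sum³ (λ u v w → h w v u) ≡ sum³ h
      wvu = trans (sum³-swap₂₃ (λ u v w → h v w u)) vwu
      six : ∀ x → x + x + x + x + x + x ≡ + 6 * x
      six = solve-∀
      distrib : ∀ a b c d e f a′ b′ c′ d′ e′ f′ k → (a * a′ + b * b′ + c * c′ + d * d′ + e * e′ + f * f′) * k ≡
        a * (a′ * k) + b * (b′ * k) + c * (c′ * k) + d * (d′ * k) + e * (e′ * k) + f * (f′ * k)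
      distrib = solve-∀
      s₁₂ = cost-swap₁₂ anti
      s₂₃ = cost-swap₂₃ anti
      at : ∀ {x y z u v w} → cost ρ x y z ≡ cost ρ u v w → lt x y * (lt y z * cost ρ u v w) ≡ h x y z
      at {x} {y} {z} e = cong (λ k → lt x y * (lt y z * k)) (sym e)
      pointwise : ∀ u v w → distinct u v w * cost ρ u v w ≡ h u v w + h u w v + h v u w + h v w u + h w u v + h w v u
      pointwise u v w = trans (cong (λ d → d * cost ρ u v w) (distinct-orders u v w))
        (trans (distrib (lt u v) (lt u w) (lt v u) (lt v w) (lt w u) (lt w v) (lt v w) (lt w v) (lt u w) (lt w u) (lt u v) (lt v u) (cost ρ u v w))
          (cong₂ _+_ (cong₂ _+_ (cong₂ _+_ (cong₂ _+_ (cong₂ _+_ (refl {x = h u v w}) (at (s₂₃ u v w))) (at (s₁₂ u v w)))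
            (at (trans (s₂₃ v u w) (s₁₂ u v w)))) (at (trans (s₁₂ u w v) (s₂₃ u v w)))) (at (trans (s₂₃ w u v) (trans (s₁₂ u w v) (s₂₃ u v w))))))

  objective : OrientedGraph n → ℕ
  objective G = numTransitive G ℕ.+ numIndependent G

  objective-sum : (G : OrientedGraph n) → + objective G ≡ sum³ (orderedCost (relOf-anti G))
  objective-sum {n} G = trans (cong₂ _+_ (count3-sum n (transitiveTriple (adj G))) (count3-sum n (independentTriple (adj G))))
    (trans (sym (sum³-+ (λ u v w → lt u v * (lt v w * ⟦ transitiveTriple (adj G) u v w ⟧ᵇ)) (λ u v w → lt u v * (lt v w * ⟦ independentTriple (adj G) u v w ⟧ᵇ))))
      (sum³-cong (λ u v w → trans (factor (lt u v) (lt v w) ⟦ transitiveTriple (adj G) u v w ⟧ᵇ ⟦ independentTriple (adj G) u v w ⟧ᵇ)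
        (cong (λ k → lt u v * (lt v w * k)) (triple-cost (relOf G u v) (relOf G v w) (relOf G u w)
          (adj-out G u v) (adj-in G u v) (adj-out G v w) (adj-in G v w) (adj-out G u w) (adj-in G u w))))))
    where
    factor : ∀ a b x y → a * (b * x) + a * (b * y) ≡ a * (b * (x + y))
    factor = solve-∀

  distinctTotal-objective : (G : OrientedGraph n) → distinctTotal (relOf G) ≡ + 6 * + objective G
  distinctTotal-objective G = trans (distinctTotal-ordered (relOf-anti G)) (cong (λ x → + 6 * x) (sym (objective-sum G)))

  -- Every antisymmetric relation is the relation of a graph, and the sum over distinct triples is 6
  -- times the objective, so the two notions of optimality agree.
  minimizer-optimal : (G : OrientedGraph n) → IsMinimizer G → Optimal (relOf G)
  minimizer-optimal G minimizer ρ′ anti′ = subst₂ _≤_ (sym (distinctTotal-objective G))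
    (trans (sym (distinctTotal-objective G′)) (sum³-cong (λ u v w → cong (λ k → distinct u v w * k) (same-cost′ u v w))))
    (*-monoˡ-≤-nonNeg (+ 6) (+≤+ (minimizer G′)))
    where
    G′ = graphOf ρ′ anti′
    same-cost′ : ∀ u v w → cost (relOf G′) u v w ≡ cost ρ′ u v w
    same-cost′ u v w = trans (cong (λ r → tripleCost r (relOf G′ v w) (relOf G′ u w)) (relOf-graphOf ρ′ anti′ u v))
      (cong₂ (tripleCost (ρ′ u v)) (relOf-graphOf ρ′ anti′ v w) (relOf-graphOf ρ′ anti′ u w))

  part₃ : Fin n → Fin 3
  part₃ {n} v = if toℕ v <ᵇ partSize n 0 then 0F
    else if toℕ v <ᵇ partSize n 0 ℕ.+ partSize n 1 then 1F
    else 2F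

  part≡toℕ : (v : Fin n) → part v ≡ toℕ (part₃ v)
  part≡toℕ {n} v = go (toℕ v <ᵇ partSize n 0) (toℕ v <ᵇ partSize n 0 ℕ.+ partSize n 1)
    where
    go : ∀ x y → (if x then 0 else if y then 1 else 2) ≡ toℕ (if x then 0F else if y then 1F else (Fin 3 ∋ 2F))
    go true  _     = refl
    go false true  = refl
    go false false = refl

  below : ∀ {n a} → a ℕ.≤ n → sum {n} (λ v → ⟦ toℕ v <ᵇ a ⟧ᵇ) ≡ + a
  below {n} {ℕ.zero} _ = sum-0 n
  below {ℕ.suc n} {ℕ.suc a} (ℕ.s≤s a≤n) = cong (λ x → 1ℤ + x) (below a≤n)

  module _ (n : ℕ) where

    private
      r q : ℕ
      r = n % 3
      q = n / 3

    record PartSizes : Set where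
      field
        digit : Fin 3 → Fin 2
        size₀ : partSize n 0 ≡ toℕ (digit 0F) ℕ.+ q
        size₁ : partSize n 1 ≡ toℕ (digit 1F) ℕ.+ q
        size₂ : partSize n 2 ≡ toℕ (digit 2F) ℕ.+ q
        whole : partSize n 0 ℕ.+ partSize n 1 ℕ.+ partSize n 2 ≡ n

    -- Each part has q or q + 1 vertices with q = n / 3; the three residues of n are treated
    -- separately.
    partSizes : PartSizes
    partSizes = go r (m%n<n n 3) (m≡m%n+[m/n]*n n 3)
      where
      shifted : ∀ r i → n ≡ r ℕ.+ q ℕ.* 3 → partSize n i ≡ (r ℕ.+ i) / 3 ℕ.+ q
      shifted r i e = trans (cong (λ m → (m ℕ.+ i) / 3) e)
        (trans (cong (_/ 3) (trans (ℕ.+-assoc r (q ℕ.* 3) i) (trans (cong (r ℕ.+_) (ℕ.+-comm (q ℕ.* 3) i)) (sym (ℕ.+-assoc r i (q ℕ.* 3))))))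
          (trans (+-distrib-/-∣ʳ (r ℕ.+ i) {q ℕ.* 3} {3} (divides-refl q)) (cong ((r ℕ.+ i) / 3 ℕ.+_) (m*n/n≡m q 3))))
      sizes : ∀ r e₀ e₁ e₂ → n ≡ r ℕ.+ q ℕ.* 3 → (r ℕ.+ 0) / 3 ≡ toℕ {2} e₀ → (r ℕ.+ 1) / 3 ≡ toℕ {2} e₁ → (r ℕ.+ 2) / 3 ≡ toℕ {2} e₂ →
        toℕ e₀ ℕ.+ q ℕ.+ (toℕ e₁ ℕ.+ q) ℕ.+ (toℕ e₂ ℕ.+ q) ≡ r ℕ.+ q ℕ.* 3 → PartSizes
      sizes r e₀ e₁ e₂ e d₀ d₁ d₂ total = record
        { digit = select (e₀ , e₁ , e₂) ; size₀ = s₀ ; size₁ = s₁ ; size₂ = s₂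
        ; whole = trans (cong₂ ℕ._+_ (cong₂ ℕ._+_ s₀ s₁) s₂) (trans total (sym e)) }
        where
        s₀ = trans (shifted r 0 e) (cong (ℕ._+ q) d₀)
        s₁ = trans (shifted r 1 e) (cong (ℕ._+ q) d₁)
        s₂ = trans (shifted r 2 e) (cong (ℕ._+ q) d₂)
      total₀ : ∀ q → 0 ℕ.+ q ℕ.+ (0 ℕ.+ q) ℕ.+ (0 ℕ.+ q) ≡ 0 ℕ.+ q ℕ.* 3
      total₀ = solveℕ-∀
      total₁ : ∀ q → 0 ℕ.+ q ℕ.+ (0 ℕ.+ q) ℕ.+ (1 ℕ.+ q) ≡ 1 ℕ.+ q ℕ.* 3
      total₁ = solveℕ-∀
      total₂ : ∀ q → 0 ℕ.+ q ℕ.+ (1 ℕ.+ q) ℕ.+ (1 ℕ.+ q) ≡ 2 ℕ.+ q ℕ.* 3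
      total₂ = solveℕ-∀
      go : ∀ r → r ℕ.< 3 → n ≡ r ℕ.+ q ℕ.* 3 → PartSizes
      go 0 _ e = sizes 0 0F 0F 0F e refl refl refl (total₀ q)
      go 1 _ e = sizes 1 0F 0F 1F e refl refl refl (total₁ q)
      go 2 _ e = sizes 2 0F 1F 1F e refl refl refl (total₂ q)
      go (ℕ.suc (ℕ.suc (ℕ.suc _))) (ℕ.s≤s (ℕ.s≤s (ℕ.s≤s ()))) _

  size-part₃ : ∀ n i → ∃ λ (e : Fin 2) → size (part₃ {n}) i ≡ + (n / 3) + + toℕ e
  size-part₃ n i = digit i , go i
    where
    open PartSizes (partSizes n)
    a b c : ℕ
    a = partSize n 0
    b = partSize n 1
    c = partSize n 2
    a+b≤n : a ℕ.+ b ℕ.≤ n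
    a+b≤n = subst (a ℕ.+ b ℕ.≤_) whole (ℕ.m≤m+n (a ℕ.+ b) c)
    a≤n : a ℕ.≤ n
    a≤n = ℕ.≤-trans (ℕ.m≤m+n a b) a+b≤n
    x y : Fin n → Bool
    x v = toℕ v <ᵇ a
    y v = toℕ v <ᵇ a ℕ.+ b
    x⇒y : ∀ v → x v ≡ true → y v ≡ true
    x⇒y v e = Equivalence.to Bool.T-≡ (ℕ.<⇒<ᵇ (ℕ.<-≤-trans (ℕ.<ᵇ⇒< (toℕ v) a (subst T (sym e) tt)) (ℕ.m≤m+n a b)))
    δ₀ : ∀ x y → δ 0F (if x then 0F else if y then 1F else (Fin 3 ∋ 2F)) ≡ ⟦ x ⟧ᵇ
    δ₀ true  _     = refl
    δ₀ false true  = refl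
    δ₀ false false = refl
    δ₁ : ∀ x y → (x ≡ true → y ≡ true) → δ 1F (if x then 0F else if y then 1F else (Fin 3 ∋ 2F)) ≡ ⟦ y ⟧ᵇ - ⟦ x ⟧ᵇ
    δ₁ true  true  _ = refl
    δ₁ true  false h = contradiction (h refl) λ ()
    δ₁ false true  _ = refl
    δ₁ false false _ = refl
    δ₂ : ∀ x y → (x ≡ true → y ≡ true) → δ 2F (if x then 0F else if y then 1F else (Fin 3 ∋ 2F)) ≡ 1ℤ - ⟦ y ⟧ᵇ
    δ₂ true  true  _ = refl
    δ₂ true  false h = contradiction (h refl) λ ()
    δ₂ false true  _ = refl
    δ₂ false false _ = refl
    swap : ∀ e → + (e ℕ.+ n / 3) ≡ + (n / 3) + + e
    swap e = +-comm (+ e) (+ (n / 3))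
    minus : ∀ x y → x + y - x ≡ y
    minus = solve-∀
    go : ∀ i → size (part₃ {n}) i ≡ + (n / 3) + + toℕ (digit i)
    go 0F = trans (sum-cong-≗ (λ v → δ₀ (x v) (y v))) (trans (below a≤n) (trans (cong +_ size₀) (swap (toℕ (digit 0F)))))
    go 1F = trans (sum-cong-≗ (λ v → δ₁ (x v) (y v) (x⇒y v)))
      (trans (sum-sub (λ v → ⟦ y v ⟧ᵇ) (λ v → ⟦ x v ⟧ᵇ)) (trans (cong₂ _-_ (below a+b≤n) (below a≤n))
        (trans (minus (+ a) (+ b)) (trans (cong +_ size₁) (swap (toℕ (digit 1F)))))))
    go 2F = trans (sum-cong-≗ (λ v → δ₂ (x v) (y v) (x⇒y v)))
      (trans (sum-sub (λ _ → 1ℤ) (λ v → ⟦ y v ⟧ᵇ)) (trans (cong₂ _-_ (trans (sum-const n 1ℤ) (trans (*-identityʳ (+ n)) (cong +_ (sym whole)))) (below a+b≤n))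
        (trans (minus (+ (a ℕ.+ b)) (+ c)) (trans (cong +_ size₂) (swap (toℕ (digit 2F)))))))

  -- Induction on n: vertex 0 is matched with some `j` of the same class, and removing both leaves
  -- equal class sizes.
  equal-sizes⇒permutation : ∀ {n} (p q : Fin n → Fin 3) → (∀ i → size p i ≡ size q i) →
    Σ (Permutation′ n) λ σ → ∀ v → p (σ ⟨$⟩ʳ v) ≡ q v
  equal-sizes⇒permutation {ℕ.zero}  p q _  = Permutation.id , λ ()
  equal-sizes⇒permutation {ℕ.suc n} p q eq = insert 0F j (proj₁ rest) , correct
    where
    preimage : ∃ λ j → p j ≡ q 0F
    preimage with any? (λ j → p j ≟ q 0F)
    ... | yes found = found
    ... | no none = contradiction (trans (sym (trans (sum-cong-≗ (λ v → δ-≢ (λ e → none (v , sym e)))) (sum-0 (ℕ.suc n)))) (eq (q 0F)))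
      (<⇒≢ (<-≤-trans (subst (0ℤ <_) (sym (δ-refl (q 0F))) (0<pos 0)) (term≤sum (λ v → δ-nonneg (q 0F) (q v)) 0F)))
    j = proj₁ preimage
    rest = equal-sizes⇒permutation (λ v → p (punchIn j v)) (λ v → q (suc v)) (λ i → +-cancelˡ (δ i (p j)) _ _
      (trans (sym (sum-remove {i = j} (λ v → δ i (p v)))) (trans (eq i) (cong (λ k → δ i k + size (λ v → q (suc v)) i) (sym (proj₂ preimage))))))
      where
      +-cancelˡ : ∀ a b c → a + b ≡ a + c → b ≡ c
      +-cancelˡ a b c e = trans (undo a b) (trans (cong (λ x → x - a) e) (sym (undo a c)))
        where
        undo : ∀ a b → b ≡ a + b - a
        undo = solve-∀
    correct : ∀ v → p (insert 0F j (proj₁ rest) ⟨$⟩ʳ v) ≡ q v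
    correct zero    = proj₂ preimage
    correct (suc v) = proj₂ rest v

open Encoding

-- From the extremal structure to membership in the family of the theorem.

open import Data.Nat using (_<_)

cyclic-edge : ∀ (i j : Fin 3) → (toℕ j ≡ᵇ (ℕ.suc (toℕ i) % 3)) ≡ isOut (j ⊝ i)
cyclic-edge = from-yes (all? λ (i : Fin 3) → all? λ (j : Fin 3) → (toℕ j ≡ᵇ (ℕ.suc (toℕ i) % 3)) Bool.≟ isOut (j ⊝ i))

B≡ : ∀ (u v : Fin n) → B n u v ≡ isOut (part₃ v ⊝ part₃ u)
B≡ u v = trans (cong₂ (λ i j → j ≡ᵇ (ℕ.suc i % 3)) (part≡toℕ u) (part≡toℕ v)) (cyclic-edge (part₃ u) (part₃ v))

⊝-self : ∀ i j → i ≡ j → j ⊝ i ≡ 0F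
⊝-self 0F _ refl = refl
⊝-self 1F _ refl = refl
⊝-self 2F _ refl = refl

isOut⇒≢ : ∀ i j → isOut (j ⊝ i) ≡ true → i ≢ j
isOut⇒≢ i j e i≡j with trans (sym e) (cong isOut (⊝-self i j i≡j))
... | ()

∨-true : ∀ a b → a ∨ b ≡ true → a ≡ true ⊎ b ≡ true
∨-true true  _ _ = inj₁ refl
∨-true false _ e = inj₂ e

∧-not-true : ∀ a b → a ∧ not b ≡ true → a ≡ true × b ≡ false
∧-not-true true false _ = refl , refl

-- Since the graph has no arc outside the blow-up, it is recovered by deleting from the blow-up
-- exactly those arcs that it lacks.
remove-some : ∀ r s → r ≡ 0F ⊎ r ≡ s → isOut r ≡ isOut s ∧ not (isOut s ∧ not (isOut r))
remove-some r s (inj₁ refl) with isOut s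
... | true  = refl
... | false = refl
remove-some r s (inj₂ refl) with isOut s
... | true  = refl
... | false = refl

module _ (G : OrientedGraph n) (p : Fin n → Fin 3) (extremal : Extremal (relOf G) p)
  (σ : Permutation′ n) (σ-part : ∀ v → p (σ ⟨$⟩ʳ v) ≡ part₃ v) where

  open Extremal extremal

  private
    ρ : Fin n → Fin n → Fin 3
    ρ u v = relOf G (σ ⟨$⟩ʳ u) (σ ⟨$⟩ʳ v)

    ρ-relation : ∀ u v → ρ u v ≡ 0F ⊎ ρ u v ≡ part₃ v ⊝ part₃ u
    ρ-relation u v = subst₂ (λ i j → ρ u v ≡ 0F ⊎ ρ u v ≡ j ⊝ i) (σ-part u) (σ-part v) (relation (σ ⟨$⟩ʳ u) (σ ⟨$⟩ʳ v))

    σ-injective : ∀ {u v} → u ≢ v → σ ⟨$⟩ʳ u ≢ σ ⟨$⟩ʳ v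
    σ-injective {u} {v} u≢v e = u≢v (trans (sym (inverseˡ σ)) (trans (cong (σ ⟨$⟩ˡ_) e) (inverseˡ σ)))

    one-part₃ : ∀ {u v w} → u ≢ v → v ≢ w → u ≢ w → ρ u v ≡ 0F → ρ v w ≡ 0F → ρ u w ≡ 0F → part₃ u ≡ part₃ v
    one-part₃ {u} {v} {w} u≢v v≢w u≢w a b c = subst₂ _≡_ (σ-part u) (σ-part v)
      (proj₁ (independent (σ-injective u≢v) (σ-injective v≢w) (σ-injective u≢w) a b c))

    flip-0 : ∀ {r s} → s ≡ flip r → r ≡ 0F → s ≡ 0F
    flip-0 refl refl = refl

  deleted : Fin n → Fin n → Bool
  deleted u v = B n u v ∧ not (adj G (σ ⟨$⟩ʳ u) (σ ⟨$⟩ʳ v))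

  deleted-arc : ∀ u v → deleted u v ≡ true → ρ u v ≡ 0F × part₃ u ≢ part₃ v
  deleted-arc u v e = nonadjacent (ρ-relation u v) , isOut⇒≢ (part₃ u) (part₃ v) out
    where
    both = ∧-not-true (B n u v) (adj G (σ ⟨$⟩ʳ u) (σ ⟨$⟩ʳ v)) e
    out : isOut (part₃ v ⊝ part₃ u) ≡ true
    out = trans (sym (B≡ u v)) (proj₁ both)
    nonadjacent : ρ u v ≡ 0F ⊎ ρ u v ≡ part₃ v ⊝ part₃ u → ρ u v ≡ 0F
    nonadjacent (inj₁ r) = r
    nonadjacent (inj₂ r) = contradiction (trans (sym out) (trans (cong isOut (sym r)) (trans (sym (adj-out G (σ ⟨$⟩ʳ u) (σ ⟨$⟩ʳ v))) (proj₂ both)))) λ ()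

  deleted-edge : ∀ u v → adjacent deleted u v ≡ true → ρ u v ≡ 0F × part₃ u ≢ part₃ v
  deleted-edge u v e = go (∨-true (deleted u v) (deleted v u) e)
    where
    go : deleted u v ≡ true ⊎ deleted v u ≡ true → ρ u v ≡ 0F × part₃ u ≢ part₃ v
    go (inj₁ d) = deleted-arc u v d
    go (inj₂ d) = flip-0 (relOf-anti G (σ ⟨$⟩ʳ v) (σ ⟨$⟩ʳ u)) (proj₁ (deleted-arc v u d)) , λ e → proj₂ (deleted-arc v u d) (sym e)

  deleted-subB : ∀ u v → deleted u v ≡ true → B n u v ≡ true
  deleted-subB u v e = proj₁ (∧-not-true (B n u v) (adj G (σ ⟨$⟩ʳ u) (σ ⟨$⟩ʳ v)) e)

  part-≢ : ∀ {u v} → part₃ {n} u ≢ part₃ v → u ≢ v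
  part-≢ h refl = h refl

  -- Vertices of one part are not adjacent, so two deleted arcs from `u` into the same part would
  -- give an independent triple that meets two parts.
  deleted-matching : ∀ u v w → adjacent deleted u v ≡ true → adjacent deleted u w ≡ true → part v ≡ part w → v ≡ w
  deleted-matching u v w uv uw e = go (v ≟ w)
    where
    same-part : part₃ v ≡ part₃ w
    same-part = toℕ-injective (trans (sym (part≡toℕ v)) (trans e (part≡toℕ w)))
    vw : ρ v w ≡ 0F ⊎ ρ v w ≡ part₃ w ⊝ part₃ v → ρ v w ≡ 0F
    vw (inj₁ r) = r
    vw (inj₂ r) = trans r (⊝-self (part₃ v) (part₃ w) same-part)
    d₁ = deleted-edge u v uv
    d₂ = deleted-edge u w uw
    go : Dec (v ≡ w) → v ≡ w
    go (yes v≡w) = v≡w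
    go (no v≢w)  = contradiction
      (one-part₃ (part-≢ (proj₂ d₁)) v≢w (part-≢ (proj₂ d₂)) (proj₁ d₁) (vw (ρ-relation v w)) (proj₁ d₂))
      (proj₂ d₁)

  -- A triangle of deleted arcs would likewise be an independent triple across the parts.
  deleted-triangleFree : ∀ u v w → adjacent deleted u v ≡ true → adjacent deleted v w ≡ true → adjacent deleted u w ≡ true → ⊥
  deleted-triangleFree u v w uv vw uw = proj₂ d₁
    (one-part₃ (part-≢ (proj₂ d₁)) (part-≢ (proj₂ d₂)) (part-≢ (proj₂ d₃)) (proj₁ d₁) (proj₁ d₂) (proj₁ d₃))
    where
    d₁ = deleted-edge u v uv
    d₂ = deleted-edge v w vw
    d₃ = deleted-edge u w uw

  extremal-InE : InE G
  extremal-InE = σ , deleted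
    , record { subB = deleted-subB ; matching = deleted-matching ; triangleFree = deleted-triangleFree }
    , λ u v → subst₂ (λ a b → a ≡ b ∧ not (b ∧ not a)) (sym (adj-out G (σ ⟨$⟩ʳ u) (σ ⟨$⟩ʳ v))) (sym (B≡ u v))
        (remove-some (ρ u v) (part₃ v ⊝ part₃ u) (ρ-relation u v))

structured⇒InE : (G : OrientedGraph n) → (∃ λ p → (∀ i → size p i ≡ size (part₃ {n}) i) × Extremal (relOf G) p) → InE G
structured⇒InE G (p , sizes , extremal) = from-permutation (equal-sizes⇒permutation p part₃ sizes)
  where
  from-permutation : Σ (Permutation′ _) (λ σ → ∀ v → p (σ ⟨$⟩ʳ v) ≡ part₃ v) → InE G
  from-permutation (σ , σ-part) = extremal-InE G p extremal σ σ-part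

2≤n/3 : threshold < n → ℤ.+ 2 ℤ.≤ ℤ.+ (n / 3)
2≤n/3 {n} large = ℤ.+≤+ (ℕ.≤-trans (ℕ.s≤s (ℕ.s≤s ℕ.z≤n)) (/-monoˡ-≤ 3 14≤n))
  where
  14≤n : 14 ℕ.≤ n
  14≤n = ℤ.drop‿+≤+ (Large.14≤N {ℤ.+ n} (subst (ℤ._≤ ℤ.+ n) bound≡ (ℤ.+≤+ (ℕ.<⇒≤ large))))

theorem1p5 : Σ ℕ λ n₀ → ∀ (n : ℕ) → n₀ < n →
    ∀ (G : OrientedGraph n) → IsMinimizer G → InE G
theorem1p5 = threshold , λ n large G minimizer →
  structured⇒InE G (Structure.structure large (relOf-anti G) (minimizer-optimal G minimizer)
    (ℤ.+ (n / 3)) (2≤n/3 large) (part₃ {n}) (size-part₃ n))
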